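{- Let $G$ be a finite simple graph with no isolated vertices and assume $\dim M(G)=1$, where $M(G)$ is the matching complex of $G$. (a) $M(G)$ is Cohen--Macaulay if and only if either (i) $G$ has exactly two connected components, each of which is either $K_3$ or a star graph, or (ii) $G$ is (up to isomorphism) in one of the families $\mathcal{G}_1,\mathcal{G}_2,\mathcal{G}_3$, or $G$ is the bowtie graph $B$. (b) $M(G)$ is Buchsbaum if and only if $G$ is a graph described in (a), or $G=K_4$, or $G=C_4$.
   Context: A matching in $G$ is a set of edges no two of which share an endpoint. $M(G)$ is the simplicial complex whose faces are all matchings of $G$ (its vertices are the edges of $G$); $\dim\sigma=|\sigma|-1$. A simplicial complex $\Delta$ is Buchsbaum if it is pure and for every nonempty face $\sigma$ the reduced homology $\tilde H_i(\mathrm{link}_\Delta\sigma)$ vanishes for all $i<\dim\Delta-|\sigma|$; it is Cohen--Macaulay if this vanishing holds also for $\sigma=\emptyset$. For a 1-dimensional $\Delta$ (a graph with at least one edge), this means: $\Delta$ is Buchsbaum iff it is a graph with no isolated vertices, and Cohen--Macaulay iff it is a connected graph. The star graph $S_n$ ($n\ge1$) has one center joined to $n$ leaves. Each family below is taken up to isomorphism and given by: vertices, required edges, optional edges (any subset may be included), and a set $U$ of vertices; one may moreover add any finite number (possibly zero) of new vertices, each joined to some nonempty subset of $U$ (and having no other neighbors). $\mathcal{G}_1$: vertices $1,\dots,5$; required $12,23,34,45$; optional $14,25$; $U=\{2,4\}$. $\mathcal{G}_2$: vertices $1,\dots,5$; required $12,23,13,34,45$; optional $14,24$; $U=\{4\}$.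 $\mathcal{G}_3$: vertices $1,\dots,5$; required $12,23,34,45,51$; optional $13,35,25,24,14$; $U=\emptyset$. Bowtie graph $B$: vertices $1,\dots,5$, edges $12,23,13,34,45,35$. -}

module Defs where

open import Algebra.Bundles using (CommutativeRing)
import Algebra.Properties.CommutativeMonoid.Sum as CommutativeMonoidSum
import Algebra.Properties.Semiring.Exp as SemiringExp
open import Data.Bool.Base using (if_then_else_)
open import Data.Empty using (⊥-elim) renaming (⊥ to False)
open import Data.Fin.Base using (Fin; zero; suc; _<_; splitAt)
open import Data.Fin.Patterns using (0F; 1F; 2F; 3F; 4F)
open import Data.Fin.Properties using (_≟_; _<?_; all?)
open import Data.Fin.Subset using
  (Subset; inside; outside; _∈_; _⊆_; _∪_; _∩_; ⁅_⁆; ⊥; ∣_∣; Empty; Nonempty)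
open import Data.Fin.Subset.Properties using
  (_∈?_; nonempty?; ∉⊥; ∪-identityˡ; x∈p∩q⁺; x∈p∩q⁻; x∈p∪q⁺; x∈p∪q⁻)
open import Data.Integer.Base as ℤ using (ℤ; +_; 1ℤ)
open import Data.List.Base as List using
  (List; []; _∷_; _++_; filter; cartesianProduct; allFin; length; lookup)
import Data.List.Membership.DecPropositional as DecMembership
import Data.List.Membership.Propositional as Membership
import Data.List.Relation.Binary.Subset.Propositional as ListSubset
open import Data.Nat.Base as ℕ using (ℕ)
open import Data.Product.Base using (Σ-syntax; ∃; ∃-syntax; ∃₂; _×_; _,_; proj₁; proj₂)
open import Data.Product.Properties using (≡-dec)
open import Data.Sum.Base as Sum using (_⊎_; inj₁; inj₂; swap)
open import Data.Vec.Base using (_∷_)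
open import Function.Base using (_∘_)
open import Function.Bundles using (_⇔_; _↔_; Inverse)
open import Function.Definitions using (Injective)
open import Level using (Level; 0ℓ; _⊔_)
open import Relation.Binary.Construct.Closure.ReflexiveTransitive using (Star)
open import Relation.Binary.Core using (Rel)
open import Relation.Binary.Definitions using (Decidable; Symmetric; Irreflexive)
open import Relation.Binary.PropositionalEquality using (_≡_; _≢_; refl; sym; subst)
open import Relation.Nullary using (¬_; no; does; ¬?; _×-dec_; _⊎-dec_; _→-dec_)
import Relation.Unary as U

-- The ground set Fin m may contain elements that are not vertices, i.e.
-- whose singleton is not a face; links use this.  ∅ is always a face.

record SimplicialComplex (m : ℕ) : Set₁ where
  field
    Face        : U.Pred (Subset m) 0ℓ
    face?       : U.Decidable Face
    ∅-face      : Face ⊥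
    down-closed : ∀ {σ τ} → σ ⊆ τ → Face τ → Face σ

open SimplicialComplex public

dim : ∀ {m} → Subset m → ℤ
dim σ = + ∣ σ ∣ ℤ.- 1ℤ

infix 4 _HasDim_

_HasDim_ : ∀ {m} → SimplicialComplex m → ℤ → Set
Δ HasDim d = (∃[ σ ] Face Δ σ × dim σ ≡ d) × (∀ σ → Face Δ σ → dim σ ℤ.≤ d)

IsFacet : ∀ {m} → SimplicialComplex m → Subset m → Set
IsFacet Δ σ = Face Δ σ × (∀ τ → Face Δ τ → σ ⊆ τ → τ ≡ σ)

Pure : ∀ {m} → SimplicialComplex m → Set
Pure Δ = ∀ σ τ → IsFacet Δ σ → IsFacet Δ τ → dim σ ≡ dim τ

link : ∀ {m} (Δ : SimplicialComplex m) (σ : Subset m) → Face Δ σ → SimplicialComplex m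
link Δ σ σ∈Δ = record
  { Face        = λ τ → Empty (τ ∩ σ) × Face Δ (τ ∪ σ)
  ; face?       = λ τ → ¬? (nonempty? (τ ∩ σ)) ×-dec face? Δ (τ ∪ σ)
  ; ∅-face      = (λ (_ , x∈) → ∉⊥ (proj₁ (x∈p∩q⁻ ⊥ σ x∈)))
                , subst (Face Δ) (sym (∪-identityˡ σ)) σ∈Δ
  ; down-closed = λ {ρ} {τ} ρ⊆τ (disjoint , τ∪σ∈Δ) →
      (λ (x , x∈) → let x∈ρ , x∈σ = x∈p∩q⁻ ρ σ x∈ in disjoint (x , x∈p∩q⁺ (ρ⊆τ x∈ρ , x∈σ)))
    , down-closed Δ (x∈p∪q⁺ ∘ Sum.map₁ ρ⊆τ ∘ x∈p∪q⁻ ρ σ) τ∪σ∈Δ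
  }

-- The number of elements of τ smaller than v.

countBelow : ∀ {m} → Fin m → Subset m → ℕ
countBelow zero    _             = 0
countBelow (suc v) (inside  ∷ τ) = ℕ.suc (countBelow v τ)
countBelow (suc v) (outside ∷ τ) = countBelow v τ

module _ {c ℓ : Level} (R : CommutativeRing c ℓ) where
  open CommutativeRing R
  open CommutativeMonoidSum +-commutativeMonoid using (sum)
  open SemiringExp semiring using (_^_)

  -- An i-chain is given by its coefficients, and is supported on the
  -- i-dimensional faces.  The (-1)-chains are the multiples of ∅.

  IsChain : ∀ {m} → SimplicialComplex m → ℤ → (Subset m → Carrier) → Set ℓ
  IsChain Δ i x = ∀ σ → ¬ (Face Δ σ × dim σ ≡ i) → x σ ≈ 0#

  -- The linear extension of  ∂ {v₀ < … < vᵢ} = Σⱼ (-1)ʲ {v₀ < … < vᵢ} ∖ {vⱼ},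
  -- written coefficientwise: the coefficient of τ collects the faces τ ∪ {v}
  -- with v ∉ τ.  On 0-chains this is the augmentation map, as ∂ {v} = ∅.

  ∂ : ∀ {m} → (Subset m → Carrier) → Subset m → Carrier
  ∂ x τ = sum λ v →
    if does (v ∈? τ) then 0# else (- 1#) ^ countBelow v τ * x (τ ∪ ⁅ v ⁆)

  ReducedHomologyVanishes : ∀ {m} → SimplicialComplex m → ℤ → Set (c ⊔ ℓ)
  ReducedHomologyVanishes {m} Δ i =
    ∀ (x : Subset m → Carrier) → IsChain Δ i x → (∀ τ → ∂ x τ ≈ 0#) →
    Σ[ y ∈ (Subset m → Carrier) ] IsChain Δ (ℤ.suc i) y × (∀ σ → ∂ y σ ≈ x σ)

  LinkHomologyVanishes : ∀ {m} (Δ : SimplicialComplex m) (σ : Subset m) → Face Δ σ → Set (c ⊔ ℓ)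
  LinkHomologyVanishes Δ σ σ∈Δ =
    ∀ d → Δ HasDim d → ∀ i → i ℤ.< d ℤ.- + ∣ σ ∣ → ReducedHomologyVanishes (link Δ σ σ∈Δ) i

  Buchsbaum : ∀ {m} → SimplicialComplex m → Set (c ⊔ ℓ)
  Buchsbaum Δ = Pure Δ × (∀ σ (σ∈Δ : Face Δ σ) → Nonempty σ → LinkHomologyVanishes Δ σ σ∈Δ)

  CohenMacaulay : ∀ {m} → SimplicialComplex m → Set (c ⊔ ℓ)
  CohenMacaulay Δ = Buchsbaum Δ × LinkHomologyVanishes Δ ⊥ (∅-face Δ)

record Graph (n : ℕ) : Set₁ where
  field
    Adj    : Rel (Fin n) 0ℓ
    adj?   : Decidable Adj
    symm   : Symmetric Adj
    irrefl : Irreflexive _≡_ Adj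

open Graph public

NoIsolatedVertices : ∀ {n} → Graph n → Set
NoIsolatedVertices G = ∀ v → ∃[ w ] Adj G v w

infix 4 _≅_

_≅_ : ∀ {m n} → Graph m → Graph n → Set
_≅_ {m} {n} G H =
  Σ[ f ∈ Fin m ↔ Fin n ] ∀ u v → Adj G u v ⇔ Adj H (Inverse.to f u) (Inverse.to f v)

-- The subgraph of G induced on C is isomorphic to H.

infix 4 _[_]≅_

_[_]≅_ : ∀ {m n} → Graph n → Subset n → Graph m → Set
_[_]≅_ {m} {n} G C H =
  Σ[ f ∈ (Fin m → Fin n) ]
    Injective _≡_ _≡_ f ×
    (∀ v → v ∈ C ⇔ (∃[ i ] f i ≡ v)) ×
    (∀ i j → Adj H i j ⇔ Adj G (f i) (f j))

IsComponent : ∀ {n} → Graph n → Subset n → Set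
IsComponent G C = ∃[ v ] ∀ w → w ∈ C ⇔ Star (Adj G) v w

-- Each edge occurs once, as the pair (u , v) with u < v.

edges : ∀ {n} → Graph n → List (Fin n × Fin n)
edges {n} G =
  filter (λ (u , v) → (u <? v) ×-dec adj? G u v) (cartesianProduct (allFin n) (allFin n))

Edge : ∀ {n} → Graph n → Set
Edge G = Fin (length (edges G))

Endpoint : ∀ {n} (G : Graph n) → Fin n → Edge G → Set
Endpoint G v e = v ≡ proj₁ (lookup (edges G) e) ⊎ v ≡ proj₂ (lookup (edges G) e)

endpoint? : ∀ {n} (G : Graph n) → Decidable (Endpoint G)
endpoint? G v e = (v ≟ _) ⊎-dec (v ≟ _)

IsMatching : ∀ {n} (G : Graph n) → Subset (length (edges G)) → Set
IsMatching {n} G σ =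
  ∀ e f → e ∈ σ → f ∈ σ → e ≢ f → ∀ (v : Fin n) → ¬ (Endpoint G v e × Endpoint G v f)

isMatching? : ∀ {n} (G : Graph n) → U.Decidable (IsMatching G)
isMatching? G σ = all? λ e → all? λ f →
  (e ∈? σ) →-dec ((f ∈? σ) →-dec (¬? (e ≟ f) →-dec
    all? λ v → ¬? (endpoint? G v e ×-dec endpoint? G v f)))

matchingComplex : ∀ {n} (G : Graph n) → SimplicialComplex (length (edges G))
matchingComplex G = record
  { Face        = IsMatching G
  ; face?       = isMatching? G
  ; ∅-face      = λ _ _ e∈∅ → ⊥-elim (∉⊥ e∈∅)
  ; down-closed = λ σ⊆τ matching e f e∈σ f∈σ →
      matching e f (σ⊆τ e∈σ) (σ⊆τ f∈σ)
  }

module _ {n : ℕ} where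
  open Membership {A = Fin n × Fin n} using () renaming (_∈_ to _∈ˡ_)
  open DecMembership {A = Fin n × Fin n} (≡-dec _≟_ _≟_) using () renaming (_∈?_ to _∈ˡ?_)

  Joined : List (Fin n × Fin n) → Rel (Fin n) 0ℓ
  Joined es u v = u ≢ v × ((u , v) ∈ˡ es ⊎ (v , u) ∈ˡ es)

  joined? : (es : List (Fin n × Fin n)) → Decidable (Joined es)
  joined? es u v = ¬? (u ≟ v) ×-dec (((u , v) ∈ˡ? es) ⊎-dec ((v , u) ∈ˡ? es))

  joined-sym : (es : List (Fin n × Fin n)) → Symmetric (Joined es)
  joined-sym es (u≢v , uv) = u≢v ∘ sym , swap uv

fromEdges : ∀ n → List (Fin n × Fin n) → Graph n
fromEdges n es = record
  { Adj    = Joined es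
  ; adj?   = joined? es
  ; symm   = joined-sym es
  ; irrefl = λ u≡v (u≢v , _) → u≢v u≡v
  }

complete : ∀ n → Graph n
complete n = record
  { Adj    = _≢_
  ; adj?   = λ u v → ¬? (u ≟ v)
  ; symm   = λ u≢v → u≢v ∘ sym
  ; irrefl = λ u≡v u≢v → u≢v u≡v
  }

-- The center is zero, so star n has n leaves.

star : ∀ n → Graph (ℕ.suc n)
star n = fromEdges (ℕ.suc n) (List.map (λ i → zero , suc i) (allFin n))

C₄ : Graph 4
C₄ = fromEdges 4 ((0F , 1F) ∷ (1F , 2F) ∷ (2F , 3F) ∷ (3F , 0F) ∷ [])

-- On five vertices, eij joins the vertices numbered i and j when counting
-- from 1.

e12 e13 e14 e23 e24 e25 e34 e35 e45 e51 : Fin 5 × Fin 5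
e12 = 0F , 1F
e13 = 0F , 2F
e14 = 0F , 3F
e23 = 1F , 2F
e24 = 1F , 3F
e25 = 1F , 4F
e34 = 2F , 3F
e35 = 2F , 4F
e45 = 3F , 4F
e51 = 4F , 0F

bowtie : Graph 5
bowtie = fromEdges 5 (e12 ∷ e23 ∷ e13 ∷ e34 ∷ e45 ∷ e35 ∷ [])

record Family : Set where
  field
    required optional : List (Fin 5 × Fin 5)
    attach            : Subset 5

-- The graph on Fin 5 with edges es, together with k new vertices, the j-th
-- of which has neighbourhood N j.

module _ (es : List (Fin 5 × Fin 5)) {k : ℕ} (N : Fin k → Subset 5) where

  ExtAdj : Rel (Fin 5 ⊎ Fin k) 0ℓ
  ExtAdj (inj₁ u) (inj₁ v) = Joined es u v
  ExtAdj (inj₁ u) (inj₂ j) = u ∈ N j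
  ExtAdj (inj₂ j) (inj₁ u) = u ∈ N j
  ExtAdj (inj₂ _) (inj₂ _) = False

  extAdj? : Decidable ExtAdj
  extAdj? (inj₁ u) (inj₁ v) = joined? es u v
  extAdj? (inj₁ u) (inj₂ j) = u ∈? N j
  extAdj? (inj₂ j) (inj₁ u) = u ∈? N j
  extAdj? (inj₂ _) (inj₂ _) = no λ ()

  extAdj-sym : Symmetric ExtAdj
  extAdj-sym {inj₁ u} {inj₁ v} uv = joined-sym es uv
  extAdj-sym {inj₁ u} {inj₂ j} uj = uj
  extAdj-sym {inj₂ j} {inj₁ u} ju = ju

  extAdj-irrefl : ∀ x → ¬ ExtAdj x x
  extAdj-irrefl (inj₁ u) (u≢u , _) = u≢u refl

  extend : Graph (5 ℕ.+ k)
  extend = record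
    { Adj    = λ x y → ExtAdj (splitAt 5 x) (splitAt 5 y)
    ; adj?   = λ x y → extAdj? (splitAt 5 x) (splitAt 5 y)
    ; symm   = λ {x} {y} → extAdj-sym {splitAt 5 x} {splitAt 5 y}
    ; irrefl = λ { {x} refl → extAdj-irrefl (splitAt 5 x) }
    }

open ListSubset using () renaming (_⊆_ to _⊆ˡ_)

_∈ᶠ_ : ∀ {n} → Graph n → Family → Set
G ∈ᶠ F =
  ∃[ chosen ] chosen ⊆ˡ optional ×
  ∃[ k ] Σ[ N ∈ (Fin k → Subset 5) ]
    (∀ j → N j ⊆ attach × Nonempty (N j)) ×
    G ≅ extend (required ++ chosen) N
  where open Family F

𝒢₁ 𝒢₂ 𝒢₃ : Family
𝒢₁ = record
  { required = e12 ∷ e23 ∷ e34 ∷ e45 ∷ []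
  ; optional = e14 ∷ e25 ∷ []
  ; attach   = ⁅ 1F ⁆ ∪ ⁅ 3F ⁆
  }
𝒢₂ = record
  { required = e12 ∷ e23 ∷ e13 ∷ e34 ∷ e45 ∷ []
  ; optional = e14 ∷ e24 ∷ []
  ; attach   = ⁅ 3F ⁆
  }
𝒢₃ = record
  { required = e12 ∷ e23 ∷ e34 ∷ e45 ∷ e51 ∷ []
  ; optional = e13 ∷ e35 ∷ e25 ∷ e24 ∷ e14 ∷ []
  ; attach   = ⊥
  }

IsTriangleOrStar : ∀ {n} → Graph n → Subset n → Set
IsTriangleOrStar G C = G [ C ]≅ complete 3 ⊎ (∃[ k ] 1 ℕ.≤ k × G [ C ]≅ star k)

TwoTriangleOrStarComponents : ∀ {n} → Graph n → Set
TwoTriangleOrStarComponents G = ∃₂ λ C D →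
  IsComponent G C × IsComponent G D × C ≢ D ×
  (∀ E → IsComponent G E → E ≡ C ⊎ E ≡ D) ×
  IsTriangleOrStar G C × IsTriangleOrStar G D

InFamiliesOrBowtie : ∀ {n} → Graph n → Set
InFamiliesOrBowtie G = G ∈ᶠ 𝒢₁ ⊎ G ∈ᶠ 𝒢₂ ⊎ G ∈ᶠ 𝒢₃ ⊎ G ≅ bowtie

{-# OPTIONS --safe #-}

-- As M(G) is one-dimensional, it is Buchsbaum iff every edge of G is disjoint
-- from some other edge, and Cohen–Macaulay iff moreover the disjointness graph on
-- the edges is connected.  The reduced 0-cycles are generated
-- by differences of two vertices, which bound when the vertices are joined by a
-- path; conversely a colour class that no 1-face leaves gives a functional killing
-- all boundaries.
--
-- For the classification let ab, cd be two disjoint edges; the vertices outside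
-- {a, b, c, d} are independent, as there are no three disjoint edges.  The absence
-- of augmenting paths shows that, for ab as for cd, either some outside vertex is
-- joined to both ends, or one end has no outside neighbour.  Chasing these cases, G
-- has a vertex cover of size two (giving two stars, 𝒢₁ or C₄), or consists of a
-- triangle and a vertex u such that all further edges contain u (giving K₄, 𝒢₂ or a
-- triangle and a star), or is a pair of triangles, or has five vertices and is
-- Hamiltonian (𝒢₃) or the bowtie.
module Submission where

open import Defs
open import Algebra.Bundles using (CommutativeRing)
import Algebra.Properties.Ring as RingProperties
import Algebra.Properties.Semiring.Exp as SemiringExp
import Algebra.Properties.Semiring.Sum as SemiringSum
open import Data.Bool.Base using (Bool; true; false; if_then_else_)
import Data.Bool.Properties as Bool
open import Data.Empty using (⊥-elim) renaming (⊥ to False)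
open import Data.Fin.Base using (Fin; zero; suc; toℕ; _<_; splitAt; _↑ˡ_; _↑ʳ_)
open import Data.Fin.Patterns using (0F; 1F; 2F; 3F; 4F)
import Data.Fin.Properties as Fin
open import Data.Fin.Properties using
  (_≟_; _<?_; <-cmp; any?; all?; suc-injective;
   splitAt-↑ˡ; splitAt-↑ʳ; splitAt⁻¹-↑ˡ; splitAt⁻¹-↑ʳ)
open import Data.Fin.Subset using
  (Subset; inside; outside; _∈_; _∉_; _⊆_; _⊂_; _∪_; ⁅_⁆; ⊥; ∣_∣; Nonempty)
open import Data.Fin.Subset.Properties using
  (_∈?_; ∉⊥; x∈⁅x⁆; x∈⁅y⁆⇒x≡y; ∣⁅x⁆∣≡1; ∣⊥∣≡0; Empty-unique; ⊆-antisym; p⊂q⇒∣p∣<∣q∣;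
   ∪-identityˡ; ∪-identityʳ; ∪-comm; ∪-assoc; x∈p∪q⁻; x∈p∩q⁻; p⊆p∪q; q⊆p∪q)
open import Data.Integer.Base as ℤ using (ℤ; +_; -[1+_])
import Data.Integer.Properties as ℤ
open import Data.List.Base as List using (List; []; _∷_; _++_; length; filter; cartesianProduct; allFin)
open import Data.List.Membership.Propositional using () renaming (_∈_ to _∈ˡ_)
open import Data.List.Membership.Propositional.Properties using
  (∈-filter⁺; ∈-filter⁻; ∈-lookup; ∈-cartesianProduct⁺; ∈-allFin;
   ∈-++⁺ˡ; ∈-++⁺ʳ; ∈-++⁻; ∈-map⁺; ∈-map⁻)
open import Data.List.Relation.Binary.Subset.Propositional using () renaming (_⊆_ to _⊆ˡ_)
open import Data.List.Relation.Unary.All as All using (All; []; _∷_)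
open import Data.List.Relation.Unary.Any as Any using (here; there)
import Data.List.Relation.Unary.Any.Properties as Any
open import Data.Nat.Base as ℕ using (ℕ)
import Data.Nat.Properties as ℕ
open import Data.Product.Base using (Σ-syntax; ∃; ∃-syntax; ∃₂; _×_; _,_; proj₁; proj₂; swap)
open import Data.Sum.Base as Sum using (_⊎_; inj₁; inj₂; [_,_]′)
open import Data.Vec.Base using (Vec; []; _∷_; here; there; lookup; tabulate)
import Data.Vec.Properties as Vec
open import Data.Vec.Properties using (lookup∘tabulate; []=⇒lookup; lookup⇒[]=)
open import Data.Vec.Relation.Unary.All using ([]; _∷_)
open import Data.Vec.Relation.Unary.AllPairs using ([]; _∷_)
open import Data.Vec.Relation.Unary.Unique.Propositional using (Unique)
open import Data.Vec.Relation.Unary.Unique.Propositional.Properties using (lookup-injective)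
open import Function.Base using (_∘_; case_of_)
open import Function.Bundles using (_⇔_; Equivalence; Inverse; mk⇔; mk↔ₛ′)
open import Function.Definitions using (Injective)
open import Level using (0ℓ)
open import Relation.Binary.Construct.Closure.ReflexiveTransitive as Star using (Star; ε; _◅_; _◅◅_)
open import Relation.Binary.Construct.Closure.Transitive using (TransClosure; [_]; _∷_)
open import Relation.Binary.Definitions using (tri<; tri≈; tri>)
open import Relation.Binary.PropositionalEquality as ≡ using (_≡_; _≢_; cong; subst)
open import Relation.Nullary using
  (¬_; Dec; yes; no; does; contradiction; ¬?; _×-dec_; _⊎-dec_; _→-dec_)
open import Relation.Nullary.Decidable using
  (True; toWitness; from-yes; from-no; dec-true; decidable-stable; ¬¬-excluded-middle)
open import Relation.Unary using (Pred; Decidable)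

-- One classification serves both parts. Cohen-Macaulay includes Buchsbaum, so (a) follows from the
-- list in (b) once the graphs of (a) are shown to have a connected disjointness graph and `K₄`,
-- `C₄` are excluded. On four vertices two disjoint edges are complementary, so no edge has two
-- partners: the complex consists of pairwise disjoint segments, three for `K₄` and two for `C₄`.
--
-- The ring `R` is an arbitrary nontrivial commutative ring. Vanishing is therefore shown by
-- explicit bounding chains, and non-vanishing by a functional with 0/1 weights that takes the value
-- 1, which nontriviality keeps apart from 0.
--
-- Constructively, a path between two edges cannot be had by denying a separation. Each listed graph
-- gets explicit short routes to one root edge, and the two exceptions get an explicit 2-colouring.
-- Graph arguments use ordered pairs of vertices instead of positions in `edges`, which keeps them
-- free of the order on `Fin n`.

-- Subsets with at most two elements

_≟ˢ_ : ∀ {m} (σ τ : Subset m) → Dec (σ ≡ τ)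
_≟ˢ_ = Vec.≡-dec Bool._≟_

∣σ∣≡0⇒σ≡⊥ : ∀ {m} (σ : Subset m) → ∣ σ ∣ ≡ 0 → σ ≡ ⊥
∣σ∣≡0⇒σ≡⊥ []            _  = ≡.refl
∣σ∣≡0⇒σ≡⊥ (outside ∷ σ) eq = cong (outside ∷_) (∣σ∣≡0⇒σ≡⊥ σ eq)

∣σ∣≡1⇒singleton : ∀ {m} (σ : Subset m) → ∣ σ ∣ ≡ 1 → ∃[ v ] σ ≡ ⁅ v ⁆
∣σ∣≡1⇒singleton (inside ∷ σ)  eq = zero , cong (inside ∷_) (∣σ∣≡0⇒σ≡⊥ σ (cong ℕ.pred eq))
∣σ∣≡1⇒singleton (outside ∷ σ) eq =
  let v , σ≡ = ∣σ∣≡1⇒singleton σ eq in suc v , cong (outside ∷_) σ≡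

∣σ∣≡2⇒pair : ∀ {m} (σ : Subset m) → ∣ σ ∣ ≡ 2 → ∃[ u ] ∃[ v ] u ≢ v × σ ≡ ⁅ u ⁆ ∪ ⁅ v ⁆
∣σ∣≡2⇒pair (inside ∷ σ)  eq =
  let v , σ≡ = ∣σ∣≡1⇒singleton σ (cong ℕ.pred eq)
  in zero , suc v , (λ ()) , cong (inside ∷_) (≡.trans σ≡ (≡.sym (∪-identityˡ ⁅ v ⁆)))
∣σ∣≡2⇒pair (outside ∷ σ) eq =
  let u , v , u≢v , σ≡ = ∣σ∣≡2⇒pair σ eq
  in suc u , suc v , u≢v ∘ suc-injective , cong (outside ∷_) σ≡

∣pair∣≡2 : ∀ {m} (u v : Fin m) → u ≢ v → ∣ ⁅ u ⁆ ∪ ⁅ v ⁆ ∣ ≡ 2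
∣pair∣≡2 zero    zero    u≢v = contradiction ≡.refl u≢v
∣pair∣≡2 zero    (suc v) u≢v =
  cong ℕ.suc (≡.trans (cong ∣_∣ (∪-identityˡ ⁅ v ⁆)) (∣⁅x⁆∣≡1 v))
∣pair∣≡2 (suc u) zero    u≢v =
  cong ℕ.suc (≡.trans (cong ∣_∣ (∪-identityʳ ⁅ u ⁆)) (∣⁅x⁆∣≡1 u))
∣pair∣≡2 (suc u) (suc v) u≢v = ∣pair∣≡2 u v (u≢v ∘ cong suc)

countBelow-⊥ : ∀ {m} (v : Fin m) → countBelow v ⊥ ≡ 0
countBelow-⊥ zero    = ≡.refl
countBelow-⊥ (suc v) = countBelow-⊥ v

-- Exactly one of `u`, `v` is the smaller. This is the source of the opposite signs of the two ends
-- of a 1-face; covering both orders spares later lemmas from sorting the pair.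
countBelow-singletons : ∀ {m} (u v : Fin m) → u ≢ v →
  (countBelow u ⁅ v ⁆ ≡ 0 × countBelow v ⁅ u ⁆ ≡ 1) ⊎
  (countBelow u ⁅ v ⁆ ≡ 1 × countBelow v ⁅ u ⁆ ≡ 0)
countBelow-singletons zero    zero    u≢v = contradiction ≡.refl u≢v
countBelow-singletons zero    (suc v) u≢v = inj₁ (≡.refl , cong ℕ.suc (countBelow-⊥ v))
countBelow-singletons (suc u) zero    u≢v = inj₂ (cong ℕ.suc (countBelow-⊥ u) , ≡.refl)
countBelow-singletons (suc u) (suc v) u≢v = countBelow-singletons u v (u≢v ∘ cong suc)

∈pair : ∀ {m} {u v x : Fin m} → x ∈ ⁅ u ⁆ ∪ ⁅ v ⁆ → x ≡ u ⊎ x ≡ v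
∈pair {u = u} {v} x∈ with x∈p∪q⁻ ⁅ u ⁆ ⁅ v ⁆ x∈
... | inj₁ x∈u = inj₁ (x∈⁅y⁆⇒x≡y u x∈u)
... | inj₂ x∈v = inj₂ (x∈⁅y⁆⇒x≡y v x∈v)

-- The coefficient of `τ` in a boundary collects the faces `τ ∪ ⁅ w ⁆` with `w ∉ τ`. Solving
-- `τ ∪ ⁅ w ⁆ ≡ σ` thus tells where a basis chain `σ` contributes; here for a vertex, next for a
-- 1-face.
remove-from-singleton : ∀ {m} {τ : Subset m} {v w} → w ∉ τ → τ ∪ ⁅ w ⁆ ≡ ⁅ v ⁆ → w ≡ v × τ ≡ ⊥
remove-from-singleton {τ = τ} {v} {w} w∉τ eq = w≡v , Empty-unique λ (x , x∈τ) → w∉τ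
  (subst (_∈ τ) (≡.trans (x∈⁅y⁆⇒x≡y v (subst (x ∈_) eq (p⊆p∪q ⁅ w ⁆ x∈τ))) (≡.sym w≡v)) x∈τ)
  where
  w≡v : w ≡ v
  w≡v = x∈⁅y⁆⇒x≡y v (subst (w ∈_) eq (q⊆p∪q τ ⁅ w ⁆ (x∈⁅x⁆ w)))

remove-from-pair : ∀ {m} {τ : Subset m} {u v w} → w ∉ τ → τ ∪ ⁅ w ⁆ ≡ ⁅ u ⁆ ∪ ⁅ v ⁆ → u ≢ v →
                   (w ≡ v × τ ≡ ⁅ u ⁆) ⊎ (w ≡ u × τ ≡ ⁅ v ⁆)
remove-from-pair {τ = τ} {u} {v} {w} w∉τ eq u≢v
  with ∈pair (subst (w ∈_) eq (q⊆p∪q τ ⁅ w ⁆ (x∈⁅x⁆ w)))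
... | inj₁ ≡.refl = inj₂ (≡.refl , ⊆-antisym τ⊆ ⊆τ)
  where
  τ⊆ : τ ⊆ ⁅ v ⁆
  τ⊆ {x} x∈τ with ∈pair (subst (x ∈_) eq (p⊆p∪q ⁅ w ⁆ x∈τ))
  ... | inj₁ ≡.refl = contradiction x∈τ w∉τ
  ... | inj₂ ≡.refl = x∈⁅x⁆ x
  ⊆τ : ⁅ v ⁆ ⊆ τ
  ⊆τ {x} x∈v with x∈p∪q⁻ τ ⁅ u ⁆ (subst (x ∈_) (≡.sym eq) (q⊆p∪q ⁅ u ⁆ ⁅ v ⁆ x∈v))
  ... | inj₁ x∈τ = x∈τ
  ... | inj₂ x∈u = contradiction (≡.trans (≡.sym (x∈⁅y⁆⇒x≡y u x∈u)) (x∈⁅y⁆⇒x≡y v x∈v)) u≢v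
... | inj₂ ≡.refl = inj₁ (≡.refl , ⊆-antisym τ⊆ ⊆τ)
  where
  τ⊆ : τ ⊆ ⁅ u ⁆
  τ⊆ {x} x∈τ with ∈pair (subst (x ∈_) eq (p⊆p∪q ⁅ w ⁆ x∈τ))
  ... | inj₁ ≡.refl = x∈⁅x⁆ x
  ... | inj₂ ≡.refl = contradiction x∈τ w∉τ
  ⊆τ : ⁅ u ⁆ ⊆ τ
  ⊆τ {x} x∈u with x∈p∪q⁻ τ ⁅ v ⁆ (subst (x ∈_) (≡.sym eq) (p⊆p∪q ⁅ v ⁆ x∈u))
  ... | inj₁ x∈τ = x∈τ
  ... | inj₂ x∈v = contradiction (≡.trans (≡.sym (x∈⁅y⁆⇒x≡y u x∈u)) (x∈⁅y⁆⇒x≡y v x∈v)) u≢v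

dim≡0⇒singleton : ∀ {m} (σ : Subset m) → dim σ ≡ + 0 → ∃[ v ] σ ≡ ⁅ v ⁆
dim≡0⇒singleton σ eq = ∣σ∣≡1⇒singleton σ (go ∣ σ ∣ eq)
  where
  go : ∀ k → + k ℤ.- ℤ.1ℤ ≡ + 0 → k ≡ 1
  go 1 _ = ≡.refl

dim≡-1⇒⊥ : ∀ {m} (σ : Subset m) → dim σ ≡ -[1+ 0 ] → σ ≡ ⊥
dim≡-1⇒⊥ σ eq = ∣σ∣≡0⇒σ≡⊥ σ (go ∣ σ ∣ eq)
  where
  go : ∀ k → + k ℤ.- ℤ.1ℤ ≡ -[1+ 0 ] → k ≡ 0
  go 0 _ = ≡.refl

dim≥-1 : ∀ {m} (σ : Subset m) k → dim σ ≢ -[1+ ℕ.suc k ]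
dim≥-1 σ k = go ∣ σ ∣
  where
  go : ∀ j → + j ℤ.- ℤ.1ℤ ≢ -[1+ ℕ.suc k ]
  go 0 ()
  go (ℕ.suc j) ()

dim-singleton : ∀ {m} (v : Fin m) → dim ⁅ v ⁆ ≡ + 0
dim-singleton v = cong (λ k → + k ℤ.- ℤ.1ℤ) (∣⁅x⁆∣≡1 v)

dim-pair : ∀ {m} (u v : Fin m) → u ≢ v → dim (⁅ u ⁆ ∪ ⁅ v ⁆) ≡ + 1
dim-pair u v u≢v = cong (λ k → + k ℤ.- ℤ.1ℤ) (∣pair∣≡2 u v u≢v)

-- Adjacency in the 1-skeleton. Without `u ≢ v` the union could collapse to a singleton and a vertex
-- would be linked to itself.
LinkedIn : ∀ {m} → SimplicialComplex m → Fin m → Fin m → Set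
LinkedIn Δ u v = u ≢ v × Face Δ (⁅ u ⁆ ∪ ⁅ v ⁆)

-- Reduced homology in degree at most zero

module Homology {c ℓ} (R : CommutativeRing c ℓ) where
  open CommutativeRing R hiding (zero)
  open RingProperties ring using (-‿involutive; -1*x≈-x)
  open SemiringExp semiring using (_^_)
  open SemiringSum semiring using
    (sum; sum-cong-≋; sum-replicate-zero; ∑-distrib-+; *-distribˡ-sum; *-distribʳ-sum)
  open import Relation.Binary.Reasoning.Setoid setoid

  private variable m : ℕ

  sum-zero : ∀ {k} {f : Fin k → Carrier} → (∀ i → f i ≈ 0#) → sum f ≈ 0#
  sum-zero {k} f≈0 = trans (sum-cong-≋ f≈0) (sum-replicate-zero k)

  sum-concentrated : ∀ {k} {f : Fin k → Carrier} i → (∀ j → j ≢ i → f j ≈ 0#) → sum f ≈ f i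
  sum-concentrated zero f≈0 =
    trans (+-congˡ (sum-zero λ j → f≈0 (suc j) λ ())) (+-identityʳ _)
  sum-concentrated (suc i) f≈0 =
    trans (+-cong (f≈0 zero λ ()) (sum-concentrated i λ j j≢i → f≈0 (suc j) (j≢i ∘ suc-injective)))
          (+-identityˡ _)

  -- The first row cancels against the first column, and the rest is smaller. The diagonal needs its
  -- own hypothesis because `a i i + a i i ≈ 0#` does not force `a i i ≈ 0#` in characteristic two.
  sum-alternating : ∀ {k} (a : Fin k → Fin k → Carrier) → (∀ i → a i i ≈ 0#) →
                    (∀ i j → a i j + a j i ≈ 0#) → sum (λ i → sum (a i)) ≈ 0#
  sum-alternating {ℕ.zero}  a diag alt = refl
  sum-alternating {ℕ.suc k} a diag alt = begin
    (a zero zero + sum top) + sum (λ i → left i + sum (rest i))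
      ≈⟨ +-cong (trans (+-congʳ (diag zero)) (+-identityˡ _)) (∑-distrib-+ left (λ i → sum (rest i))) ⟩
    sum top + (sum left + sum (λ i → sum (rest i)))
      ≈⟨ +-congˡ (trans (+-congˡ (sum-alternating rest (λ i → diag (suc i)) (λ i j → alt (suc i) (suc j))))
                        (+-identityʳ _)) ⟩
    sum top + sum left
      ≈⟨ ∑-distrib-+ top left ⟨
    sum (λ i → top i + left i)
      ≈⟨ sum-zero (λ i → alt zero (suc i)) ⟩
    0# ∎
    where
    top left : Fin k → Carrier
    top j  = a zero (suc j)
    left i = a (suc i) zero
    rest : Fin k → Fin k → Carrier
    rest i j = a (suc i) (suc j)

  sign : Fin m → Subset m → Carrier
  sign v τ = (- 1#) ^ countBelow v τ

  -- Definitionally the summand of `∂ R x τ`, so facts about it apply under `sum` without unfolding.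
  ∂-term : (Subset m → Carrier) → Subset m → Fin m → Carrier
  ∂-term x τ v = if does (v ∈? τ) then 0# else sign v τ * x (τ ∪ ⁅ v ⁆)

  ∂-term-∈ : ∀ (x : Subset m → Carrier) {τ v} → v ∈ τ → ∂-term x τ v ≈ 0#
  ∂-term-∈ x {τ} {v} v∈τ with v ∈? τ
  ... | yes _  = refl
  ... | no v∉τ = contradiction v∈τ v∉τ

  ∂-term-∉ : ∀ (x : Subset m → Carrier) {τ v} → v ∉ τ →
             ∂-term x τ v ≈ sign v τ * x (τ ∪ ⁅ v ⁆)
  ∂-term-∉ x {τ} {v} v∉τ with v ∈? τ
  ... | yes v∈τ = contradiction v∈τ v∉τ
  ... | no _    = refl

  ∂-term-zero : ∀ (x : Subset m → Carrier) {τ v} → (v ∉ τ → x (τ ∪ ⁅ v ⁆) ≈ 0#) →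
                ∂-term x τ v ≈ 0#
  ∂-term-zero x {τ} {v} x≈0 with v ∈? τ
  ... | yes _  = refl
  ... | no v∉τ = trans (*-congˡ (x≈0 v∉τ)) (zeroʳ _)

  ∂-+ : ∀ (x y : Subset m → Carrier) τ → ∂ R (λ σ → x σ + y σ) τ ≈ ∂ R x τ + ∂ R y τ
  ∂-+ x y τ = trans (sum-cong-≋ term) (∑-distrib-+ (∂-term x τ) (∂-term y τ))
    where
    term : ∀ v → ∂-term (λ σ → x σ + y σ) τ v ≈ ∂-term x τ v + ∂-term y τ v
    term v with v ∈? τ
    ... | yes _ = sym (+-identityˡ 0#)
    ... | no _  = distribˡ _ _ _

  ∂-* : ∀ a (x : Subset m → Carrier) τ → ∂ R (λ σ → a * x σ) τ ≈ a * ∂ R x τ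
  ∂-* a x τ = trans (sum-cong-≋ term) (sym (*-distribˡ-sum a (∂-term x τ)))
    where
    term : ∀ v → ∂-term (λ σ → a * x σ) τ v ≈ a * ∂-term x τ v
    term v with v ∈? τ
    ... | yes _ = sym (zeroʳ a)
    ... | no _  = trans (sym (*-assoc _ _ _)) (trans (*-congʳ (*-comm _ _)) (*-assoc _ _ _))

  sign-⊥ : ∀ (v : Fin m) → sign v ⊥ ≈ 1#
  sign-⊥ v = reflexive (cong ((- 1#) ^_) (countBelow-⊥ v))

  sign-singletons : ∀ (u v : Fin m) → u ≢ v →
    (sign u ⁅ v ⁆ ≈ 1# × sign v ⁅ u ⁆ ≈ - 1#) ⊎ (sign u ⁅ v ⁆ ≈ - 1# × sign v ⁅ u ⁆ ≈ 1#)
  sign-singletons u v u≢v with countBelow-singletons u v u≢v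
  ... | inj₁ (p , q) = inj₁ (reflexive (cong ((- 1#) ^_) p)
                            , trans (reflexive (cong ((- 1#) ^_) q)) (*-identityʳ _))
  ... | inj₂ (p , q) = inj₂ (trans (reflexive (cong ((- 1#) ^_) p)) (*-identityʳ _)
                            , reflexive (cong ((- 1#) ^_) q))

  single : Subset m → Carrier → Subset m → Carrier
  single σ a τ = if does (τ ≟ˢ σ) then a else 0#

  single-≡ : ∀ (σ : Subset m) a → single σ a σ ≈ a
  single-≡ σ a with σ ≟ˢ σ
  ... | yes _  = refl
  ... | no σ≢σ = contradiction ≡.refl σ≢σ

  single-≢ : ∀ (σ τ : Subset m) a → τ ≢ σ → single σ a τ ≈ 0#
  single-≢ σ τ a τ≢σ with τ ≟ˢ σ
  ... | yes τ≡σ = contradiction τ≡σ τ≢σ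
  ... | no _    = refl

  single-chain : ∀ (Δ : SimplicialComplex m) {σ i} a → Face Δ σ → dim σ ≡ i →
                 IsChain R Δ i (single σ a)
  single-chain Δ {σ} a σ∈Δ dimσ τ ¬τ = single-≢ σ τ a λ { ≡.refl → ¬τ (σ∈Δ , dimσ) }

  ∂-vertex : ∀ (v : Fin m) a τ → ∂ R (single ⁅ v ⁆ a) τ ≈ single ⊥ a τ
  ∂-vertex v a τ with τ ≟ˢ ⊥
  ... | yes ≡.refl = begin
    ∂ R (single ⁅ v ⁆ a) ⊥
      ≈⟨ sum-concentrated v (λ w w≢v → ∂-term-zero (single ⁅ v ⁆ a) {v = w} λ w∉τ →
           single-≢ ⁅ v ⁆ (⊥ ∪ ⁅ w ⁆) a λ eq → w≢v (proj₁ (remove-from-singleton w∉τ eq))) ⟩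
    ∂-term (single ⁅ v ⁆ a) ⊥ v
      ≈⟨ ∂-term-∉ (single ⁅ v ⁆ a) {v = v} ∉⊥ ⟩
    sign v ⊥ * single ⁅ v ⁆ a (⊥ ∪ ⁅ v ⁆)
      ≈⟨ *-cong (sign-⊥ v) (trans (reflexive (cong (single ⁅ v ⁆ a) (∪-identityˡ ⁅ v ⁆))) (single-≡ ⁅ v ⁆ a)) ⟩
    1# * a
      ≈⟨ *-identityˡ a ⟩
    a ∎
  ... | no τ≢⊥ = sum-zero λ w → ∂-term-zero (single ⁅ v ⁆ a) {v = w} λ w∉τ →
    single-≢ ⁅ v ⁆ (τ ∪ ⁅ w ⁆) a λ eq → τ≢⊥ (proj₂ (remove-from-singleton w∉τ eq))

  -- The face `⁅ u ⁆` arises by deleting `v` and so carries the sign of `v`, and conversely. The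
  -- order of the two vertices stays hidden in the signs.
  ∂-pair : ∀ (u v : Fin m) → u ≢ v → ∀ a τ → ∂ R (single (⁅ u ⁆ ∪ ⁅ v ⁆) a) τ ≈
           single ⁅ u ⁆ (sign v ⁅ u ⁆ * a) τ + single ⁅ v ⁆ (sign u ⁅ v ⁆ * a) τ
  ∂-pair u v u≢v a τ with τ ≟ˢ ⁅ u ⁆ | τ ≟ˢ ⁅ v ⁆
  ... | yes ≡.refl | yes eq = contradiction (x∈⁅y⁆⇒x≡y v (subst (u ∈_) eq (x∈⁅x⁆ u))) u≢v
  ... | yes ≡.refl | no τ≢v = begin
    ∂ R (single (⁅ u ⁆ ∪ ⁅ v ⁆) a) ⁅ u ⁆
      ≈⟨ sum-concentrated v (λ w w≢v → ∂-term-zero (single (⁅ u ⁆ ∪ ⁅ v ⁆) a) {v = w} λ w∉τ → single-≢ (⁅ u ⁆ ∪ ⁅ v ⁆) (⁅ u ⁆ ∪ ⁅ w ⁆) a λ eq →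
           [ (λ (w≡v , _) → w≢v w≡v) , (λ (_ , τ≡v) → τ≢v τ≡v) ]′ (remove-from-pair w∉τ eq u≢v)) ⟩
    ∂-term (single (⁅ u ⁆ ∪ ⁅ v ⁆) a) ⁅ u ⁆ v
      ≈⟨ ∂-term-∉ (single (⁅ u ⁆ ∪ ⁅ v ⁆) a) {v = v} (λ v∈u → u≢v (≡.sym (x∈⁅y⁆⇒x≡y u v∈u))) ⟩
    sign v ⁅ u ⁆ * single (⁅ u ⁆ ∪ ⁅ v ⁆) a (⁅ u ⁆ ∪ ⁅ v ⁆)
      ≈⟨ *-congˡ (single-≡ (⁅ u ⁆ ∪ ⁅ v ⁆) a) ⟩
    sign v ⁅ u ⁆ * a
      ≈⟨ +-identityʳ _ ⟨
    sign v ⁅ u ⁆ * a + 0# ∎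
  ... | no τ≢u | yes ≡.refl = begin
    ∂ R (single (⁅ u ⁆ ∪ ⁅ v ⁆) a) ⁅ v ⁆
      ≈⟨ sum-concentrated u (λ w w≢u → ∂-term-zero (single (⁅ u ⁆ ∪ ⁅ v ⁆) a) {v = w} λ w∉τ → single-≢ (⁅ u ⁆ ∪ ⁅ v ⁆) (⁅ v ⁆ ∪ ⁅ w ⁆) a λ eq →
           [ (λ (_ , τ≡u) → τ≢u τ≡u) , (λ (w≡u , _) → w≢u w≡u) ]′ (remove-from-pair w∉τ eq u≢v)) ⟩
    ∂-term (single (⁅ u ⁆ ∪ ⁅ v ⁆) a) ⁅ v ⁆ u
      ≈⟨ ∂-term-∉ (single (⁅ u ⁆ ∪ ⁅ v ⁆) a) {v = u} (λ u∈v → u≢v (x∈⁅y⁆⇒x≡y v u∈v)) ⟩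
    sign u ⁅ v ⁆ * single (⁅ u ⁆ ∪ ⁅ v ⁆) a (⁅ v ⁆ ∪ ⁅ u ⁆)
      ≈⟨ *-congˡ (trans (reflexive (cong (single (⁅ u ⁆ ∪ ⁅ v ⁆) a) (∪-comm ⁅ v ⁆ ⁅ u ⁆)))
                        (single-≡ (⁅ u ⁆ ∪ ⁅ v ⁆) a)) ⟩
    sign u ⁅ v ⁆ * a
      ≈⟨ +-identityˡ _ ⟨
    0# + sign u ⁅ v ⁆ * a ∎
  ... | no τ≢u | no τ≢v = trans
    (sum-zero λ w → ∂-term-zero (single (⁅ u ⁆ ∪ ⁅ v ⁆) a) {v = w} λ w∉τ → single-≢ (⁅ u ⁆ ∪ ⁅ v ⁆) (τ ∪ ⁅ w ⁆) a λ eq →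
       [ (λ (_ , τ≡u) → τ≢u τ≡u) , (λ (_ , τ≡v) → τ≢v τ≡v) ]′ (remove-from-pair w∉τ eq u≢v))
    (sym (+-identityˡ 0#))

  IsBoundary : SimplicialComplex m → ℤ → (Subset m → Carrier) → Set _
  IsBoundary {m} Δ i x =
    Σ[ y ∈ (Subset m → Carrier) ] IsChain R Δ (ℤ.suc i) y × (∀ σ → ∂ R y σ ≈ x σ)

  module _ {m} (Δ : SimplicialComplex m) where

    module _ (i : ℤ) where

      boundary-cong : ∀ {x x′} → (∀ σ → x σ ≈ x′ σ) → IsBoundary Δ i x → IsBoundary Δ i x′
      boundary-cong x≈x′ (y , chain , ∂y) = y , chain , λ σ → trans (∂y σ) (x≈x′ σ)

      boundary-zero : IsBoundary Δ i (λ _ → 0#)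
      boundary-zero = (λ _ → 0#) , (λ _ _ → refl)
                    , λ σ → sum-zero λ v → ∂-term-zero (λ _ → 0#) {σ} {v} λ _ → refl

      boundary-+ : ∀ {x x′} → IsBoundary Δ i x → IsBoundary Δ i x′ → IsBoundary Δ i (λ σ → x σ + x′ σ)
      boundary-+ (y , chain , ∂y) (y′ , chain′ , ∂y′) =
          (λ σ → y σ + y′ σ)
        , (λ σ ¬σ → trans (+-cong (chain σ ¬σ) (chain′ σ ¬σ)) (+-identityˡ 0#))
        , (λ σ → trans (∂-+ y y′ σ) (+-cong (∂y σ) (∂y′ σ)))

      boundary-* : ∀ a {x} → IsBoundary Δ i x → IsBoundary Δ i (λ σ → a * x σ)
      boundary-* a (y , chain , ∂y) =
          (λ σ → a * y σ)
        , (λ σ ¬σ → trans (*-congˡ (chain σ ¬σ)) (zeroʳ a))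
        , (λ σ → trans (∂-* a y σ) (*-congˡ (∂y σ)))

      boundary-sum : ∀ {k} {x : Fin k → Subset m → Carrier} →
                     (∀ j → IsBoundary Δ i (x j)) → IsBoundary Δ i (λ σ → sum λ j → x j σ)
      boundary-sum {ℕ.zero}  _ = boundary-zero
      boundary-sum {ℕ.suc k} b = boundary-+ (b zero) (boundary-sum (b ∘ suc))

    -- No face has dimension below -1, so the only chain is zero. The degree in
    -- `LinkHomologyVanishes` ranges over all integers, which makes these cases appear.
    homology-below-1 : ∀ k → ReducedHomologyVanishes R Δ -[1+ ℕ.suc k ]
    homology-below-1 k x chain _ =
      boundary-cong -[1+ ℕ.suc k ] (λ σ → sym (chain σ (dim≥-1 σ k ∘ proj₂))) (boundary-zero -[1+ ℕ.suc k ])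

    -- Degree -1: a chain is a multiple of the empty face, and that multiple of any vertex bounds
    -- it. So a single vertex suffices.
    homology-1 : ∀ v → Face Δ ⁅ v ⁆ → ReducedHomologyVanishes R Δ -[1+ 0 ]
    homology-1 v v∈Δ x chain _ =
        single ⁅ v ⁆ (x ⊥)
      , single-chain Δ (x ⊥) v∈Δ (dim-singleton v)
      , λ τ → trans (∂-vertex v (x ⊥) τ) (single-x τ)
      where
      single-x : ∀ τ → single ⊥ (x ⊥) τ ≈ x τ
      single-x τ with τ ≟ˢ ⊥
      ... | yes ≡.refl = refl
      ... | no τ≢⊥     = sym (chain τ λ (_ , dimτ) → τ≢⊥ (dim≡-1⇒⊥ τ dimτ))

    difference : Fin m → Fin m → Subset m → Carrier
    difference u v τ = single ⁅ u ⁆ 1# τ + single ⁅ v ⁆ (- 1#) τ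

    linked-difference : ∀ {u v} → LinkedIn Δ u v → IsBoundary Δ (+ 0) (difference u v)
    linked-difference {u} {v} (u≢v , uv∈Δ) =
      -- The coefficient -1 or 1 of the 1-face is dictated by which vertex comes first, so that the
      -- boundary is `u` minus `v` in both orders.
      [ (λ (suv , svu) → go (- 1#)
          (trans (*-congʳ svu) (trans (-1*x≈-x (- 1#)) (-‿involutive 1#)))
          (trans (*-congʳ suv) (*-identityˡ _)))
      , (λ (suv , svu) → go 1#
          (trans (*-congʳ svu) (*-identityˡ _))
          (trans (*-congʳ suv) (*-identityʳ _)))
      ]′ (sign-singletons u v u≢v)
      where
      single-cong : ∀ (σ : Subset m) {a b} τ → a ≈ b → single σ a τ ≈ single σ b τ
      single-cong σ τ a≈b with τ ≟ˢ σ
      ... | yes _ = a≈b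
      ... | no _  = refl
      go : ∀ a → sign v ⁅ u ⁆ * a ≈ 1# → sign u ⁅ v ⁆ * a ≈ - 1# → IsBoundary Δ (+ 0) (difference u v)
      go a p q = single (⁅ u ⁆ ∪ ⁅ v ⁆) a , single-chain Δ a uv∈Δ (dim-pair u v u≢v)
               , λ τ → trans (∂-pair u v u≢v a τ)
                             (+-cong (single-cong ⁅ u ⁆ τ p) (single-cong ⁅ v ⁆ τ q))

    path-difference : ∀ {u v} → Star (LinkedIn Δ) u v → IsBoundary Δ (+ 0) (difference u v)
    path-difference {u} ε = boundary-cong (+ 0) same (boundary-zero (+ 0))
      where
      same : ∀ τ → 0# ≈ difference u u τ
      same τ with τ ≟ˢ ⁅ u ⁆
      ... | yes _ = sym (-‿inverseʳ 1#)
      ... | no _  = sym (+-identityˡ 0#)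
    path-difference {u} {v} (_◅_ {j = w} uw wv) =
      boundary-cong (+ 0) telescope (boundary-+ (+ 0) (linked-difference uw) (path-difference wv))
      where
      cancel : ∀ τ → single ⁅ w ⁆ (- 1#) τ + single ⁅ w ⁆ 1# τ ≈ 0#
      cancel τ with τ ≟ˢ ⁅ w ⁆
      ... | yes _ = -‿inverseˡ 1#
      ... | no _  = +-identityˡ 0#
      telescope : ∀ τ → difference u w τ + difference w v τ ≈ difference u v τ
      telescope τ = trans (+-assoc _ _ _) (+-congˡ
        (trans (sym (+-assoc _ _ _)) (trans (+-congʳ (cancel τ)) (+-identityˡ _))))

    ∂-at-⊥ : ∀ (x : Subset m → Carrier) → ∂ R x ⊥ ≈ sum (λ v → x ⁅ v ⁆)
    ∂-at-⊥ x = sum-cong-≋ λ v → trans (∂-term-∉ x {v = v} ∉⊥) (trans (*-congʳ (sign-⊥ v))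
      (trans (*-identityˡ _) (reflexive (cong x (∪-identityˡ ⁅ v ⁆)))))

    -- Write the cycle as the sum of `x ⁅ v ⁆` times (`v` minus `r`). The correction at `r` is the
    -- sum of all coefficients, which is the boundary at `⊥` and hence zero; each difference bounds
    -- along the path from `v` to `r`.
    connected⇒homology0 : ∀ r → (∀ v → Face Δ ⁅ v ⁆ → Star (LinkedIn Δ) v r) →
                          ReducedHomologyVanishes R Δ (+ 0)
    connected⇒homology0 r path x chain cycle =
      boundary-cong (+ 0) decompose (boundary-sum (+ 0) λ v → term v)
      where
      term : ∀ v → IsBoundary Δ (+ 0) (λ τ → x ⁅ v ⁆ * difference v r τ)
      term v with face? Δ ⁅ v ⁆
      ... | yes v∈Δ = boundary-* (+ 0) (x ⁅ v ⁆) (path-difference (path v v∈Δ))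
      ... | no v∉Δ  = boundary-cong (+ 0)
        (λ τ → sym (trans (*-congʳ (chain ⁅ v ⁆ (v∉Δ ∘ proj₁))) (zeroˡ _))) (boundary-zero (+ 0))

      support : ∀ τ → sum (λ v → x ⁅ v ⁆ * single ⁅ v ⁆ 1# τ) ≈ x τ
      support τ with any? (λ w → τ ≟ˢ ⁅ w ⁆)
      ... | yes (w , ≡.refl) = trans
        (sum-concentrated w λ v v≢w → trans
          (*-congˡ (single-≢ ⁅ v ⁆ ⁅ w ⁆ 1# λ eq → v≢w (≡.sym (x∈⁅y⁆⇒x≡y v (subst (w ∈_) eq (x∈⁅x⁆ w))))))
          (zeroʳ _))
        (trans (*-congˡ (single-≡ ⁅ w ⁆ 1#)) (*-identityʳ _))
      ... | no ¬vertex = trans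
        (sum-zero λ v → trans (*-congˡ (single-≢ ⁅ v ⁆ τ 1# λ eq → ¬vertex (v , eq))) (zeroʳ _))
        (sym (chain τ λ (_ , dimτ) → ¬vertex (dim≡0⇒singleton τ dimτ)))

      decompose : ∀ τ → sum (λ v → x ⁅ v ⁆ * difference v r τ) ≈ x τ
      decompose τ = begin
        sum (λ v → x ⁅ v ⁆ * (single ⁅ v ⁆ 1# τ + s))
          ≈⟨ sum-cong-≋ (λ v → distribˡ (x ⁅ v ⁆) (single ⁅ v ⁆ 1# τ) s) ⟩
        sum (λ v → x ⁅ v ⁆ * single ⁅ v ⁆ 1# τ + x ⁅ v ⁆ * s)
          ≈⟨ ∑-distrib-+ (λ v → x ⁅ v ⁆ * single ⁅ v ⁆ 1# τ) (λ v → x ⁅ v ⁆ * s) ⟩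
        sum (λ v → x ⁅ v ⁆ * single ⁅ v ⁆ 1# τ) + sum (λ v → x ⁅ v ⁆ * s)
          ≈⟨ +-cong (support τ) (sym (*-distribʳ-sum s (λ v → x ⁅ v ⁆))) ⟩
        x τ + sum (λ v → x ⁅ v ⁆) * s
          ≈⟨ +-congˡ (*-congʳ (trans (sym (∂-at-⊥ x)) (cycle ⊥))) ⟩
        x τ + 0# * s
          ≈⟨ trans (+-congˡ (zeroˡ s)) (+-identityʳ _) ⟩
        x τ ∎
        where
        s : Carrier
        s = single ⁅ r ⁆ (- 1#) τ

    -- The sum of the coefficients over one colour class is a linear functional
    -- that kills boundaries but not p − q.
    disconnected⇒¬homology0 : ¬ 1# ≈ 0# → (colour : Fin m → Bool) →
      (∀ {u v} → LinkedIn Δ u v → colour u ≡ colour v) →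
      ∀ {p q} → Face Δ ⁅ p ⁆ → Face Δ ⁅ q ⁆ → colour p ≡ true → colour q ≡ false →
      ¬ ReducedHomologyVanishes R Δ (+ 0)
    disconnected⇒¬homology0 1≉0 colour linked {p} {q} p∈Δ q∈Δ p-true q-false vanishes =
      1≉0 (trans (sym class-sum) (trans (sum-cong-≋ expand) (sum-alternating a diagonal alternating)))
      where
      p≢q : p ≢ q
      p≢q ≡.refl with () ← ≡.trans (≡.sym p-true) q-false

      chain : IsChain R Δ (+ 0) (difference p q)
      chain σ ¬σ = trans (+-cong (single-chain Δ 1# p∈Δ (dim-singleton p) σ ¬σ)
                                 (single-chain Δ (- 1#) q∈Δ (dim-singleton q) σ ¬σ)) (+-identityˡ 0#)

      cycle : ∀ τ → ∂ R (difference p q) τ ≈ 0#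
      cycle τ = trans (∂-+ (single ⁅ p ⁆ 1#) (single ⁅ q ⁆ (- 1#)) τ)
        (trans (+-cong (∂-vertex p 1# τ) (∂-vertex q (- 1#) τ)) (cancel τ))
        where
        cancel : ∀ τ → single ⊥ 1# τ + single ⊥ (- 1#) τ ≈ 0#
        cancel τ with τ ≟ˢ ⊥
        ... | yes _ = -‿inverseʳ 1#
        ... | no _  = +-identityˡ 0#

      boundary : IsBoundary Δ (+ 0) (difference p q)
      boundary = vanishes (difference p q) chain cycle

      y : Subset m → Carrier
      y = proj₁ boundary

      weight : Fin m → Carrier
      weight u = if colour u then 1# else 0#

      class-sum : sum (λ u → weight u * difference p q ⁅ u ⁆) ≈ 1#
      class-sum = trans (sum-concentrated p other) (trans
        (*-cong (reflexive (cong (λ b → if b then 1# else 0#) p-true))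
          (trans (+-cong (single-≡ ⁅ p ⁆ 1#) (single-≢ ⁅ q ⁆ ⁅ p ⁆ (- 1#) (p≢q ∘ singleton-injective))) (+-identityʳ 1#)))
        (*-identityˡ 1#))
        where
        singleton-injective : ∀ {u v : Fin m} → ⁅ u ⁆ ≡ ⁅ v ⁆ → u ≡ v
        singleton-injective {u} {v} eq = x∈⁅y⁆⇒x≡y v (subst (u ∈_) eq (x∈⁅x⁆ u))
        other : ∀ u → u ≢ p → weight u * difference p q ⁅ u ⁆ ≈ 0#
        other u u≢p with u ≟ q
        ... | yes ≡.refl = trans (*-congʳ (reflexive (cong (λ b → if b then 1# else 0#) q-false))) (zeroˡ _)
        ... | no u≢q     = trans (*-congˡ (trans
          (+-cong (single-≢ ⁅ p ⁆ ⁅ u ⁆ 1# (u≢p ∘ singleton-injective)) (single-≢ ⁅ q ⁆ ⁅ u ⁆ (- 1#) (u≢q ∘ singleton-injective)))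
          (+-identityˡ 0#))) (zeroʳ _)

      -- `a u v` is the share of the face `{u, v}` in the functional, seen from its end `u`. The two
      -- shares cancel: the signs are opposite, and the weights agree if `{u, v}` is a face, while
      -- `y` vanishes on it otherwise.
      a : Fin m → Fin m → Carrier
      a u v = weight u * ∂-term y ⁅ u ⁆ v

      expand : ∀ u → weight u * difference p q ⁅ u ⁆ ≈ sum (a u)
      expand u = trans (*-congˡ (sym (proj₂ (proj₂ boundary) ⁅ u ⁆)))
                       (*-distribˡ-sum (weight u) (∂-term y ⁅ u ⁆))

      diagonal : ∀ u → a u u ≈ 0#
      diagonal u = trans (*-congˡ (∂-term-∈ y (x∈⁅x⁆ u))) (zeroʳ _)

      alternating : ∀ u v → a u v + a v u ≈ 0#
      alternating u v with u ≟ v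
      ... | yes ≡.refl = trans (+-cong (diagonal u) (diagonal u)) (+-identityˡ 0#)
      ... | no u≢v     = begin
        weight u * ∂-term y ⁅ u ⁆ v + weight v * ∂-term y ⁅ v ⁆ u
          ≈⟨ +-cong (*-congˡ (∂-term-∉ y {v = v} λ v∈u → u≢v (≡.sym (x∈⁅y⁆⇒x≡y u v∈u))))
                    (*-congˡ (∂-term-∉ y {v = u} λ u∈v → u≢v (x∈⁅y⁆⇒x≡y v u∈v))) ⟩
        weight u * (sign v ⁅ u ⁆ * yuv) + weight v * (sign u ⁅ v ⁆ * y (⁅ v ⁆ ∪ ⁅ u ⁆))
          ≈⟨ +-congˡ (*-congˡ (*-congˡ (reflexive (cong y (∪-comm ⁅ v ⁆ ⁅ u ⁆))))) ⟩
        weight u * (sign v ⁅ u ⁆ * yuv) + weight v * (sign u ⁅ v ⁆ * yuv)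
          ≈⟨ same-weight (face? Δ (⁅ u ⁆ ∪ ⁅ v ⁆)) ⟩
        0# ∎
        where
        yuv : Carrier
        yuv = y (⁅ u ⁆ ∪ ⁅ v ⁆)
        opposite : sign v ⁅ u ⁆ + sign u ⁅ v ⁆ ≈ 0#
        opposite = [ (λ (p , q) → trans (+-cong q p) (-‿inverseˡ 1#))
                   , (λ (p , q) → trans (+-cong q p) (-‿inverseʳ 1#)) ]′ (sign-singletons u v u≢v)
        same-weight : Dec (Face Δ (⁅ u ⁆ ∪ ⁅ v ⁆)) →
                      weight u * (sign v ⁅ u ⁆ * yuv) + weight v * (sign u ⁅ v ⁆ * yuv) ≈ 0#
        same-weight (yes uv∈Δ) = begin
          weight u * (sign v ⁅ u ⁆ * yuv) + weight v * (sign u ⁅ v ⁆ * yuv)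
            ≈⟨ +-congˡ (*-congʳ (reflexive
                 (cong (λ b → if b then 1# else 0#) (≡.sym (linked (u≢v , uv∈Δ)))))) ⟩
          weight u * (sign v ⁅ u ⁆ * yuv) + weight u * (sign u ⁅ v ⁆ * yuv)
            ≈⟨ distribˡ _ _ _ ⟨
          weight u * (sign v ⁅ u ⁆ * yuv + sign u ⁅ v ⁆ * yuv)
            ≈⟨ *-congˡ (trans (sym (distribʳ _ _ _)) (trans (*-congʳ opposite) (zeroˡ yuv))) ⟩
          weight u * 0#
            ≈⟨ zeroʳ _ ⟩
          0# ∎
        same-weight (no uv∉Δ) = trans (+-cong (vanish _ _) (vanish _ _)) (+-identityˡ 0#)
          where
          vanish : ∀ w s → w * (s * yuv) ≈ 0#
          vanish w s = trans (*-congˡ (trans (*-congˡ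
            (proj₁ (proj₂ boundary) (⁅ u ⁆ ∪ ⁅ v ⁆) (uv∉Δ ∘ proj₁))) (zeroʳ s))) (zeroʳ w)

open ≡ using (refl; sym)
open Equivalence using (to; from)

-- Matching complexes

Apart : ∀ {n} → Fin n × Fin n → Fin n × Fin n → Set
Apart (u , v) (w , z) = (u ≢ w × u ≢ z) × (v ≢ w × v ≢ z)

apart? : ∀ {n} (p q : Fin n × Fin n) → Dec (Apart p q)
apart? (u , v) (w , z) = (¬? (u ≟ w) ×-dec ¬? (u ≟ z)) ×-dec (¬? (v ≟ w) ×-dec ¬? (v ≟ z))

apart-sym : ∀ {n} {p q : Fin n × Fin n} → Apart p q → Apart q p
apart-sym ((uw , uz) , (vw , vz)) = (uw ∘ sym , vw ∘ sym) , (uz ∘ sym , vz ∘ sym)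

apart-swapˡ : ∀ {n} {p q : Fin n × Fin n} → Apart p q → Apart (swap p) q
apart-swapˡ = swap

apart-swapʳ : ∀ {n} {p q : Fin n × Fin n} → Apart p q → Apart p (swap q)
apart-swapʳ (x , y) = swap x , swap y

module _ {n} (G : Graph n) where

  -- Each edge of G is two arcs.
  IsArc : Fin n × Fin n → Set
  IsArc (u , v) = Adj G u v

  -- Adjacency in the disjointness graph, on arcs; unrelated to the `link` of a face.
  Link : Fin n × Fin n → Fin n × Fin n → Set
  Link p q = IsArc p × IsArc q × Apart p q

  Partnered : Set
  Partnered = ∀ p → IsArc p → ∃[ q ] Link p q

  -- Paths are nonempty, also from `r` to itself. Their first step then provides every arc with a
  -- disjoint one, so that `Connected` entails `Partnered` without a separate argument at the root.
  Connected : Set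
  Connected = ∃[ r ] ∀ p → IsArc p → TransClosure Link p r

  TwoDisjoint : Set
  TwoDisjoint = ∃₂ Link

  NoThreeDisjoint : Set
  NoThreeDisjoint = ∀ p q r → Link p q → Link p r → ¬ Link q r

  link-sym : ∀ {p q} → Link p q → Link q p
  link-sym (p∈ , q∈ , pq) = q∈ , p∈ , apart-sym pq

  connected⇒partnered : Connected → Partnered
  connected⇒partnered (r , path) p p∈ with path p p∈
  ... | [ pr ]    = r , pr
  ... | _∷_ pq _  = _ , pq

  private
    Δ = matchingComplex G

  ends : Edge G → Fin n × Fin n
  ends = List.lookup (edges G)

  ends-arc : ∀ e → IsArc (ends e)
  ends-arc e = proj₂ (proj₂ (∈-filter⁻ (λ (u , v) → (u <? v) ×-dec adj? G u v)
    {xs = cartesianProduct (allFin n) (allFin n)} (∈-lookup {xs = edges G} e)))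

  -- `edges` stores each edge increasingly, so an arc is the pair of ends of its edge only up to
  -- `swap`.
  Represents : Edge G → Fin n × Fin n → Set
  Represents e p = ends e ≡ p ⊎ ends e ≡ swap p

  increasing-arc-edge : ∀ {u v} → u < v → Adj G u v → ∃[ e ] ends e ≡ (u , v)
  increasing-arc-edge u<v uv = _ , sym (Any.lookup-index (∈-filter⁺ (λ (u , v) → (u <? v) ×-dec adj? G u v)
    (∈-cartesianProduct⁺ (∈-allFin _) (∈-allFin _)) (u<v , uv)))

  arc-edge : ∀ p → IsArc p → ∃[ e ] Represents e p
  arc-edge (u , v) uv with <-cmp u v
  ... | tri< u<v _ _ = let e , e≡ = increasing-arc-edge u<v uv in e , inj₁ e≡
  ... | tri≈ _ u≡v _ = contradiction uv (irrefl G u≡v)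
  ... | tri> _ _ v<u = let e , e≡ = increasing-arc-edge v<u (symm G uv) in e , inj₂ e≡

  represents-apartˡ : ∀ {e p q} → Represents e p → Apart p q → Apart (ends e) q
  represents-apartˡ {q = q} (inj₁ e≡) a = subst (λ p → Apart p q) (sym e≡) a
  represents-apartˡ {q = q} (inj₂ e≡) a = subst (λ p → Apart p q) (sym e≡) (swap a)

  represents-apart : ∀ {e f p q} → Represents e p → Represents f q → Apart p q → Apart (ends e) (ends f)
  represents-apart e~p f~q a =
    apart-sym (represents-apartˡ f~q (apart-sym (represents-apartˡ e~p a)))

  matching-singleton : ∀ e → IsMatching G ⁅ e ⁆
  matching-singleton e f g f∈ g∈ f≢g =
    contradiction (≡.trans (x∈⁅y⁆⇒x≡y e f∈) (sym (x∈⁅y⁆⇒x≡y e g∈))) f≢g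

  apart⇒no-common-endpoint : ∀ {e f} → Apart (ends e) (ends f) → ∀ v → ¬ (Endpoint G v e × Endpoint G v f)
  apart⇒no-common-endpoint ((a , b) , (c , d)) v (inj₁ x , inj₁ y) = a (≡.trans (sym x) y)
  apart⇒no-common-endpoint ((a , b) , (c , d)) v (inj₁ x , inj₂ y) = b (≡.trans (sym x) y)
  apart⇒no-common-endpoint ((a , b) , (c , d)) v (inj₂ x , inj₁ y) = c (≡.trans (sym x) y)
  apart⇒no-common-endpoint ((a , b) , (c , d)) v (inj₂ x , inj₂ y) = d (≡.trans (sym x) y)

  apart⇒≢ : ∀ {e f} → Apart (ends e) (ends f) → e ≢ f
  apart⇒≢ ((a , _) , _) refl = a refl

  matching⇒apart : ∀ {σ e f} → IsMatching G σ → e ∈ σ → f ∈ σ → e ≢ f → Apart (ends e) (ends f)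
  matching⇒apart {e = e} {f} m e∈ f∈ e≢f =
      ((λ eq → disjoint _ (inj₁ refl , inj₁ eq)) , (λ eq → disjoint _ (inj₁ refl , inj₂ eq)))
    , ((λ eq → disjoint _ (inj₂ refl , inj₁ eq)) , (λ eq → disjoint _ (inj₂ refl , inj₂ eq)))
    where
    disjoint = m e f e∈ f∈ e≢f

  matching-insert : ∀ {σ e} → IsMatching G σ → (∀ f → f ∈ σ → Apart (ends e) (ends f)) →
                    IsMatching G (σ ∪ ⁅ e ⁆)
  matching-insert {σ} {e} m apart f g f∈ g∈ f≢g v with x∈p∪q⁻ σ ⁅ e ⁆ f∈ | x∈p∪q⁻ σ ⁅ e ⁆ g∈
  ... | inj₁ f∈σ | inj₁ g∈σ = m f g f∈σ g∈σ f≢g v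
  ... | inj₁ f∈σ | inj₂ g∈e rewrite x∈⁅y⁆⇒x≡y e g∈e =
    apart⇒no-common-endpoint (apart f f∈σ) v ∘ swap
  ... | inj₂ f∈e | inj₁ g∈σ rewrite x∈⁅y⁆⇒x≡y e f∈e = apart⇒no-common-endpoint (apart g g∈σ) v
  ... | inj₂ f∈e | inj₂ g∈e = contradiction (≡.trans (x∈⁅y⁆⇒x≡y e f∈e) (sym (x∈⁅y⁆⇒x≡y e g∈e))) f≢g

  apart⇒linked : ∀ {e f} → Apart (ends e) (ends f) → LinkedIn Δ e f
  apart⇒linked {e} {f} a = apart⇒≢ {e} {f} a , matching-insert (matching-singleton e)
    λ g g∈ → subst (λ g → Apart (ends f) (ends g)) (sym (x∈⁅y⁆⇒x≡y e g∈)) (apart-sym a)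

  linked⇒apart : ∀ {e f} → LinkedIn Δ e f → Apart (ends e) (ends f)
  linked⇒apart {e} {f} (e≢f , m) =
    matching⇒apart m (p⊆p∪q ⁅ f ⁆ (x∈⁅x⁆ e)) (q⊆p∪q ⁅ e ⁆ ⁅ f ⁆ (x∈⁅x⁆ f)) e≢f

  connected⇒path : ∀ {p q} → TransClosure Link p q → ∀ {e f} → Represents e p → Represents f q →
                   Star (LinkedIn Δ) e f
  connected⇒path [ (_ , _ , a) ]          e~p f~q = apart⇒linked (represents-apart e~p f~q a) ◅ ε
  connected⇒path (_∷_ {y = r} (_ , r∈ , a) rest) e~p f~q =
    let g , g~r = arc-edge r r∈
    in apart⇒linked (represents-apart e~p g~r a) ◅ connected⇒path rest g~r f~q

  module _ (dim1 : Δ HasDim (+ 1)) where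

    two-disjoint : TwoDisjoint
    two-disjoint =
      let (σ , σ∈ , dimσ) , _ = dim1
          e , f , e≢f , σ≡    = ∣σ∣≡2⇒pair σ (size ∣ σ ∣ dimσ)
      in ends e , ends f , ends-arc e , ends-arc f
       , linked⇒apart (e≢f , subst (IsMatching G) σ≡ σ∈)
      where
      size : ∀ k → + k ℤ.- ℤ.1ℤ ≡ + 1 → k ≡ 2
      size 2 _ = refl

    matching-size : ∀ σ → IsMatching G σ → ∣ σ ∣ ℕ.≤ 2
    matching-size σ σ∈ = go ∣ σ ∣ (proj₂ dim1 σ σ∈)
      where
      go : ∀ k → + k ℤ.- ℤ.1ℤ ℤ.≤ + 1 → k ℕ.≤ 2
      go 0         _         = ℕ.z≤n
      go (ℕ.suc k) (ℤ.+≤+ p) = ℕ.s≤s p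

    -- The three edges form a matching that properly contains a two-element set; the proper
    -- inclusion replaces counting a union of three singletons.
    no-three-disjoint : NoThreeDisjoint
    no-three-disjoint p q r (p∈ , q∈ , pq) (_ , r∈ , pr) (_ , _ , qr) =
      ℕ.<⇒≱ (subst (ℕ._< ∣ ⁅ e ⁆ ∪ ⁅ f ⁆ ∪ ⁅ g ⁆ ∣) (∣pair∣≡2 e f e≢f) (p⊂q⇒∣p∣<∣q∣ bigger))
            (matching-size (⁅ e ⁆ ∪ ⁅ f ⁆ ∪ ⁅ g ⁆) triple)
      where
      e = proj₁ (arc-edge p p∈)
      f = proj₁ (arc-edge q q∈)
      g = proj₁ (arc-edge r r∈)
      ef : Apart (ends e) (ends f)
      ef = represents-apart (proj₂ (arc-edge p p∈)) (proj₂ (arc-edge q q∈)) pq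
      eg : Apart (ends e) (ends g)
      eg = represents-apart (proj₂ (arc-edge p p∈)) (proj₂ (arc-edge r r∈)) pr
      fg : Apart (ends f) (ends g)
      fg = represents-apart (proj₂ (arc-edge q q∈)) (proj₂ (arc-edge r r∈)) qr
      e≢f = apart⇒≢ {e} {f} ef
      triple : IsMatching G (⁅ e ⁆ ∪ ⁅ f ⁆ ∪ ⁅ g ⁆)
      triple = subst (IsMatching G) (∪-assoc ⁅ e ⁆ ⁅ f ⁆ ⁅ g ⁆)
        (matching-insert (proj₂ (apart⇒linked ef)) λ h h∈ → apart-sym
          ([ (λ { refl → eg }) , (λ { refl → fg }) ]′ (∈pair h∈)))
      bigger : ⁅ e ⁆ ∪ ⁅ f ⁆ ⊂ ⁅ e ⁆ ∪ ⁅ f ⁆ ∪ ⁅ g ⁆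
      bigger = (λ {x} → [ (λ x∈e → p⊆p∪q _ x∈e) , (λ x∈f → q⊆p∪q ⁅ e ⁆ _ (p⊆p∪q ⁅ g ⁆ x∈f)) ]′ ∘ x∈p∪q⁻ ⁅ e ⁆ ⁅ f ⁆)
             , g , q⊆p∪q ⁅ e ⁆ _ (q⊆p∪q ⁅ f ⁆ ⁅ g ⁆ (x∈⁅x⁆ g))
             , λ g∈ → [ (λ { g≡e → apart⇒≢ {e} {g} eg (sym g≡e) }) , (λ { g≡f → apart⇒≢ {f} {g} fg (sym g≡f) }) ]′ (∈pair g∈)

    dim-unique : ∀ {d} → Δ HasDim d → d ≡ + 1
    dim-unique {d} ((σ , σ∈ , dimσ) , max) =
      let (τ , τ∈ , dimτ) , max′ = dim1
      in ℤ.≤-antisym (subst (ℤ._≤ + 1) dimσ (max′ σ σ∈)) (subst (ℤ._≤ d) dimτ (max τ τ∈))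

    -- An arc without a disjoint arc is by itself a facet of dimension 0, whereas a matching that
    -- attains the dimension of the complex is a facet of dimension 1.
    pure⇒partnered : Pure Δ → Partnered
    pure⇒partnered pure p p∈ with any? (λ u → any? λ v → adj? G u v ×-dec apart? p (u , v))
    ... | yes (u , v , uv , a) = (u , v) , p∈ , uv , a
    ... | no isolated = case ≡.trans (sym (dim-singleton e)) (≡.trans (pure ⁅ e ⁆ σ e-facet σ-facet) dimσ) of λ ()
      where
      e = proj₁ (arc-edge p p∈)
      e~p = proj₂ (arc-edge p p∈)
      σ = proj₁ (proj₁ dim1)
      σ∈ = proj₁ (proj₂ (proj₁ dim1))
      dimσ = proj₂ (proj₂ (proj₁ dim1))

      represents-sym-apart : ∀ {q} → Represents e p → Apart (ends e) q → Apart p q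
      represents-sym-apart {q} (inj₁ e≡) a = subst (λ p → Apart p q) e≡ a
      represents-sym-apart {q} (inj₂ e≡) a = swap (subst (λ p → Apart p q) e≡ a)

      e-facet : IsFacet Δ ⁅ e ⁆
      e-facet = matching-singleton e , λ τ τ∈ e⊆τ → ⊆-antisym
        (λ {f} f∈ → case f ≟ e of λ where
          (yes refl) → x∈⁅x⁆ e
          (no f≢e)   → contradiction
            (_ , _ , ends-arc f , represents-sym-apart e~p (matching⇒apart τ∈ (e⊆τ (x∈⁅x⁆ e)) f∈ (f≢e ∘ sym)))
            isolated)
        e⊆τ

      σ-facet : IsFacet Δ σ
      σ-facet = σ∈ , λ τ τ∈ σ⊆τ → ⊆-antisym (λ {f} f∈ → case f ∈? σ of λ where
          (yes f∈σ) → f∈σ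
          (no f∉σ)  → contradiction (ℤ.<-≤-trans (bigger τ σ⊆τ f f∈ f∉σ) (proj₂ dim1 τ τ∈)) (ℤ.<-irrefl refl)) σ⊆τ
        where
        bigger : ∀ τ → σ ⊆ τ → ∀ f → f ∈ τ → ¬ f ∈ σ → + 1 ℤ.< dim τ
        bigger τ σ⊆τ f f∈ f∉ = subst (ℤ._< dim τ) dimσ
          (ℤ.+-monoˡ-< -[1+ 0 ] (ℤ.+<+ (p⊂q⇒∣p∣<∣q∣ (σ⊆τ , f , f∈ , f∉))))

    -- The empty matching extends by any edge and a single edge by its partner, so every facet has
    -- exactly two elements.
    partnered⇒pure : Partnered → Pure Δ
    partnered⇒pure partner σ τ σ-facet τ-facet = ≡.trans (facet-dim σ σ-facet) (sym (facet-dim τ τ-facet))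
      where
      facet-dim : ∀ σ → IsFacet Δ σ → dim σ ≡ + 1
      facet-dim σ (σ∈ , maximal) = go ∣ σ ∣ refl (matching-size σ σ∈)
        where
        go : ∀ k → ∣ σ ∣ ≡ k → k ℕ.≤ 2 → dim σ ≡ + 1
        go 0 size _ =
          let p , _ , p∈ , _ = two-disjoint
              e , _          = arc-edge p p∈
              σ≡⊥            = ∣σ∣≡0⇒σ≡⊥ σ size
              e≡σ            = maximal ⁅ e ⁆ (matching-singleton e)
                                 λ {x} x∈σ → contradiction (subst (x ∈_) σ≡⊥ x∈σ) ∉⊥
          in contradiction (subst (e ∈_) (≡.trans e≡σ σ≡⊥) (x∈⁅x⁆ e)) ∉⊥
        go 1 size _ =
          let e , σ≡              = ∣σ∣≡1⇒singleton σ size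
              q , _ , q∈ , a      = partner (ends e) (ends-arc e)
              f , f~q             = arc-edge q q∈
              ef                  = represents-apart {e} {f} (inj₁ refl) f~q a
              pair≡σ              = maximal (⁅ e ⁆ ∪ ⁅ f ⁆) (proj₂ (apart⇒linked ef))
                                      λ {x} x∈σ → p⊆p∪q ⁅ f ⁆ (subst (x ∈_) σ≡ x∈σ)
          in contradiction (sym (x∈⁅y⁆⇒x≡y e (subst (f ∈_) (≡.trans pair≡σ σ≡) (q⊆p∪q ⁅ e ⁆ ⁅ f ⁆ (x∈⁅x⁆ f)))))
                           (apart⇒≢ {e} {f} ef)
        go 2 size _ = cong (λ k → + k ℤ.- ℤ.1ℤ) size
        go (ℕ.suc (ℕ.suc (ℕ.suc _))) _ (ℕ.s≤s (ℕ.s≤s ()))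

    module _ {c ℓ} (R : CommutativeRing c ℓ) where
      open Homology R

      private
        link-homology : ∀ σ (σ∈ : IsMatching G σ) → (∀ i → i ℤ.< + 1 ℤ.- + ∣ σ ∣ →
          ReducedHomologyVanishes R (link Δ σ σ∈) i) → LinkHomologyVanishes R Δ σ σ∈
        link-homology σ σ∈ vanish d hasDim i i< =
          vanish i (subst (λ d → i ℤ.< d ℤ.- + ∣ σ ∣) (dim-unique hasDim) i<)

      -- For a face with one edge the degrees below 0 remain, and degree -1 is settled by the
      -- partner, which is a vertex of the link. For larger faces the bound on the degree leaves
      -- only degrees below -1.
      partnered⇒buchsbaum : Partnered → Buchsbaum R Δ
      partnered⇒buchsbaum partner = partnered⇒pure partner , λ σ σ∈ nonempty →
        link-homology σ σ∈ λ i → vanish σ σ∈ nonempty ∣ σ ∣ refl i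
        where
        vanish : ∀ σ (σ∈ : IsMatching G σ) → Nonempty σ → ∀ k → ∣ σ ∣ ≡ k → ∀ i → i ℤ.< + 1 ℤ.- + k →
                 ReducedHomologyVanishes R (link Δ σ σ∈) i
        vanish σ σ∈ (x , x∈) 0 size i i< = contradiction (subst (x ∈_) (∣σ∣≡0⇒σ≡⊥ σ size) x∈) ∉⊥
        vanish σ σ∈ _ 1 size (+ _) (ℤ.+<+ ())
        vanish σ σ∈ _ 1 size -[1+ 0 ] _ =
          let e , σ≡         = ∣σ∣≡1⇒singleton σ size
              q , _ , q∈ , a = partner (ends e) (ends-arc e)
              f , f~q        = arc-edge q q∈
              fe             = apart-sym (represents-apart {e} {f} (inj₁ refl) f~q a)
          in homology-1 (link Δ σ σ∈) f
               ( (λ (x , x∈) → let x∈f , x∈σ = x∈p∩q⁻ ⁅ f ⁆ σ x∈ in apart⇒≢ {f} {e} fe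
                   (≡.trans (sym (x∈⁅y⁆⇒x≡y f x∈f)) (x∈⁅y⁆⇒x≡y e (subst (x ∈_) σ≡ x∈σ))))
               , subst (λ σ → IsMatching G (⁅ f ⁆ ∪ σ)) (sym σ≡) (proj₂ (apart⇒linked fe)))
        vanish σ σ∈ _ 1 size -[1+ ℕ.suc k ] _ = homology-below-1 (link Δ σ σ∈) k
        vanish σ σ∈ _ (ℕ.suc (ℕ.suc j)) size -[1+ 0 ] (ℤ.-<- ())
        vanish σ σ∈ _ (ℕ.suc (ℕ.suc j)) size -[1+ ℕ.suc k ] _ = homology-below-1 (link Δ σ σ∈) k

      private
        -- `CohenMacaulay` tests the whole complex through the link of the empty face. It has the
        -- faces of `Δ`, but only up to the equation `σ ∪ ⊥ ≡ σ`, which has to be transported along.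
        Λ : SimplicialComplex (length (edges G))
        Λ = link Δ ⊥ (∅-face Δ)

        face-in-Λ : ∀ {σ} → Face Δ σ → Face Λ σ
        face-in-Λ {σ} σ∈ = (λ (x , x∈) → ∉⊥ (proj₂ (x∈p∩q⁻ σ ⊥ x∈)))
                         , subst (IsMatching G) (sym (∪-identityʳ σ)) σ∈

        face-of-Λ : ∀ {σ} → Face Λ σ → Face Δ σ
        face-of-Λ {σ} (_ , σ∈) = subst (IsMatching G) (∪-identityʳ σ) σ∈

      connected⇒cohenMacaulay : Connected → CohenMacaulay R Δ
      connected⇒cohenMacaulay connected@(r , path) =
          partnered⇒buchsbaum (connected⇒partnered connected)
        , link-homology ⊥ (∅-face Δ) λ i i< →
            vanish i (subst (λ k → i ℤ.< + 1 ℤ.- + k) (∣⊥∣≡0 (length (edges G))) i<)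
        where
        -- `Connected` does not say that `r` is an arc; it is the last arc of a nonempty path
        -- starting at some arc.
        r-arc : IsArc r
        r-arc = let p , _ , p∈ , _ = two-disjoint in end (path p p∈)
          where
          end : ∀ {p q} → TransClosure Link p q → IsArc q
          end [ (_ , q∈ , _) ] = q∈
          end (_ ∷ rest)       = end rest
        root : Edge G
        root = proj₁ (arc-edge r r-arc)
        vanish : ∀ i → i ℤ.< + 1 → ReducedHomologyVanishes R Λ i
        vanish (+ 0) _ = connected⇒homology0 Λ root λ e _ →
          Star.map (λ (e≢f , ef) → e≢f , face-in-Λ ef)
            (connected⇒path (path (ends e) (ends-arc e)) (inj₁ refl) (proj₂ (arc-edge r r-arc)))
        vanish (+ (ℕ.suc _)) (ℤ.+<+ (ℕ.s≤s ()))
        vanish -[1+ 0 ]        _ = homology-1 Λ root (face-in-Λ (matching-singleton root))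
        vanish -[1+ ℕ.suc k ] _ = homology-below-1 Λ k

      -- A colouring of arcs that ignores direction colours the edges, which are the vertices of the
      -- complex. The obstruction lies in degree 0, the largest degree tested for the empty face.
      disconnected⇒¬cohenMacaulay :
        (let open CommutativeRing R in ¬ 1# ≈ 0#) → (colour : Fin n × Fin n → Bool) →
        (∀ p → colour (swap p) ≡ colour p) → (∀ {p q} → Link p q → colour p ≡ colour q) →
        ∀ {p q} → IsArc p → IsArc q → colour p ≡ true → colour q ≡ false → ¬ CohenMacaulay R Δ
      disconnected⇒¬cohenMacaulay 1≉0 colour colour-swap colour-link {p} {q} p∈ q∈ p-true q-false (_ , vanish) =
        disconnected⇒¬homology0 Λ 1≉0 (colour ∘ ends)
          (λ {e} {f} (e≢f , ef) →
            colour-link (ends-arc e , ends-arc f , linked⇒apart (e≢f , face-of-Λ ef)))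
          (face-in-Λ (matching-singleton (proj₁ (arc-edge p p∈))))
          (face-in-Λ (matching-singleton (proj₁ (arc-edge q q∈))))
          (≡.trans (colour-represents (proj₂ (arc-edge p p∈))) p-true)
          (≡.trans (colour-represents (proj₂ (arc-edge q q∈))) q-false)
          (vanish (+ 1) dim1 (+ 0)
            (subst (λ k → + 0 ℤ.< + 1 ℤ.- + k) (sym (∣⊥∣≡0 (length (edges G)))) (ℤ.+<+ (ℕ.s≤s ℕ.z≤n))))
        where
        colour-represents : ∀ {e p} → Represents e p → colour (ends e) ≡ colour p
        colour-represents (inj₁ e≡) = cong colour e≡
        colour-represents {p = p} (inj₂ e≡) = ≡.trans (cong colour e≡) (colour-swap p)

-- Recognising a graph from named vertices

-- Numbers the vertices that no argument names individually: the leaves of a star and the new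
-- vertices of a family member.
enumerate : ∀ {n} {P : Pred (Fin n) 0ℓ} → Decidable P →
  ∃[ k ] Σ[ h ∈ (Fin k → Fin n) ] Injective _≡_ _≡_ h × (∀ v → P v ⇔ (∃[ j ] h j ≡ v))
enumerate {ℕ.zero}  P? = 0 , (λ ()) , (λ { {()} }) , λ ()
enumerate {ℕ.suc n} {P} P? with P? zero | enumerate (P? ∘ suc)
... | yes p | k , h , h-inj , h-image = ℕ.suc k , h′ , h′-inj , h′-image
  where
  h′ : Fin (ℕ.suc k) → Fin (ℕ.suc n)
  h′ zero    = zero
  h′ (suc j) = suc (h j)
  h′-inj : Injective _≡_ _≡_ h′
  h′-inj {zero}  {zero}  _  = refl
  h′-inj {suc i} {suc j} eq = cong suc (h-inj (suc-injective eq))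
  h′-image : ∀ v → P v ⇔ (∃[ j ] h′ j ≡ v)
  h′-image zero    = mk⇔ (λ _ → zero , refl) (λ _ → p)
  h′-image (suc v) = mk⇔
    (λ pv → let j , eq = to (h-image v) pv in suc j , cong suc eq)
    (λ { (zero , ()) ; (suc j , eq) → from (h-image v) (j , suc-injective eq) })
... | no ¬p | k , h , h-inj , h-image = k , suc ∘ h , h-inj ∘ suc-injective , image
  where
  image : ∀ v → P v ⇔ (∃[ j ] suc (h j) ≡ v)
  image zero    = mk⇔ (λ p → contradiction p ¬p) λ ()
  image (suc v) = mk⇔
    (λ pv → let j , eq = to (h-image v) pv in j , cong suc eq)
    (λ (j , eq) → from (h-image v) (j , suc-injective eq))

subset : ∀ {n} {P : Pred (Fin n) 0ℓ} → Decidable P → Subset n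
subset P? = tabulate (does ∘ P?)

∈-subset : ∀ {n} {P : Pred (Fin n) 0ℓ} (P? : Decidable P) v → v ∈ subset P? ⇔ P v
∈-subset P? v = mk⇔
  (λ v∈ → decide (≡.trans (sym (lookup∘tabulate (does ∘ P?) v)) ([]=⇒lookup v∈)))
  (λ p → lookup⇒[]= v _ (≡.trans (lookup∘tabulate (does ∘ P?) v) (dec-true (P? v) p)))
  where
  decide : does (P? v) ≡ true → _
  decide eq with P? v
  ... | yes p = p

module _ {n} (G : Graph n) where

  adj-≢ : ∀ {u v} → Adj G u v → u ≢ v
  adj-≢ uv u≡v = irrefl G u≡v uv

  iso-by-vertices : ∀ {m} (H : Graph m) (g : Fin m → Fin n) → Injective _≡_ _≡_ g →
    (∀ v → ∃[ i ] g i ≡ v) → (∀ i j → Adj H i j ⇔ Adj G (g i) (g j)) → G ≅ H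
  iso-by-vertices H g g-inj g-surj adj =
      mk↔ₛ′ g⁻¹ g (λ i → g-inj (proj₂ (g-surj (g i)))) (λ v → proj₂ (g-surj v))
    , λ u v → mk⇔
        (λ uv → from (adj (g⁻¹ u) (g⁻¹ v))
          (≡.subst₂ (Adj G) (sym (proj₂ (g-surj u))) (sym (proj₂ (g-surj v))) uv))
        (λ ij → ≡.subst₂ (Adj G) (proj₂ (g-surj u)) (proj₂ (g-surj v))
          (to (adj (g⁻¹ u) (g⁻¹ v)) ij))
    where
    g⁻¹ = proj₁ ∘ g-surj

  module _ {m} (g : Fin m → Fin n) where

    ArcImage NonArcImage : Fin m × Fin m → Set
    ArcImage    (i , j) = Adj G (g i) (g j)
    NonArcImage (i , j) = ¬ Adj G (g i) (g j)

    joined⇒adj : ∀ {es} → All ArcImage es → ∀ {i j} → Joined es i j → Adj G (g i) (g j)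
    joined⇒adj arcs (_ , inj₁ ij) = All.lookup arcs ij
    joined⇒adj arcs (_ , inj₂ ji) = symm G (All.lookup arcs ji)

    adj⇒joined : ∀ es non → (∀ i j → i ≡ j ⊎ Joined es i j ⊎ Joined non i j) →
                 All NonArcImage non → ∀ {i j} → Adj G (g i) (g j) → Joined es i j
    adj⇒joined es non complete nonarcs {i} {j} ij with complete i j
    ... | inj₁ refl                      = contradiction ij (irrefl G refl)
    ... | inj₂ (inj₁ joined)             = joined
    ... | inj₂ (inj₂ (_ , inj₁ ij∈))     = contradiction ij (All.lookup nonarcs ij∈)
    ... | inj₂ (inj₂ (_ , inj₂ ji∈))     = contradiction (symm G ij) (All.lookup nonarcs ji∈)

  -- Every pair of distinct indices occurs in one of the two lists. Concrete lists pass this check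
  -- by evaluation, so recognising a graph amounts to supplying its arcs and its non-arcs.
  Complete? : ∀ {m} (es non : List (Fin m × Fin m)) → Dec (∀ i j → i ≡ j ⊎ Joined es i j ⊎ Joined non i j)
  Complete? es non = all? λ i → all? λ j → (i ≟ j) ⊎-dec (joined? es i j ⊎-dec joined? non i j)

  fromEdges-iso : ∀ {m} {es non : List (Fin m × Fin m)} {_ : True (Complete? es non)}
    (g : Fin m → Fin n) → Injective _≡_ _≡_ g → (∀ v → ∃[ i ] g i ≡ v) →
    All (ArcImage g) es → All (NonArcImage g) non → G ≅ fromEdges m es
  fromEdges-iso {es = es} {non} {complete} g g-inj g-surj arcs nonarcs =
    iso-by-vertices (fromEdges _ es) g g-inj g-surj λ i j →
      mk⇔ (joined⇒adj g arcs) (adj⇒joined g es non (toWitness complete) nonarcs)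

  module _ (F : Family) where
    open Family F

    -- The chosen optional edges are those present in `G`, and the new vertices are all vertices
    -- missed by `g`, with neighbourhoods read off from `G`. Hence `non` has to cover just the pairs
    -- that are neither required nor optional. By the last hypothesis all neighbours of a new vertex
    -- are named, so new vertices are independent.
    family-member : ∀ {non} {_ : True (Complete? (required ++ optional) non)}
      (g : Fin 5 → Fin n) → Injective _≡_ _≡_ g → NoIsolatedVertices G →
      All (ArcImage g) required → All (NonArcImage g) non →
      (∀ {v w} → (∀ i → g i ≢ v) → Adj G v w → ∃[ i ] i ∈ attach × g i ≡ w) →
      G ∈ᶠ F
    family-member {non} {complete} g g-inj no-isolated arcs nonarcs attached =
        chosen , (λ e∈ → proj₁ (∈-filter⁻ arc? e∈))
      , k , N , (λ j → N⊆attach j , N-nonempty j)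
      , iso-by-vertices (extend (required ++ chosen) N) gh gh-inj gh-surj
          (λ x y → adj (splitAt 5 x) (splitAt 5 y))
      where
      arc? : Decidable (ArcImage g)
      arc? (i , j) = adj? G (g i) (g j)

      chosen : List (Fin 5 × Fin 5)
      chosen = filter arc? optional

      rest = enumerate (λ v → ¬? (any? λ i → g i ≟ v))
      k = proj₁ rest
      h = proj₁ (proj₂ rest)
      h-inj = proj₁ (proj₂ (proj₂ rest))
      h-image = proj₂ (proj₂ (proj₂ rest))

      h-outside : ∀ j i → g i ≢ h j
      h-outside j i eq = from (h-image (h j)) (j , refl) (i , eq)

      N : Fin k → Subset 5
      N j = subset (λ i → adj? G (g i) (h j))

      N⊆attach : ∀ j → N j ⊆ attach
      N⊆attach j {i} i∈ =
        let i′ , i′∈ , eq = attached (h-outside j) (symm G (to (∈-subset (λ i → adj? G (g i) (h j)) i) i∈))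
        in subst (_∈ attach) (g-inj eq) i′∈

      N-nonempty : ∀ j → Nonempty (N j)
      N-nonempty j =
        let w , hw     = no-isolated (h j)
            i , _ , eq = attached (h-outside j) hw
        in i , from (∈-subset (λ i → adj? G (g i) (h j)) i) (symm G (subst (Adj G (h j)) (sym eq) hw))

      pick : Fin 5 ⊎ Fin k → Fin n
      pick = [ g , h ]′

      gh : Fin (5 ℕ.+ k) → Fin n
      gh x = pick (splitAt 5 x)

      pick-inj : Injective _≡_ _≡_ pick
      pick-inj {inj₁ i} {inj₁ j} eq = cong inj₁ (g-inj eq)
      pick-inj {inj₁ i} {inj₂ j} eq = contradiction eq (h-outside j i)
      pick-inj {inj₂ i} {inj₁ j} eq = contradiction (sym eq) (h-outside i j)
      pick-inj {inj₂ i} {inj₂ j} eq = cong inj₂ (h-inj eq)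

      gh-inj : Injective _≡_ _≡_ gh
      gh-inj {x} {y} eq = splitAt-injective x y (pick-inj eq)
        where
        splitAt-injective : ∀ x y → splitAt 5 x ≡ splitAt 5 y → x ≡ y
        splitAt-injective x y eq with splitAt 5 x in x≡ | splitAt 5 y in y≡
        ... | inj₁ i | inj₁ j with refl ← eq = ≡.trans (sym (splitAt⁻¹-↑ˡ {5} x≡)) (splitAt⁻¹-↑ˡ {5} y≡)
        ... | inj₂ i | inj₂ j with refl ← eq = ≡.trans (sym (splitAt⁻¹-↑ʳ {5} x≡)) (splitAt⁻¹-↑ʳ {5} y≡)

      gh-surj : ∀ v → ∃[ x ] gh x ≡ v
      gh-surj v with any? (λ i → g i ≟ v)
      ... | yes (i , eq) = i ↑ˡ k , ≡.trans (cong pick (splitAt-↑ˡ 5 i k)) eq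
      ... | no unlisted   =
        let j , eq = to (h-image v) unlisted
        in 5 ↑ʳ j , ≡.trans (cong pick (splitAt-↑ʳ 5 k j)) eq

      widen : ∀ {e} → e ∈ˡ required ++ optional → ArcImage g e → e ∈ˡ required ++ chosen
      widen e∈ arc = [ ∈-++⁺ˡ , (λ e∈opt → ∈-++⁺ʳ required (∈-filter⁺ arc? e∈opt arc)) ]′
                       (∈-++⁻ required e∈)

      core : ∀ {i j} → Adj G (g i) (g j) → Joined (required ++ chosen) i j
      core ij with adj⇒joined g (required ++ optional) non (toWitness complete) nonarcs ij
      ... | i≢j , inj₁ ij∈ = i≢j , inj₁ (widen ij∈ ij)
      ... | i≢j , inj₂ ji∈ = i≢j , inj₂ (widen ji∈ (symm G ij))

      adj : ∀ s t → ExtAdj (required ++ chosen) N s t ⇔ Adj G (pick s) (pick t)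
      adj (inj₁ i) (inj₁ j) = mk⇔
        (joined⇒adj g (All.tabulate λ e∈ → [ All.lookup arcs , (λ e∈ → proj₂ (∈-filter⁻ arc? {xs = optional} e∈)) ]′
          (∈-++⁻ required e∈)))
        core
      adj (inj₁ i) (inj₂ j) = ∈-subset (λ i → adj? G (g i) (h j)) i
      adj (inj₂ j) (inj₁ i) = mk⇔ (symm G ∘ to (∈-subset (λ i → adj? G (g i) (h j)) i))
                                  (from (∈-subset (λ i → adj? G (g i) (h j)) i) ∘ symm G)
      adj (inj₂ i) (inj₂ j) = mk⇔ (λ ()) λ ij →
        let l , _ , eq = attached (h-outside i) ij in contradiction eq (h-outside j l)

  -- The predicate describes the component by the vertices at hand, so that covering and
  -- disjointness of two pieces are argued without `Subset`.
  Piece : Pred (Fin n) 0ℓ → Set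
  Piece P = Σ[ C ∈ Subset n ] IsComponent G C × IsTriangleOrStar G C × (∀ v → v ∈ C ⇔ P v)

  star-closed : ∀ {P : Pred (Fin n) 0ℓ} → (∀ {v w} → P v → Adj G v w → P w) →
                ∀ {v w} → P v → Star (Adj G) v w → P w
  star-closed closed pv ε         = pv
  star-closed closed pv (vw ◅ ws) = star-closed closed (closed pv vw) ws

  module _ {P : Pred (Fin n) 0ℓ} (P? : Decidable P) {m} (H : Graph m)
           (g : Fin m → Fin n) (g-inj : Injective _≡_ _≡_ g) (image : ∀ v → P v ⇔ (∃[ i ] g i ≡ v))
           (adj : ∀ i j → Adj H i j ⇔ Adj G (g i) (g j)) where

    induced : G [ subset P? ]≅ H
    induced = g , g-inj
            , (λ v → mk⇔ (to (image v) ∘ to (∈-subset P? v)) (from (∈-subset P? v) ∘ from (image v)))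
            , adj

  component : ∀ {P : Pred (Fin n) 0ℓ} (P? : Decidable P) {r} → P r →
              (∀ {v} → P v → Star (Adj G) r v) → (∀ {v w} → P v → Adj G v w → P w) →
              IsComponent G (subset P?)
  component P? {r} pr reach closed = r , λ w → mk⇔
    (reach ∘ to (∈-subset P? w))
    (from (∈-subset P? w) ∘ star-closed closed pr)

  -- The hypothesis on `u` does two things at once: it makes the leaves independent and it closes
  -- the star under adjacency.
  star-piece : NoIsolatedVertices G → ∀ u → (∀ {v w} → Adj G u v → Adj G v w → w ≡ u) →
               Piece (λ v → v ≡ u ⊎ Adj G u v)
  star-piece no-isolated u closed =
      subset P? , component P? (inj₁ refl) reach P-closed
    , inj₂ (k , k≥1 , induced P? (star k) g g-inj image adj) , ∈-subset P?
    where
    P : Pred (Fin n) 0ℓ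
    P v = v ≡ u ⊎ Adj G u v
    P? : Decidable P
    P? v = (v ≟ u) ⊎-dec adj? G u v
    reach : ∀ {v} → P v → Star (Adj G) u v
    reach (inj₁ refl) = ε
    reach (inj₂ uv)   = uv ◅ ε
    P-closed : ∀ {v w} → P v → Adj G v w → P w
    P-closed (inj₁ refl) vw = inj₂ vw
    P-closed (inj₂ uv)   vw = inj₁ (closed uv vw)

    leaves = enumerate (adj? G u)
    k = proj₁ leaves
    h = proj₁ (proj₂ leaves)
    h-inj = proj₁ (proj₂ (proj₂ leaves))
    h-image = proj₂ (proj₂ (proj₂ leaves))

    leaf-adj : ∀ j → Adj G u (h j)
    leaf-adj j = from (h-image (h j)) (j , refl)

    k≥1 : 1 ℕ.≤ k
    k≥1 = inhabited (proj₁ (to (h-image _) (proj₂ (no-isolated u))))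
      where
      inhabited : ∀ {k} → Fin k → 1 ℕ.≤ k
      inhabited zero    = ℕ.s≤s ℕ.z≤n
      inhabited (suc _) = ℕ.s≤s ℕ.z≤n

    g : Fin (ℕ.suc k) → Fin n
    g zero    = u
    g (suc j) = h j

    g-inj : Injective _≡_ _≡_ g
    g-inj {zero}  {zero}  _  = refl
    g-inj {zero}  {suc j} eq = contradiction eq (adj-≢ (leaf-adj j))
    g-inj {suc i} {zero}  eq = contradiction (sym eq) (adj-≢ (leaf-adj i))
    g-inj {suc i} {suc j} eq = cong suc (h-inj eq)

    image : ∀ v → P v ⇔ (∃[ i ] g i ≡ v)
    image v = mk⇔
      [ (λ v≡u → zero , sym v≡u) , (λ uv → let j , eq = to (h-image v) uv in suc j , eq) ]′
      (λ { (zero , eq) → inj₁ (sym eq) ; (suc j , eq) → inj₂ (from (h-image v) (j , eq)) })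

    spokes : List (Fin (ℕ.suc k) × Fin (ℕ.suc k))
    spokes = List.map (λ i → zero , suc i) (allFin k)

    spoke : ∀ j → (zero , suc j) ∈ˡ spokes
    spoke j = ∈-map⁺ (λ i → zero , suc i) (∈-allFin j)

    spoke-center : ∀ {i j} → (suc i , j) ∈ˡ spokes → False
    spoke-center e∈ with _ , _ , () ← ∈-map⁻ (λ i → zero , suc i) e∈

    adj : ∀ i j → Joined spokes i j ⇔ Adj G (g i) (g j)
    adj zero    zero    = mk⇔ (λ (0≢0 , _) → contradiction refl 0≢0) (λ uu → contradiction refl (adj-≢ uu))
    adj zero    (suc j) = mk⇔ (λ _ → leaf-adj j) (λ _ → (λ ()) , inj₁ (spoke j))
    adj (suc i) zero    = mk⇔ (λ _ → symm G (leaf-adj i)) (λ _ → (λ ()) , inj₂ (spoke i))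
    adj (suc i) (suc j) = mk⇔
      (λ (_ , e) → ⊥-elim ([ spoke-center , spoke-center ]′ e))
      (λ ij → contradiction (sym (closed (leaf-adj i) ij)) (adj-≢ (leaf-adj j)))

  triangle-piece : ∀ {a b c} → Adj G a b → Adj G b c → Adj G a c →
    (∀ {w} → Adj G a w → w ≡ b ⊎ w ≡ c) → (∀ {w} → Adj G b w → w ≡ a ⊎ w ≡ c) →
    (∀ {w} → Adj G c w → w ≡ a ⊎ w ≡ b) → Piece (λ v → v ≡ a ⊎ v ≡ b ⊎ v ≡ c)
  triangle-piece {a} {b} {c} ab bc ac a-closed b-closed c-closed =
      subset P? , component P? (inj₁ refl) reach P-closed
    , inj₁ (induced P? (complete 3) g g-inj image λ i j → mk⇔ (adj i j) λ ij i≡j → irrefl G (cong g i≡j) ij)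
    , ∈-subset P?
    where
    P : Pred (Fin n) 0ℓ
    P v = v ≡ a ⊎ v ≡ b ⊎ v ≡ c
    P? : Decidable P
    P? v = (v ≟ a) ⊎-dec ((v ≟ b) ⊎-dec (v ≟ c))
    reach : ∀ {v} → P v → Star (Adj G) a v
    reach (inj₁ refl)        = ε
    reach (inj₂ (inj₁ refl)) = ab ◅ ε
    reach (inj₂ (inj₂ refl)) = ac ◅ ε
    P-closed : ∀ {v w} → P v → Adj G v w → P w
    P-closed (inj₁ refl)        vw = inj₂ (a-closed vw)
    P-closed (inj₂ (inj₁ refl)) vw = Sum.map₂ inj₂ (b-closed vw)
    P-closed (inj₂ (inj₂ refl)) vw = Sum.map₂ inj₁ (c-closed vw)
    g : Fin 3 → Fin n
    g 0F = a
    g 1F = b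
    g 2F = c
    adj : ∀ i j → i ≢ j → Adj G (g i) (g j)
    adj 0F 0F i≢j = contradiction refl i≢j
    adj 0F 1F _   = ab
    adj 0F 2F _   = ac
    adj 1F 0F _   = symm G ab
    adj 1F 1F i≢j = contradiction refl i≢j
    adj 1F 2F _   = bc
    adj 2F 0F _   = symm G ac
    adj 2F 1F _   = symm G bc
    adj 2F 2F i≢j = contradiction refl i≢j
    g-inj : Injective _≡_ _≡_ g
    g-inj {i} {j} eq = decidable-stable (i ≟ j) λ i≢j → adj-≢ (adj i j i≢j) eq
    P-vertex : ∀ i → P (g i)
    P-vertex 0F = inj₁ refl
    P-vertex 1F = inj₂ (inj₁ refl)
    P-vertex 2F = inj₂ (inj₂ refl)
    image : ∀ v → P v ⇔ (∃[ i ] g i ≡ v)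
    image v = mk⇔
      [ (λ eq → 0F , sym eq) , [ (λ eq → 1F , sym eq) , (λ eq → 2F , sym eq) ]′ ]′
      (λ (i , eq) → subst P eq (P-vertex i))

  reachable-sym : ∀ {u v} → Star (Adj G) u v → Star (Adj G) v u
  reachable-sym = Star.reverse (symm G)

  same-component : ∀ {C D v} → IsComponent G C → IsComponent G D → v ∈ C → v ∈ D → C ≡ D
  same-component {C} {D} {v} (r , C-reach) (s , D-reach) v∈C v∈D = ⊆-antisym
    (λ {w} w∈C → from (D-reach w) (to (D-reach v) v∈D ◅◅ reachable-sym (to (C-reach v) v∈C) ◅◅ to (C-reach w) w∈C))
    (λ {w} w∈D → from (C-reach w) (to (C-reach v) v∈C ◅◅ reachable-sym (to (D-reach v) v∈D) ◅◅ to (D-reach w) w∈D))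

  root∈ : ∀ {C} (C-component : IsComponent G C) → proj₁ C-component ∈ C
  root∈ (r , reach) = from (reach r) ε

  two-pieces : ∀ {P Q : Pred (Fin n) 0ℓ} → Piece P → Piece Q → (∀ v → P v ⊎ Q v) →
               (∀ {v} → P v → ¬ Q v) → TwoTriangleOrStarComponents G
  two-pieces (C , C-component , C-shape , C≡P) (D , D-component , D-shape , D≡Q) cover disjoint =
      C , D , C-component , D-component
    , (λ C≡D → let r = proj₁ C-component ; r∈C = root∈ C-component in
        disjoint (to (C≡P r) r∈C) (to (D≡Q r) (subst (r ∈_) C≡D r∈C)))
    , (λ E E-component → let r = proj₁ E-component ; r∈E = root∈ E-component in
        Sum.map (λ pr → same-component E-component C-component r∈E (from (C≡P r) pr))
                (λ qr → same-component E-component D-component r∈E (from (D≡Q r) qr)) (cover r))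
    , C-shape , D-shape

-- Classification of the graphs whose edges all lie in 2-matchings

vertices-injective : ∀ {m n} {vs : Vec (Fin n) m} → Unique vs → Injective _≡_ _≡_ (lookup vs)
vertices-injective vs! {i} {j} = lookup-injective vs! i j

module Classification {n} (G : Graph n) (no-isolated : NoIsolatedVertices G)
                      (no-three : NoThreeDisjoint G) (partner : Partnered G) where

  V : Set
  V = Fin n

  infix 4 _~_

  _~_ : V → V → Set
  _~_ = Adj G

  ~-sym : ∀ {u v} → u ~ v → v ~ u
  ~-sym = symm G

  ~-≢ : ∀ {u v} → u ~ v → u ≢ v
  ~-≢ = adj-≢ G

  Classified : Set
  Classified = (TwoTriangleOrStarComponents G ⊎ InFamiliesOrBowtie G) ⊎ G ≅ complete 4 ⊎ G ≅ C₄

  no-three-arcs : ∀ {a b c d e f} → a ~ b → c ~ d → e ~ f →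
                  Apart (a , b) (c , d) → Apart (a , b) (e , f) → ¬ Apart (c , d) (e , f)
  no-three-arcs ab cd ef p q r = no-three _ _ _ (ab , cd , p) (ab , ef , q) (cd , ef , r)

  -- Graphs with a vertex cover of size two

  module Cover2 (p q : V) (p≢q : p ≢ q)
                (cover : ∀ {v w} → v ~ w → (v ≡ p ⊎ v ≡ q) ⊎ (w ≡ p ⊎ w ≡ q)) where

    -- An edge disjoint from `pq` would avoid the cover.
    p≁q : ¬ p ~ q
    p≁q pq with partner _ pq
    ... | _ , _ , wz , ((p≢w , p≢z) , (q≢w , q≢z)) with cover wz
    ... | inj₁ (inj₁ w≡p) = p≢w (sym w≡p)
    ... | inj₁ (inj₂ w≡q) = q≢w (sym w≡q)
    ... | inj₂ (inj₁ z≡p) = p≢z (sym z≡p)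
    ... | inj₂ (inj₂ z≡q) = q≢z (sym z≡q)

    uncovered : ∀ {v w} → v ≢ p → v ≢ q → w ≢ p → w ≢ q → ¬ v ~ w
    uncovered v≢p v≢q w≢p w≢q vw = [ [ v≢p , v≢q ]′ , [ w≢p , w≢q ]′ ]′ (cover vw)

    neighbour : ∀ v → v ≢ p → v ≢ q → p ~ v ⊎ q ~ v
    neighbour v v≢p v≢q with no-isolated v
    ... | w , vw with cover vw
    ... | inj₁ (inj₁ v≡p)  = contradiction v≡p v≢p
    ... | inj₁ (inj₂ v≡q)  = contradiction v≡q v≢q
    ... | inj₂ (inj₁ refl) = inj₁ (~-sym vw)
    ... | inj₂ (inj₂ refl) = inj₂ (~-sym vw)

    -- An edge disjoint from `qz` avoids `q`, so the cover forces it through `p`.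
    another : ∀ {z} → q ~ z → ∃[ x ] p ~ x × x ≢ z
    another qz with partner _ qz
    ... | (v , w) , _ , vw , ((q≢v , q≢w) , (z≢v , z≢w)) with cover vw
    ... | inj₁ (inj₁ refl) = w , vw , z≢w ∘ sym
    ... | inj₁ (inj₂ v≡q)  = contradiction (sym v≡q) q≢v
    ... | inj₂ (inj₁ refl) = v , ~-sym vw , z≢v ∘ sym
    ... | inj₂ (inj₂ w≡q)  = contradiction (sym w≡q) q≢w

    -- The path `x p z q y` is the required path, with `p`, `q` as the attaching vertices. The
    -- optional edges are `xq` and `py`; all other pairs are excluded by the cover and by `p≁q`.
    member-𝒢₁ : ∀ {x z y} → p ~ x → p ~ z → q ~ z → q ~ y → x ≢ z → z ≢ y → x ≢ y → G ∈ᶠ 𝒢₁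
    member-𝒢₁ {x} {z} {y} px pz qz qy x≢z z≢y x≢y =
      family-member G 𝒢₁ {(0F , 2F) ∷ (0F , 4F) ∷ (2F , 4F) ∷ (1F , 3F) ∷ []}
        (lookup vs) (vertices-injective vs!) no-isolated
        (~-sym px ∷ pz ∷ ~-sym qz ∷ qy ∷ [])
        (uncovered x≢p x≢q z≢p z≢q ∷ uncovered x≢p x≢q y≢p y≢q ∷ uncovered z≢p z≢q y≢p y≢q ∷ p≁q ∷ [])
        attached
      where
      x≢p : x ≢ p
      x≢p = ~-≢ (~-sym px)
      x≢q : x ≢ q
      x≢q refl = p≁q px
      z≢p : z ≢ p
      z≢p = ~-≢ (~-sym pz)
      z≢q : z ≢ q
      z≢q = ~-≢ (~-sym qz)
      y≢q : y ≢ q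
      y≢q = ~-≢ (~-sym qy)
      y≢p : y ≢ p
      y≢p refl = p≁q (~-sym qy)
      vs : Vec V 5
      vs = x ∷ p ∷ z ∷ q ∷ y ∷ []
      vs! : Unique vs
      vs! = (x≢p ∷ x≢z ∷ x≢q ∷ x≢y ∷ []) ∷ (z≢p ∘ sym ∷ p≢q ∷ y≢p ∘ sym ∷ [])
          ∷ (z≢q ∷ z≢y ∷ []) ∷ (y≢q ∘ sym ∷ []) ∷ [] ∷ []
      attached : ∀ {v w} → (∀ i → lookup vs i ≢ v) → v ~ w → ∃[ i ] i ∈ Family.attach 𝒢₁ × lookup vs i ≡ w
      attached unlisted vw with cover vw
      ... | inj₁ (inj₁ v≡p) = contradiction (sym v≡p) (unlisted 1F)
      ... | inj₁ (inj₂ v≡q) = contradiction (sym v≡q) (unlisted 3F)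
      ... | inj₂ (inj₁ w≡p) = 1F , there here , sym w≡p
      ... | inj₂ (inj₂ w≡q) = 3F , there (there (there here)) , sym w≡q

    four-cycle : ∀ {x z} → p ~ x → p ~ z → q ~ x → q ~ z → x ≢ z →
                 (∀ v → v ≡ p ⊎ v ≡ q ⊎ v ≡ z ⊎ v ≡ x) → G ≅ C₄
    four-cycle {x} {z} px pz qx qz x≢z spanning =
      fromEdges-iso G {non = (0F , 2F) ∷ (1F , 3F) ∷ []} (lookup vs) (vertices-injective vs!) surjective
        (pz ∷ ~-sym qz ∷ qx ∷ ~-sym px ∷ [])
        (p≁q ∷ uncovered (~-≢ (~-sym pz)) (~-≢ (~-sym qz)) (~-≢ (~-sym px)) (~-≢ (~-sym qx)) ∷ [])
      where
      vs : Vec V 4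
      vs = p ∷ z ∷ q ∷ x ∷ []
      vs! : Unique vs
      vs! = (~-≢ pz ∷ p≢q ∷ ~-≢ px ∷ []) ∷ (~-≢ (~-sym qz) ∷ x≢z ∘ sym ∷ []) ∷ (~-≢ qx ∷ []) ∷ [] ∷ []
      surjective : ∀ v → ∃[ i ] lookup vs i ≡ v
      surjective v with spanning v
      ... | inj₁ v≡p               = 0F , sym v≡p
      ... | inj₂ (inj₁ v≡q)        = 2F , sym v≡q
      ... | inj₂ (inj₂ (inj₁ v≡z)) = 1F , sym v≡z
      ... | inj₂ (inj₂ (inj₂ v≡x)) = 3F , sym v≡x

  cover-swap : ∀ {p q : V} → (∀ {v w} → v ~ w → (v ≡ p ⊎ v ≡ q) ⊎ (w ≡ p ⊎ w ≡ q)) →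
               ∀ {v w} → v ~ w → (v ≡ q ⊎ v ≡ p) ⊎ (w ≡ q ⊎ w ≡ p)
  cover-swap cover vw = Sum.map Sum.swap Sum.swap (cover vw)

  -- Without a common neighbour of `p` and `q` there are two stars. A common neighbour `z` comes
  -- with a further neighbour `x` of `p` and `y` of `q`, from the partners of `qz` and `pz`. If `x`
  -- and `y` differ, the path `x p z q y` gives `𝒢₁`; if they coincide, a fifth vertex replaces one
  -- end of that path, and without a fifth vertex the graph is `C₄`.
  cover2⇒classified : ∀ {p q} → p ≢ q →
    (∀ {v w} → v ~ w → (v ≡ p ⊎ v ≡ q) ⊎ (w ≡ p ⊎ w ≡ q)) → Classified
  cover2⇒classified {p} {q} p≢q cover with any? (λ z → adj? G p z ×-dec adj? G q z)
  ... | no no-common = inj₁ (inj₁ (two-pieces G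
      (star-piece G no-isolated p (closed-p cover p≁q λ pv qv → no-common (_ , pv , qv)))
      (star-piece G no-isolated q (closed-p (cover-swap cover) (p≁q ∘ ~-sym) λ qv pv → no-common (_ , pv , qv)))
      every disjoint))
    where
    open Cover2 p q p≢q cover
    closed-p : ∀ {p q} → (∀ {v w} → v ~ w → (v ≡ p ⊎ v ≡ q) ⊎ (w ≡ p ⊎ w ≡ q)) → ¬ p ~ q →
               (∀ {v} → p ~ v → ¬ q ~ v) → ∀ {v w} → p ~ v → v ~ w → w ≡ p
    closed-p cover p≁q no-common pv vw with cover vw
    ... | inj₁ (inj₁ refl) = contradiction refl (~-≢ pv)
    ... | inj₁ (inj₂ refl) = contradiction pv p≁q
    ... | inj₂ (inj₁ w≡p)  = w≡p
    ... | inj₂ (inj₂ refl) = contradiction (~-sym vw) (no-common pv)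
    every : ∀ v → (v ≡ p ⊎ p ~ v) ⊎ (v ≡ q ⊎ q ~ v)
    every v with v ≟ p | v ≟ q
    ... | yes v≡p | _       = inj₁ (inj₁ v≡p)
    ... | no _    | yes v≡q = inj₂ (inj₁ v≡q)
    ... | no v≢p  | no v≢q  = Sum.map inj₂ inj₂ (neighbour v v≢p v≢q)
    disjoint : ∀ {v} → v ≡ p ⊎ p ~ v → ¬ (v ≡ q ⊎ q ~ v)
    disjoint (inj₁ refl) (inj₁ p≡q) = p≢q p≡q
    disjoint (inj₁ refl) (inj₂ qp)  = p≁q (~-sym qp)
    disjoint (inj₂ pq)   (inj₁ refl) = p≁q pq
    disjoint (inj₂ pv)   (inj₂ qv)  = no-common (_ , pv , qv)
  ... | yes (z , pz , qz)
    with Cover2.another p q p≢q cover qz | Cover2.another q p (p≢q ∘ sym) (cover-swap cover) pz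
  ... | x , px , x≢z | y , qy , y≢z with x ≟ y
  ... | no x≢y = inj₁ (inj₂ (inj₁ (Cover2.member-𝒢₁ p q p≢q cover px pz qz qy x≢z (y≢z ∘ sym) x≢y)))
  ... | yes refl with any? (λ w → ¬? (w ≟ p) ×-dec ¬? (w ≟ q) ×-dec ¬? (w ≟ z) ×-dec ¬? (w ≟ x))
  ... | yes (w , w≢p , w≢q , w≢z , w≢x) with Cover2.neighbour p q p≢q cover w w≢p w≢q
  ... | inj₁ pw = inj₁ (inj₂ (inj₁ (Cover2.member-𝒢₁ p q p≢q cover pw pz qz qy w≢z (x≢z ∘ sym) w≢x)))
  ... | inj₂ qw = inj₁ (inj₂ (inj₁ (Cover2.member-𝒢₁ p q p≢q cover px pz qz qw x≢z (w≢z ∘ sym) (w≢x ∘ sym))))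
  cover2⇒classified {p} {q} p≢q cover | yes (z , pz , qz) | x , px , x≢z | .x , qx , _ | yes refl | no no-fifth =
    inj₂ (inj₂ (Cover2.four-cycle p q p≢q cover px pz qx qz x≢z spanning))
    where
    spanning : ∀ v → v ≡ p ⊎ v ≡ q ⊎ v ≡ z ⊎ v ≡ x
    spanning v with v ≟ p | v ≟ q | v ≟ z | v ≟ x
    ... | yes e | _     | _     | _     = inj₁ e
    ... | no _  | yes e | _     | _     = inj₂ (inj₁ e)
    ... | no _  | no _  | yes e | _     = inj₂ (inj₂ (inj₁ e))
    ... | no _  | no _  | no _  | yes e = inj₂ (inj₂ (inj₂ e))
    ... | no a  | no b  | no c  | no d  = contradiction (v , a , b , c , d) no-fifth

  -- A triangle and a vertex carrying all further edges

  record Hub (u a b c : V) : Set where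
    field
      ab  : a ~ b
      bc  : b ~ c
      ac  : a ~ c
      u≢a : u ≢ a
      u≢b : u ≢ b
      u≢c : u ≢ c
      -- Vertices beyond the four hang at `u` alone. Which of `ua`, `ub`, `uc` are present is left
      -- open and decides between the outcomes.
      leaf : ∀ {v w} → v ~ w → v ≢ u → v ≢ a → v ≢ b → v ≢ c → w ≡ u

  hub-rotate : ∀ {u a b c} → Hub u a b c → Hub u b c a
  hub-rotate hub = record
    { ab = bc ; bc = ~-sym ac ; ac = ~-sym ab ; u≢a = u≢b ; u≢b = u≢c ; u≢c = u≢a
    ; leaf = λ vw v≢u v≢b v≢c v≢a → leaf vw v≢u v≢a v≢b v≢c }
    where open Hub hub

  -- A fifth vertex is a leaf at `u` and gives `𝒢₂`, with `u` as the attaching vertex and `uc` as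
  -- its required edge into the triangle. With only four vertices, the partners of `bc` and `ac`
  -- force `ua` and `ub`, so the graph is `K₄`.
  attached-hub⇒classified : ∀ {u a b c} → Hub u a b c → u ~ c → Classified
  attached-hub⇒classified {u} {a} {b} {c} hub uc
    with any? (λ x → ¬? (x ≟ u) ×-dec ¬? (x ≟ a) ×-dec ¬? (x ≟ b) ×-dec ¬? (x ≟ c))
  ... | yes (x , x≢u , x≢a , x≢b , x≢c) = inj₁ (inj₂ (inj₂ (inj₁
      (family-member G 𝒢₂ {(0F , 4F) ∷ (1F , 4F) ∷ (2F , 4F) ∷ []}
        (lookup vs) (vertices-injective vs!) no-isolated
        (ab ∷ bc ∷ ac ∷ ~-sym uc ∷ ux ∷ [])
        ((λ ax → u≢a (sym (x-leaf (~-sym ax)))) ∷ (λ bx → u≢b (sym (x-leaf (~-sym bx))))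
          ∷ (λ cx → u≢c (sym (x-leaf (~-sym cx)))) ∷ [])
        λ unlisted vw → 3F , there (there (there here)) ,
          sym (leaf vw (unlisted 3F ∘ sym) (unlisted 0F ∘ sym) (unlisted 1F ∘ sym) (unlisted 2F ∘ sym))))))
    where
    open Hub hub
    x-leaf : ∀ {w} → x ~ w → w ≡ u
    x-leaf xw = leaf xw x≢u x≢a x≢b x≢c
    ux : u ~ x
    ux = let w , xw = no-isolated x in ~-sym (subst (x ~_) (x-leaf xw) xw)
    vs : Vec V 5
    vs = a ∷ b ∷ c ∷ u ∷ x ∷ []
    vs! : Unique vs
    vs! = (~-≢ ab ∷ ~-≢ ac ∷ u≢a ∘ sym ∷ x≢a ∘ sym ∷ []) ∷ (~-≢ bc ∷ u≢b ∘ sym ∷ x≢b ∘ sym ∷ [])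
        ∷ (u≢c ∘ sym ∷ x≢c ∘ sym ∷ []) ∷ (x≢u ∘ sym ∷ []) ∷ [] ∷ []
  ... | no no-fifth = inj₂ (inj₁ (iso-by-vertices G (complete 4) (lookup vs) (vertices-injective vs!) surjective
      λ i j → mk⇔ (arc i j) (λ ij → λ { refl → ~-≢ ij refl })))
    where
    open Hub hub
    surjective : ∀ v → ∃[ i ] lookup (u ∷ a ∷ b ∷ c ∷ []) i ≡ v
    surjective v with v ≟ u | v ≟ a | v ≟ b | v ≟ c
    ... | yes e | _     | _     | _     = 0F , sym e
    ... | no _  | yes e | _     | _     = 1F , sym e
    ... | no _  | no _  | yes e | _     = 2F , sym e
    ... | no _  | no _  | no _  | yes e = 3F , sym e
    ... | no p  | no q  | no r  | no s  = contradiction (v , p , q , r , s) no-fifth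
    -- If `s` and `t` are the only vertices off `vw`, then `st` is the only possible partner of
    -- `vw`.
    complement : ∀ {v w s t} → (∀ x → x ≢ v → x ≢ w → x ≡ s ⊎ x ≡ t) → v ~ w → s ~ t
    complement rest vw with partner _ vw
    ... | (x , y) , _ , xy , ((v≢x , v≢y) , (w≢x , w≢y))
      with rest x (v≢x ∘ sym) (w≢x ∘ sym) | rest y (v≢y ∘ sym) (w≢y ∘ sym)
    ... | inj₁ refl | inj₁ refl = contradiction refl (~-≢ xy)
    ... | inj₁ refl | inj₂ refl = xy
    ... | inj₂ refl | inj₁ refl = ~-sym xy
    ... | inj₂ refl | inj₂ refl = contradiction refl (~-≢ xy)
    ua : u ~ a
    ua = complement rest bc
      where
      rest : ∀ x → x ≢ b → x ≢ c → x ≡ u ⊎ x ≡ a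
      rest x x≢b x≢c with surjective x
      ... | 0F , refl = inj₁ refl
      ... | 1F , refl = inj₂ refl
      ... | 2F , refl = contradiction refl x≢b
      ... | 3F , refl = contradiction refl x≢c
    ub : u ~ b
    ub = complement rest ac
      where
      rest : ∀ x → x ≢ a → x ≢ c → x ≡ u ⊎ x ≡ b
      rest x x≢a x≢c with surjective x
      ... | 0F , refl = inj₁ refl
      ... | 1F , refl = contradiction refl x≢a
      ... | 2F , refl = inj₂ refl
      ... | 3F , refl = contradiction refl x≢c
    vs : Vec V 4
    vs = u ∷ a ∷ b ∷ c ∷ []
    vs! : Unique vs
    vs! = (u≢a ∷ u≢b ∷ u≢c ∷ []) ∷ (~-≢ ab ∷ ~-≢ ac ∷ []) ∷ (~-≢ bc ∷ []) ∷ [] ∷ []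
    arc : ∀ i j → i ≢ j → lookup vs i ~ lookup vs j
    arc 0F 0F i≢j = contradiction refl i≢j
    arc 0F 1F _   = ua
    arc 0F 2F _   = ub
    arc 0F 3F _   = uc
    arc 1F 0F _   = ~-sym ua
    arc 1F 1F i≢j = contradiction refl i≢j
    arc 1F 2F _   = ab
    arc 1F 3F _   = ac
    arc 2F 0F _   = ~-sym ub
    arc 2F 1F _   = ~-sym ab
    arc 2F 2F i≢j = contradiction refl i≢j
    arc 2F 3F _   = bc
    arc 3F 0F _   = ~-sym uc
    arc 3F 1F _   = ~-sym ac
    arc 3F 2F _   = ~-sym bc
    arc 3F 3F i≢j = contradiction refl i≢j

  -- If `u` has a neighbour in the triangle, rotating the triangle moves it to `c`. Otherwise the
  -- triangle and the star at `u` are the two components.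
  hub⇒classified : ∀ {u a b c} → Hub u a b c → Classified
  hub⇒classified {u} {a} {b} {c} hub with adj? G u a | adj? G u b | adj? G u c
  ... | _      | _      | yes uc = attached-hub⇒classified hub uc
  ... | yes ua | _      | no _   = attached-hub⇒classified (hub-rotate hub) ua
  ... | no _   | yes ub | no _   = attached-hub⇒classified (hub-rotate (hub-rotate hub)) ub
  ... | no ua  | no ub  | no uc  = inj₁ (inj₁ (two-pieces G
      (triangle-piece G ab bc ac (closed hub ua) (Sum.swap ∘ closed (hub-rotate hub) ub)
        (closed (hub-rotate (hub-rotate hub)) uc))
      (star-piece G no-isolated u λ uv vw → leaf vw (~-≢ (~-sym uv))
        (λ { refl → ua uv }) (λ { refl → ub uv }) (λ { refl → uc uv }))
      every disjoint))
    where
    open Hub hub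
    closed : ∀ {a b c} → Hub u a b c → ¬ u ~ a → ∀ {w} → a ~ w → w ≡ b ⊎ w ≡ c
    closed {a} {b} {c} hub u≁a {w} aw with w ≟ b | w ≟ c | w ≟ u
    ... | yes w≡b | _       | _        = inj₁ w≡b
    ... | no _    | yes w≡c | _        = inj₂ w≡c
    ... | no _    | no _    | yes refl = contradiction (~-sym aw) u≁a
    ... | no w≢b  | no w≢c  | no w≢u   = contradiction
      (sym (Hub.leaf hub (~-sym aw) w≢u (~-≢ (~-sym aw)) w≢b w≢c)) (Hub.u≢a hub)
    every : ∀ v → (v ≡ a ⊎ v ≡ b ⊎ v ≡ c) ⊎ (v ≡ u ⊎ u ~ v)
    every v with v ≟ u | v ≟ a | v ≟ b | v ≟ c
    ... | yes e | _     | _     | _     = inj₂ (inj₁ e)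
    ... | no _  | yes e | _     | _     = inj₁ (inj₁ e)
    ... | no _  | no _  | yes e | _     = inj₁ (inj₂ (inj₁ e))
    ... | no _  | no _  | no _  | yes e = inj₁ (inj₂ (inj₂ e))
    ... | no p  | no q  | no r  | no s  =
      let w , vw = no-isolated v in inj₂ (inj₂ (~-sym (subst (v ~_) (leaf vw p q r s) vw)))
    disjoint : ∀ {v} → v ≡ a ⊎ v ≡ b ⊎ v ≡ c → ¬ (v ≡ u ⊎ u ~ v)
    disjoint (inj₁ refl)        = [ u≢a ∘ sym , ua ]′
    disjoint (inj₂ (inj₁ refl)) = [ u≢b ∘ sym , ub ]′
    disjoint (inj₂ (inj₂ refl)) = [ u≢c ∘ sym , uc ]′

  -- Graphs on five vertices

  IsPermutation : Vec (Fin 5) 5 → Set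
  IsPermutation π = (∀ i j → lookup π i ≡ lookup π j → i ≡ j) × (∀ i → ∃[ j ] lookup π j ≡ i)

  permutation? : ∀ π → Dec (IsPermutation π)
  permutation? π = all? (λ i → all? λ j → (lookup π i ≟ lookup π j) →-dec (i ≟ j))
                   ×-dec all? (λ i → any? λ j → lookup π j ≟ i)

  -- `g` numbers the vertices once and for all; `π` lists them in the order in which they occur in
  -- the pentagon or the bowtie. That `π` is a permutation is checked by evaluation.
  module FiveVertices (g : Fin 5 → V) (g-inj : Injective _≡_ _≡_ g) (g-surj : ∀ v → ∃[ i ] g i ≡ v) where

    module _ (π : Vec (Fin 5) 5) {π-perm : True (permutation? π)} where

      private
        gπ : Fin 5 → V
        gπ i = g (lookup π i)

        gπ-inj : Injective _≡_ _≡_ gπ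
        gπ-inj {i} {j} eq = proj₁ (toWitness π-perm) i j (g-inj eq)

        gπ-surj : ∀ v → ∃[ i ] gπ i ≡ v
        gπ-surj v = let i , gi≡v = g-surj v
                        j , πj≡i = proj₂ (toWitness π-perm) i
                    in j , ≡.trans (cong g πj≡i) gi≡v

      -- The required and optional edges of `𝒢₃` are together all ten pairs, so a Hamiltonian cycle
      -- on five vertices is enough and the list of non-arcs is empty.
      pentagon : All (ArcImage G gπ) (Family.required 𝒢₃) → Classified
      pentagon arcs = inj₁ (inj₂ (inj₂ (inj₂ (inj₁ (family-member G 𝒢₃ {[]} gπ gπ-inj no-isolated arcs []
        λ {v} unlisted _ → let i , eq = gπ-surj v in contradiction eq (unlisted i))))))

      bowtie-shape : All (ArcImage G gπ) (e12 ∷ e23 ∷ e13 ∷ e34 ∷ e45 ∷ e35 ∷ []) →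
                     All (NonArcImage G gπ) (e14 ∷ e51 ∷ e24 ∷ e25 ∷ []) → Classified
      bowtie-shape arcs nonarcs =
        inj₁ (inj₂ (inj₂ (inj₂ (inj₂ (fromEdges-iso G gπ gπ-inj gπ-surj arcs nonarcs)))))

  -- A triangle T disjoint from a second triangle sends no edge outwards: such
  -- an edge, the opposite side of T and a side of the second triangle that
  -- avoids it would be three disjoint edges.
  triangle-isolated : ∀ {a b x c d y} → b ~ x → c ~ d → d ~ y → c ~ y →
    a ≢ c → a ≢ d → a ≢ y → Apart (b , x) (c , d) → b ≢ y → x ≢ y →
    a ≢ b → a ≢ x → ∀ {w} → a ~ w → w ≡ b ⊎ w ≡ x
  triangle-isolated {a} {b} {x} {c} {d} {y} bx cd dy cy a≢c a≢d a≢y ((b≢c , b≢d) , (x≢c , x≢d)) b≢y x≢y a≢b a≢x {w} aw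
    with w ≟ b | w ≟ x
  ... | yes w≡b | _       = inj₁ w≡b
  ... | no _    | yes w≡x = inj₂ w≡x
  ... | no w≢b  | no w≢x with w ≟ c | w ≟ d
  ... | yes refl | _ = contradiction ((b≢d , b≢y) , (x≢d , x≢y)) (no-three-arcs aw bx dy
    ((a≢b , a≢x) , (w≢b , w≢x)) ((a≢d , a≢y) , (~-≢ cd , ~-≢ cy)))
  ... | no _ | yes refl = contradiction ((b≢c , b≢y) , (x≢c , x≢y)) (no-three-arcs aw bx cy
    ((a≢b , a≢x) , (w≢b , w≢x)) ((a≢c , a≢y) , (~-≢ (~-sym cd) , ~-≢ dy)))
  ... | no w≢c | no w≢d = contradiction ((b≢c , b≢d) , (x≢c , x≢d)) (no-three-arcs aw bx cd
    ((a≢b , a≢x) , (w≢b , w≢x)) ((a≢c , a≢d) , (w≢c , w≢d)))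

  -- Two disjoint edges and the vertices outside them

  Outside : V → V → V → V → V → Set
  Outside a b c d v = (v ≢ a × v ≢ b) × (v ≢ c × v ≢ d)

  outside-swap₁ : ∀ {a b c d v} → Outside a b c d v → Outside b a c d v
  outside-swap₁ (ab , cd) = swap ab , cd

  outside-swap₂ : ∀ {a b c d v} → Outside a b c d v → Outside a b d c v
  outside-swap₂ (ab , cd) = ab , swap cd

  outside-exchange : ∀ {a b c d v} → Outside a b c d v → Outside c d a b v
  outside-exchange = swap

  data Position (a b c d : V) : V → Set where
    at-a : Position a b c d a
    at-b : Position a b c d b
    at-c : Position a b c d c
    at-d : Position a b c d d
    out  : ∀ {v} → Outside a b c d v → Position a b c d v

  position : ∀ a b c d v → Position a b c d v
  position a b c d v with v ≟ a | v ≟ b | v ≟ c | v ≟ d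
  ... | yes refl | _        | _        | _        = at-a
  ... | no _     | yes refl | _        | _        = at-b
  ... | no _     | no _     | yes refl | _        = at-c
  ... | no _     | no _     | no _     | yes refl = at-d
  ... | no p     | no q     | no r     | no s     = out ((p , q) , (r , s))

  record TwoEdges (a b c d : V) : Set where
    field
      ab    : a ~ b
      cd    : c ~ d
      apart : Apart (a , b) (c , d)

    a≢c = proj₁ (proj₁ apart)
    a≢d = proj₂ (proj₁ apart)
    b≢c = proj₁ (proj₂ apart)
    b≢d = proj₂ (proj₂ apart)

    independent : ∀ {v w} → Outside a b c d v → Outside a b c d w → ¬ v ~ w
    independent ((va , vb) , (vc , vd)) ((wa , wb) , (wc , wd)) vw =
      no-three-arcs ab cd vw apart ((va ∘ sym , wa ∘ sym) , (vb ∘ sym , wb ∘ sym))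
        ((vc ∘ sym , wc ∘ sym) , (vd ∘ sym , wd ∘ sym))

    -- The augmenting path `x a b y`: trading `ab` for `xa` and `yb` leaves three disjoint edges
    -- together with `cd`.
    augment₃ : ∀ {x y} → Outside a b c d x → Outside a b c d y → x ≢ y → x ~ a → ¬ y ~ b
    augment₃ ((xa , xb) , (xc , xd)) ((ya , yb) , (yc , yd)) x≢y xa-arc yb-arc =
      no-three-arcs xa-arc yb-arc cd ((x≢y , xb) , (ya ∘ sym , ~-≢ ab))
        ((xc , xd) , (a≢c , a≢d)) ((yc , yd) , (b≢c , b≢d))

    -- The augmenting path `x a b c d y`, whose edges `xa`, `bc`, `yd` are disjoint.
    augment₅ : ∀ {x y} → Outside a b c d x → Outside a b c d y → x ≢ y → x ~ a → b ~ c → ¬ y ~ d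
    augment₅ ((xa , xb) , (xc , xd)) ((ya , yb) , (yc , yd)) x≢y xa-arc bc yd-arc =
      no-three-arcs xa-arc bc yd-arc ((xb , xc) , (~-≢ ab , a≢c))
        ((x≢y , xd) , (ya ∘ sym , a≢d)) ((yb ∘ sym , b≢d) , (yc ∘ sym , ~-≢ cd))

    outside-neighbour : ∀ {v} → Outside a b c d v → v ~ a ⊎ v ~ b ⊎ v ~ c ⊎ v ~ d
    outside-neighbour {v} v-out with no-isolated v
    ... | w , vw with position a b c d w
    ... | at-a      = inj₁ vw
    ... | at-b      = inj₂ (inj₁ vw)
    ... | at-c      = inj₂ (inj₂ (inj₁ vw))
    ... | at-d      = inj₂ (inj₂ (inj₂ vw))
    ... | out w-out = contradiction vw (independent v-out w-out)

    outside? : ∀ v → Dec (Outside a b c d v)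
    outside? v = (¬? (v ≟ a) ×-dec ¬? (v ≟ b)) ×-dec (¬? (v ≟ c) ×-dec ¬? (v ≟ d))

    Avoided : V → Set
    Avoided t = ∀ {v} → Outside a b c d v → ¬ v ~ t

    reached-or-avoided : ∀ t → (∃[ v ] Outside a b c d v × v ~ t) ⊎ Avoided t
    reached-or-avoided t with any? (λ v → outside? v ×-dec adj? G v t)
    ... | yes found = inj₁ found
    ... | no none   = inj₂ λ v-out vt → none (_ , v-out , vt)

    Apex : V → Set
    Apex x = Outside a b c d x × x ~ a × x ~ b

    apex-or-avoided : ∃ Apex ⊎ Avoided a ⊎ Avoided b
    apex-or-avoided with reached-or-avoided a | reached-or-avoided b
    ... | inj₂ a-avoided | _              = inj₂ (inj₁ a-avoided)
    ... | inj₁ _         | inj₂ b-avoided = inj₂ (inj₂ b-avoided)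
    ... | inj₁ (x , x-out , xa) | inj₁ (y , y-out , yb) with x ≟ y
    ... | yes refl = inj₁ (x , x-out , xa , yb)
    ... | no x≢y   = contradiction yb (augment₃ x-out y-out x≢y xa)

    -- A unique outside vertex leaves five vertices, numbered `a`, `b`, `c`, `d`, `x` from `0F` to
    -- `4F`. The index lists given to `pentagon` and `bowtie-shape` refer to this numbering.
    module Spanning {x} (x-out : Outside a b c d x) (only : ∀ {v} → Outside a b c d v → v ≡ x) where
      vertex : Fin 5 → V
      vertex = lookup (a ∷ b ∷ c ∷ d ∷ x ∷ [])

      vertex-injective : Injective _≡_ _≡_ vertex
      vertex-injective = vertices-injective
        ( (~-≢ ab ∷ a≢c ∷ a≢d ∷ proj₁ (proj₁ x-out) ∘ sym ∷ [])
        ∷ (b≢c ∷ b≢d ∷ proj₂ (proj₁ x-out) ∘ sym ∷ [])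
        ∷ (~-≢ cd ∷ proj₁ (proj₂ x-out) ∘ sym ∷ [])
        ∷ (proj₂ (proj₂ x-out) ∘ sym ∷ []) ∷ [] ∷ [])

      vertex-surjective : ∀ v → ∃[ i ] vertex i ≡ v
      vertex-surjective v with position a b c d v
      ... | at-a      = 0F , refl
      ... | at-b      = 1F , refl
      ... | at-c      = 2F , refl
      ... | at-d      = 3F , refl
      ... | out v-out = 4F , sym (only v-out)

      open FiveVertices vertex vertex-injective vertex-surjective public

  two-edges-swap₁ : ∀ {a b c d} → TwoEdges a b c d → TwoEdges b a c d
  two-edges-swap₁ E = record { ab = ~-sym ab ; cd = cd ; apart = apart-swapˡ apart } where open TwoEdges E

  two-edges-swap₂ : ∀ {a b c d} → TwoEdges a b c d → TwoEdges a b d c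
  two-edges-swap₂ E = record { ab = ab ; cd = ~-sym cd ; apart = apart-swapʳ apart } where open TwoEdges E

  two-edges-exchange : ∀ {a b c d} → TwoEdges a b c d → TwoEdges c d a b
  two-edges-exchange E = record { ab = cd ; cd = ab ; apart = apart-sym apart } where open TwoEdges E

  -- All neighbours of `b` and `d` are then `a` or `c`, and outside vertices are independent, so `a`
  -- and `c` form a vertex cover.
  nonadjacent-avoided : ∀ {a b c d} (E : TwoEdges a b c d) → let open TwoEdges E in
                        Avoided b → Avoided d → ¬ b ~ d → Classified
  nonadjacent-avoided {a} {b} {c} {d} E b-avoided d-avoided b≁d = cover2⇒classified (TwoEdges.a≢c E) cover
    where
    open TwoEdges E
    cover : ∀ {v w} → v ~ w → (v ≡ a ⊎ v ≡ c) ⊎ (w ≡ a ⊎ w ≡ c)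
    cover {v} {w} vw with position a b c d v | position a b c d w
    ... | at-a | _    = inj₁ (inj₁ refl)
    ... | at-c | _    = inj₁ (inj₂ refl)
    ... | _    | at-a = inj₂ (inj₁ refl)
    ... | _    | at-c = inj₂ (inj₂ refl)
    ... | at-b | at-b = contradiction refl (~-≢ vw)
    ... | at-b | at-d = contradiction vw b≁d
    ... | at-b | out o = contradiction (~-sym vw) (b-avoided o)
    ... | at-d | at-b = contradiction (~-sym vw) b≁d
    ... | at-d | at-d = contradiction refl (~-≢ vw)
    ... | at-d | out o = contradiction (~-sym vw) (d-avoided o)
    ... | out o | at-b = contradiction vw (b-avoided o)
    ... | out o | at-d = contradiction vw (d-avoided o)
    ... | out o | out o′ = contradiction vw (independent o o′)

  -- If `bc` is missing as well, exchanging `c` and `d` makes `a`, `d` a cover. If it is present,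
  -- `b`, `c`, `d` form a triangle without outside neighbours, and all further edges contain `a`.
  three-avoided : ∀ {a b c d} (E : TwoEdges a b c d) → let open TwoEdges E in
                  Avoided b → Avoided c → Avoided d → b ~ d → Classified
  three-avoided {a} {b} {c} {d} E b-avoided c-avoided d-avoided bd with adj? G b c
  ... | no b≁c = nonadjacent-avoided (two-edges-swap₂ E)
    (b-avoided ∘ outside-swap₂) (c-avoided ∘ outside-swap₂) b≁c
  ... | yes bc = hub⇒classified record
    { ab = bd ; bc = ~-sym cd ; ac = bc ; u≢a = ~-≢ ab ; u≢b = a≢d ; u≢c = a≢c
    ; leaf = leaf }
    where
    open TwoEdges E
    leaf : ∀ {v w} → v ~ w → v ≢ a → v ≢ b → v ≢ d → v ≢ c → w ≡ a
    leaf {v} {w} vw v≢a v≢b v≢d v≢c with position a b c d w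
    ... | at-a  = refl
    ... | at-b  = contradiction vw (b-avoided ((v≢a , v≢b) , (v≢c , v≢d)))
    ... | at-c  = contradiction vw (c-avoided ((v≢a , v≢b) , (v≢c , v≢d)))
    ... | at-d  = contradiction vw (d-avoided ((v≢a , v≢b) , (v≢c , v≢d)))
    ... | out o = contradiction vw (independent ((v≢a , v≢b) , (v≢c , v≢d)) o)

  -- The interesting case has `bd` present and outside neighbours `x` of `a` and `y` of `c`. The
  -- path `x a b d c y` is augmenting unless `x` and `y` coincide, and then it closes up to a
  -- pentagon. Any other outside vertex would be adjacent to `a` or `c` and produce an augmenting
  -- path again.
  two-avoided : ∀ {a b c d} (E : TwoEdges a b c d) → let open TwoEdges E in
                Avoided b → Avoided d → Classified
  two-avoided {a} {b} {c} {d} E b-avoided d-avoided with adj? G b d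
  ... | no b≁d = nonadjacent-avoided E b-avoided d-avoided b≁d
  ... | yes bd with TwoEdges.reached-or-avoided E a | TwoEdges.reached-or-avoided E c
  ... | _ | inj₂ c-avoided = three-avoided E b-avoided c-avoided d-avoided bd
  ... | inj₂ a-avoided | inj₁ _ = three-avoided (two-edges-exchange E)
    (d-avoided ∘ outside-exchange) (a-avoided ∘ outside-exchange) (b-avoided ∘ outside-exchange) (~-sym bd)
  ... | inj₁ (x , x-out , xa) | inj₁ (y , y-out , yc) with x ≟ y
  ... | no x≢y = contradiction yc (TwoEdges.augment₅ (two-edges-swap₂ E)
    (outside-swap₂ x-out) (outside-swap₂ y-out) x≢y xa bd)
  ... | yes refl = pentagon (4F ∷ 0F ∷ 1F ∷ 3F ∷ 2F ∷ []) (xa ∷ ab ∷ bd ∷ ~-sym cd ∷ ~-sym yc ∷ [])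
    where
    open TwoEdges E
    only : ∀ {v} → Outside a b c d v → v ≡ x
    only {v} v-out with v ≟ x
    ... | yes v≡x = v≡x
    ... | no v≢x with outside-neighbour v-out
    ... | inj₁ va                = contradiction yc (TwoEdges.augment₅ (two-edges-swap₂ E)
      (outside-swap₂ v-out) (outside-swap₂ x-out) v≢x va bd)
    ... | inj₂ (inj₁ vb)         = contradiction vb (b-avoided v-out)
    ... | inj₂ (inj₂ (inj₁ vc))  = contradiction vc (TwoEdges.augment₅ (two-edges-swap₂ E)
      (outside-swap₂ x-out) (outside-swap₂ v-out) (v≢x ∘ sym) xa bd)
    ... | inj₂ (inj₂ (inj₂ vd))  = contradiction vd (d-avoided v-out)
    open Spanning x-out only

  module OneApex {a b c d} (E : TwoEdges a b c d) {x} (apex : TwoEdges.Apex E x) where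
    open TwoEdges E

    x-out : Outside a b c d x
    x-out = proj₁ apex
    xa : x ~ a
    xa = proj₁ (proj₂ apex)
    xb : x ~ b
    xb = proj₂ (proj₂ apex)

    x≢c : x ≢ c
    x≢c = proj₁ (proj₂ x-out)
    x≢d : x ≢ d
    x≢d = proj₂ (proj₂ x-out)

    -- As `x` is adjacent to both ends of `ab`, a second outside neighbour of either end completes
    -- an augmenting path.
    others-avoid-a : ∀ {v} → Outside a b c d v → v ≢ x → ¬ v ~ a
    others-avoid-a v-out v≢x va = augment₃ v-out x-out v≢x va xb

    others-avoid-b : ∀ {v} → Outside a b c d v → v ≢ x → ¬ v ~ b
    others-avoid-b v-out v≢x vb = augment₃ x-out v-out (v≢x ∘ sym) xa vb

    -- A second outside vertex could only be adjacent to c, and then cv, da, bx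
    -- would be disjoint.
    only : Avoided d → d ~ a → ∀ {v} → Outside a b c d v → v ≡ x
    only d-avoided da {v} v-out@((v≢a , v≢b) , (v≢c , v≢d)) with v ≟ x
    ... | yes v≡x = v≡x
    ... | no v≢x with outside-neighbour v-out
    ... | inj₁ va               = contradiction va (others-avoid-a v-out v≢x)
    ... | inj₂ (inj₁ vb)        = contradiction vb (others-avoid-b v-out v≢x)
    ... | inj₂ (inj₂ (inj₁ vc)) = contradiction ((b≢d ∘ sym , x≢d ∘ sym) , (~-≢ ab , ~-≢ (~-sym xa)))
      (no-three-arcs vc da (~-sym xb) ((v≢d , v≢a) , (~-≢ cd , a≢c ∘ sym)) ((v≢b , v≢x) , (b≢c ∘ sym , x≢c ∘ sym)))
    ... | inj₂ (inj₂ (inj₂ vd)) = contradiction vd (d-avoided v-out)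

    -- Every outside vertex is one of the apexes, by augmenting paths at `ab` and `cd`. Distinct
    -- apexes give two separate triangles. A common apex gives two triangles sharing a vertex: one
    -- edge between `ab` and `cd` makes this Hamiltonian, none makes it the bowtie.
    two-apexes : ∀ {y} → TwoEdges.Apex (two-edges-exchange E) y → Classified
    two-apexes {y} (y-out′ , yc , yd) with x ≟ y
    ... | no x≢y = inj₁ (inj₁ (two-pieces G
      (triangle-piece G ab (~-sym xb) (~-sym xa)
        (triangle-isolated (~-sym xb) cd dy cy a≢c a≢d a≢y ((b≢c , b≢d) , (x≢c , x≢d)) b≢y x≢y (~-≢ ab) (~-≢ (~-sym xa)))
        (triangle-isolated (~-sym xa) cd dy cy b≢c b≢d b≢y ((a≢c , a≢d) , (x≢c , x≢d)) a≢y x≢y (~-≢ (~-sym ab)) (~-≢ (~-sym xb)))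
        (triangle-isolated ab cd dy cy x≢c x≢d x≢y apart a≢y b≢y (~-≢ xa) (~-≢ xb)))
      (triangle-piece G cd dy cy
        (triangle-isolated dy ab bx ax (a≢c ∘ sym) (b≢c ∘ sym) (x≢c ∘ sym) ((a≢d ∘ sym , b≢d ∘ sym) , (a≢y ∘ sym , b≢y ∘ sym)) (x≢d ∘ sym) (x≢y ∘ sym) (~-≢ cd) (~-≢ cy))
        (triangle-isolated cy ab bx ax (a≢d ∘ sym) (b≢d ∘ sym) (x≢d ∘ sym) ((a≢c ∘ sym , b≢c ∘ sym) , (a≢y ∘ sym , b≢y ∘ sym)) (x≢c ∘ sym) (x≢y ∘ sym) (~-≢ (~-sym cd)) (~-≢ dy))
        (triangle-isolated cd ab bx ax (a≢y ∘ sym) (b≢y ∘ sym) (x≢y ∘ sym) (apart-sym apart) (x≢c ∘ sym) (x≢d ∘ sym) (~-≢ yc) (~-≢ yd)))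
      every disjoint))
      where
      cy : c ~ y
      cy = ~-sym yc
      dy : d ~ y
      dy = ~-sym yd
      ax : a ~ x
      ax = ~-sym xa
      bx : b ~ x
      bx = ~-sym xb
      y-out : Outside a b c d y
      y-out = outside-exchange y-out′
      a≢y : a ≢ y
      a≢y = proj₁ (proj₁ y-out) ∘ sym
      b≢y : b ≢ y
      b≢y = proj₂ (proj₁ y-out) ∘ sym
      every : ∀ v → (v ≡ a ⊎ v ≡ b ⊎ v ≡ x) ⊎ (v ≡ c ⊎ v ≡ d ⊎ v ≡ y)
      every v with position a b c d v
      ... | at-a = inj₁ (inj₁ refl)
      ... | at-b = inj₁ (inj₂ (inj₁ refl))
      ... | at-c = inj₂ (inj₁ refl)
      ... | at-d = inj₂ (inj₂ (inj₁ refl))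
      ... | out v-out with v ≟ x | v ≟ y
      ... | yes v≡x | _       = inj₁ (inj₂ (inj₂ v≡x))
      ... | no _    | yes v≡y = inj₂ (inj₂ (inj₂ v≡y))
      ... | no v≢x  | no v≢y with outside-neighbour v-out
      ... | inj₁ va               = contradiction va (others-avoid-a v-out v≢x)
      ... | inj₂ (inj₁ vb)        = contradiction vb (others-avoid-b v-out v≢x)
      ... | inj₂ (inj₂ (inj₁ vc)) = contradiction yd (TwoEdges.augment₃ (two-edges-exchange E)
        (outside-exchange v-out) y-out′ v≢y vc)
      ... | inj₂ (inj₂ (inj₂ vd)) = contradiction vd (TwoEdges.augment₃ (two-edges-exchange E)
        y-out′ (outside-exchange v-out) (v≢y ∘ sym) yc)
      disjoint : ∀ {v} → v ≡ a ⊎ v ≡ b ⊎ v ≡ x → ¬ (v ≡ c ⊎ v ≡ d ⊎ v ≡ y)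
      disjoint (inj₁ refl)        = [ a≢c , [ a≢d , a≢y ]′ ]′
      disjoint (inj₂ (inj₁ refl)) = [ b≢c , [ b≢d , b≢y ]′ ]′
      disjoint (inj₂ (inj₂ refl)) = [ x≢c , [ x≢d , x≢y ]′ ]′
    ... | yes refl = common-apex
      where
      only-apex : ∀ {v} → Outside a b c d v → v ≡ x
      only-apex {v} v-out with v ≟ x
      ... | yes v≡x = v≡x
      ... | no v≢x with outside-neighbour v-out
      ... | inj₁ va               = contradiction va (others-avoid-a v-out v≢x)
      ... | inj₂ (inj₁ vb)        = contradiction vb (others-avoid-b v-out v≢x)
      ... | inj₂ (inj₂ (inj₁ vc)) = contradiction yd (TwoEdges.augment₃ (two-edges-exchange E)
        (outside-exchange v-out) y-out′ v≢x vc)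
      ... | inj₂ (inj₂ (inj₂ vd)) = contradiction vd (TwoEdges.augment₃ (two-edges-exchange E)
        y-out′ (outside-exchange v-out) (v≢x ∘ sym) yc)
      open Spanning x-out only-apex
      common-apex : Classified
      common-apex with adj? G a c | adj? G a d | adj? G b c | adj? G b d
      ... | yes ac | _ | _ | _ = pentagon (4F ∷ 1F ∷ 0F ∷ 2F ∷ 3F ∷ []) (xb ∷ ~-sym ab ∷ ac ∷ cd ∷ ~-sym yd ∷ [])
      ... | no _ | yes ad | _ | _ = pentagon (4F ∷ 1F ∷ 0F ∷ 3F ∷ 2F ∷ []) (xb ∷ ~-sym ab ∷ ad ∷ ~-sym cd ∷ ~-sym yc ∷ [])
      ... | no _ | no _ | yes bc | _ = pentagon (4F ∷ 0F ∷ 1F ∷ 2F ∷ 3F ∷ []) (xa ∷ ab ∷ bc ∷ cd ∷ ~-sym yd ∷ [])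
      ... | no _ | no _ | no _ | yes bd = pentagon (4F ∷ 0F ∷ 1F ∷ 3F ∷ 2F ∷ []) (xa ∷ ab ∷ bd ∷ ~-sym cd ∷ ~-sym yc ∷ [])
      ... | no a≁c | no a≁d | no b≁c | no b≁d = bowtie-shape (0F ∷ 1F ∷ 4F ∷ 2F ∷ 3F ∷ [])
        (ab ∷ ~-sym xb ∷ ~-sym xa ∷ yc ∷ cd ∷ yd ∷ []) (a≁c ∷ a≁d ∘ ~-sym ∷ b≁c ∷ b≁d ∷ [])

    -- The vertices are the triangle `abx`, the vertex `d` attached at `a`, and `c`. If `c` is
    -- adjacent to `x` or `b`, there is a pentagon; if it meets none of `a`, `b`, `x`, it is a leaf
    -- at `d`, which is then a hub. If it meets `a` only, the triangles `abx` and `acd` share `a`,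
    -- and the edge `db` decides between pentagon and bowtie.
    avoided-adjacent : Avoided d → d ~ a → Classified
    avoided-adjacent d-avoided da with adj? G c x | adj? G c b | adj? G c a
    ... | yes cx | _ | _ = pentagon (4F ∷ 1F ∷ 0F ∷ 3F ∷ 2F ∷ [])
      (xb ∷ ~-sym ab ∷ ~-sym da ∷ ~-sym cd ∷ cx ∷ [])
      where open Spanning x-out (only d-avoided da)
    ... | no _ | yes cb | _ = pentagon (4F ∷ 0F ∷ 3F ∷ 2F ∷ 1F ∷ [])
      (xa ∷ ~-sym da ∷ ~-sym cd ∷ cb ∷ ~-sym xb ∷ [])
      where open Spanning x-out (only d-avoided da)
    ... | no c≁x | no c≁b | no c≁a = hub⇒classified record
      { ab = ab ; bc = ~-sym xb ; ac = ~-sym xa ; u≢a = a≢d ∘ sym ; u≢b = b≢d ∘ sym ; u≢c = x≢d ∘ sym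
      ; leaf = leaf }
      where
      leaf : ∀ {v w} → v ~ w → v ≢ d → v ≢ a → v ≢ b → v ≢ x → w ≡ d
      leaf {v} {w} vw v≢d v≢a v≢b v≢x with position a b c d v | position a b c d w
      ... | at-a    | _       = contradiction refl v≢a
      ... | at-b    | _       = contradiction refl v≢b
      ... | at-d    | _       = contradiction refl v≢d
      ... | out o   | _       = contradiction (only d-avoided da o) v≢x
      ... | at-c    | at-a    = contradiction vw c≁a
      ... | at-c    | at-b    = contradiction vw c≁b
      ... | at-c    | at-c    = contradiction refl (~-≢ vw)
      ... | at-c    | at-d    = refl
      ... | at-c    | out o   = contradiction (subst (c ~_) (only d-avoided da o) vw) c≁x
    ... | no c≁x | no c≁b | yes ca with adj? G d b
    ... | yes db = pentagon (4F ∷ 0F ∷ 2F ∷ 3F ∷ 1F ∷ []) (xa ∷ ~-sym ca ∷ cd ∷ db ∷ ~-sym xb ∷ [])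
      where open Spanning x-out (only d-avoided da)
    ... | no d≁b = bowtie-shape (1F ∷ 4F ∷ 0F ∷ 2F ∷ 3F ∷ [])
      (~-sym xb ∷ xa ∷ ~-sym ab ∷ ~-sym ca ∷ cd ∷ ~-sym da ∷ [])
      (c≁b ∘ ~-sym ∷ d≁b ∷ c≁x ∘ ~-sym ∷ d-avoided x-out ∷ [])
      where open Spanning x-out (only d-avoided da)

  -- If `d` meets neither `a` nor `b`, its only neighbour is `c`, and `c` is a hub for the triangle
  -- `abx`. Otherwise swapping `a` and `b` reduces to `d ~ a`.
  one-apex : ∀ {a b c d} (E : TwoEdges a b c d) {x} → TwoEdges.Apex E x → TwoEdges.Avoided E d → Classified
  one-apex {a} {b} {c} {d} E {x} apex d-avoided with adj? G d a | adj? G d b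
  ... | yes da | _      = OneApex.avoided-adjacent E apex d-avoided da
  ... | no _   | yes db = let x-out , xa , xb = apex in
    OneApex.avoided-adjacent (two-edges-swap₁ E) (outside-swap₁ x-out , xb , xa)
      (d-avoided ∘ outside-swap₁) db
  ... | no d≁a | no d≁b = hub⇒classified record
    { ab = ab ; bc = ~-sym xb ; ac = ~-sym xa ; u≢a = a≢c ∘ sym ; u≢b = b≢c ∘ sym ; u≢c = x≢c ∘ sym
    ; leaf = leaf }
    where
    open TwoEdges E
    open OneApex E apex
    leaf : ∀ {v w} → v ~ w → v ≢ c → v ≢ a → v ≢ b → v ≢ x → w ≡ c
    leaf {v} {w} vw v≢c v≢a v≢b v≢x with position a b c d v | position a b c d w
    ... | at-a  | _      = contradiction refl v≢a
    ... | at-b  | _      = contradiction refl v≢b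
    ... | at-c  | _      = contradiction refl v≢c
    ... | _     | at-c   = refl
    ... | at-d  | at-a   = contradiction vw d≁a
    ... | at-d  | at-b   = contradiction vw d≁b
    ... | at-d  | at-d   = contradiction refl (~-≢ vw)
    ... | at-d  | out o  = contradiction (~-sym vw) (d-avoided o)
    ... | out o | at-a   = contradiction vw (others-avoid-a o v≢x)
    ... | out o | at-b   = contradiction vw (others-avoid-b o v≢x)
    ... | out o | at-d   = contradiction vw (d-avoided o)
    ... | out o | out o′ = contradiction vw (independent o o′)

  -- Each of the two edges has an apex or one of two avoided ends, which makes nine cases. Reversing
  -- either edge and exchanging the edges reduce them to three: two apexes, an apex over `ab` with
  -- `d` avoided, and `b`, `d` avoided.
  classify : ∀ {a b c d} → TwoEdges a b c d → Classified
  classify E with TwoEdges.apex-or-avoided E | TwoEdges.apex-or-avoided (two-edges-exchange E)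
  ... | inj₁ (_ , apex) | inj₁ (_ , apex′) = OneApex.two-apexes E apex apex′
  ... | inj₁ (_ , x-out , xa , xb) | inj₂ (inj₁ c-avoided) =
    one-apex (two-edges-swap₂ E) (outside-swap₂ x-out , xa , xb)
      (c-avoided ∘ outside-exchange ∘ outside-swap₂)
  ... | inj₁ (_ , apex) | inj₂ (inj₂ d-avoided) = one-apex E apex (d-avoided ∘ outside-exchange)
  ... | inj₂ (inj₁ a-avoided) | inj₁ (_ , y-out , yc , yd) =
    one-apex (two-edges-swap₂ (two-edges-exchange E)) (outside-swap₂ y-out , yc , yd)
      (a-avoided ∘ outside-exchange ∘ outside-swap₂)
  ... | inj₂ (inj₂ b-avoided) | inj₁ (_ , apex) =
    one-apex (two-edges-exchange E) apex (b-avoided ∘ outside-exchange)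
  ... | inj₂ (inj₁ a-avoided) | inj₂ (inj₁ c-avoided) = two-avoided (two-edges-swap₁ (two-edges-swap₂ E))
    (a-avoided ∘ outside-swap₂ ∘ outside-swap₁)
    (c-avoided ∘ outside-exchange ∘ outside-swap₂ ∘ outside-swap₁)
  ... | inj₂ (inj₁ a-avoided) | inj₂ (inj₂ d-avoided) = two-avoided (two-edges-swap₁ E)
    (a-avoided ∘ outside-swap₁) (d-avoided ∘ outside-exchange ∘ outside-swap₁)
  ... | inj₂ (inj₂ b-avoided) | inj₂ (inj₁ c-avoided) = two-avoided (two-edges-swap₂ E)
    (b-avoided ∘ outside-swap₂) (c-avoided ∘ outside-exchange ∘ outside-swap₂)
  ... | inj₂ (inj₂ b-avoided) | inj₂ (inj₂ d-avoided) = two-avoided E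
    b-avoided (d-avoided ∘ outside-exchange)

  classification : TwoDisjoint G → Classified
  classification (_ , _ , ab , cd , apart) = classify record { ab = ab ; cd = cd ; apart = apart }

-- Connectedness of the disjointness graph

map₂ : ∀ {m n} → (Fin m → Fin n) → Fin m × Fin m → Fin n × Fin n
map₂ g (i , j) = g i , g j

apart-map : ∀ {m n} {g : Fin m → Fin n} → (∀ {i j} → g i ≡ g j → i ≡ j) →
            ∀ {p q} → Apart p q → Apart (map₂ g p) (map₂ g q)
apart-map g-inj ((uw , uz) , (vw , vz)) = (uw ∘ g-inj , uz ∘ g-inj) , (vw ∘ g-inj , vz ∘ g-inj)

path-map : ∀ {m n} {G : Graph m} {H : Graph n} {g : Fin m → Fin n} →
           (∀ {p q} → Link G p q → Link H (map₂ g p) (map₂ g q)) →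
           ∀ {p q} → TransClosure (Link G) p q → TransClosure (Link H) (map₂ g p) (map₂ g q)
path-map                         f [ pq ]      = [ f pq ]
path-map {G = G} {H = H} {g = g} f (pq ∷ rest) = f pq ∷ path-map {G = G} {H = H} {g = g} f rest

side : Fin 5 → Fin 5 × Fin 5
side 0F = 0F , 1F
side 1F = 1F , 2F
side 2F = 2F , 3F
side 3F = 3F , 4F
side 4F = 4F , 0F

-- Each vertex lies on two sides, so two vertices meet at most four of the five.
side-apart-from : ∀ i j → i ≢ j → ∃[ k ] Apart (i , j) (side k)
side-apart-from = from-yes (all? λ i → all? λ j → ¬? (i ≟ j) →-dec any? λ k → apart? (i , j) (side k))

module _ {n} (G : Graph n) where

  path-swap : ∀ {p r} → TransClosure (Link G) p r → TransClosure (Link G) (swap p) r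
  path-swap [ p∈ , q∈ , a ]        = [ symm G p∈ , q∈ , apart-swapˡ a ]
  path-swap ((p∈ , q∈ , a) ∷ rest) = (symm G p∈ , q∈ , apart-swapˡ a) ∷ rest

  module _ {p q x z y} (xp : Adj G x p) (pz : Adj G p z) (zq : Adj G z q) (qy : Adj G q y)
           (x≢z : x ≢ z) (z≢y : z ≢ y) (x≢y : x ≢ y) (p≢q : p ≢ q) (p≁q : ¬ Adj G p q)
           (cover : ∀ {v w} → Adj G v w → (v ≡ p ⊎ v ≡ q) ⊎ (w ≡ p ⊎ w ≡ q)) where

    -- Every edge is a spoke at `p` or at `q`, and `pv`, `qw` are disjoint exactly when `v` and `w`
    -- differ. A spoke `pv` reaches `px` through `qy`, or through `qz` when `v` is `y`; a spoke `qw`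
    -- is disjoint from `px` unless `w` is `x`, and then it passes through `pz`.
    path-connected : Connected G
    path-connected = (p , x) , λ (u , v) → path
      where
      px : Adj G p x
      px = symm G xp
      qz : Adj G q z
      qz = symm G zq
      x≢q : x ≢ q
      x≢q refl = p≁q px
      y≢p : y ≢ p
      y≢p refl = p≁q (symm G qy)
      z≢q : z ≢ q
      z≢q = adj-≢ G zq
      x≢p : x ≢ p
      x≢p = adj-≢ G xp
      z≢p : z ≢ p
      z≢p = adj-≢ G pz ∘ sym
      y≢q : y ≢ q
      y≢q = adj-≢ G qy ∘ sym

      spokes-link : ∀ {v w} → Adj G p v → Adj G q w → v ≢ w → Link G (p , v) (q , w)
      spokes-link pv qw v≢w = pv , qw , ((p≢q , λ { refl → p≁q (symm G qw) }) , ((λ { refl → p≁q pv }) , v≢w))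

      from-p : ∀ {v} → Adj G p v → TransClosure (Link G) (p , v) (p , x)
      from-p {v} pv with v ≟ y
      ... | no v≢y   = spokes-link pv qy v≢y ∷ [ link-sym G (spokes-link px qy x≢y) ]
      ... | yes refl = spokes-link pv qz (z≢y ∘ sym) ∷ [ link-sym G (spokes-link px qz x≢z) ]

      from-q : ∀ {w} → Adj G q w → TransClosure (Link G) (q , w) (p , x)
      from-q {w} qw with w ≟ x
      ... | no w≢x   = [ link-sym G (spokes-link px qw (w≢x ∘ sym)) ]
      ... | yes refl = link-sym G (spokes-link pz qw (x≢z ∘ sym)) ∷ from-p pz

      path : ∀ {u v} → Adj G u v → TransClosure (Link G) (u , v) (p , x)
      path uv with cover uv
      ... | inj₁ (inj₁ refl) = from-p uv
      ... | inj₁ (inj₂ refl) = from-q uv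
      ... | inj₂ (inj₁ refl) = path-swap (from-p (symm G uv))
      ... | inj₂ (inj₂ refl) = path-swap (from-q (symm G uv))

  module _ {u a b c x} (ab : Adj G a b) (bc : Adj G b c) (ac : Adj G a c) (ux : Adj G u x)
           (u≢a : u ≢ a) (u≢b : u ≢ b) (u≢c : u ≢ c) (x≢a : x ≢ a) (x≢b : x ≢ b) (x≢c : x ≢ c)
           (cover : ∀ {v w} → Adj G v w →
              (v ≡ u ⊎ w ≡ u) ⊎ ((v ≡ a ⊎ v ≡ b ⊎ v ≡ c) × (w ≡ a ⊎ w ≡ b ⊎ w ≡ c))) where

    -- A side of the triangle is disjoint from `ux`. An edge `uv` is disjoint from some side of the
    -- triangle that avoids `v`, and that side is disjoint from `ux`.
    hub-connected : Connected G
    hub-connected = (u , x) , λ _ → path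
      where
      spokes-link : ∀ {v w z} → Adj G u v → Adj G w z → u ≢ w → u ≢ z → v ≢ w → v ≢ z → Link G (u , v) (w , z)
      spokes-link uv wz uw uz vw vz = uv , wz , ((uw , uz) , (vw , vz))

      from-u : ∀ {v} → Adj G u v → TransClosure (Link G) (u , v) (u , x)
      from-u {v} uv with v ≟ a | v ≟ b
      ... | no v≢a   | no v≢b   = spokes-link uv ab u≢a u≢b v≢a v≢b ∷ [ link-sym G (spokes-link ux ab u≢a u≢b x≢a x≢b) ]
      ... | yes refl | _        = spokes-link uv bc u≢b u≢c (adj-≢ G ab) (adj-≢ G ac) ∷ [ link-sym G (spokes-link ux bc u≢b u≢c x≢b x≢c) ]
      ... | no _     | yes refl = spokes-link uv ac u≢a u≢c (adj-≢ G ab ∘ sym) (adj-≢ G bc) ∷ [ link-sym G (spokes-link ux ac u≢a u≢c x≢a x≢c) ]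

      off-triangle : ∀ {v} → v ≡ a ⊎ v ≡ b ⊎ v ≡ c → u ≢ v × x ≢ v
      off-triangle (inj₁ refl)        = u≢a , x≢a
      off-triangle (inj₂ (inj₁ refl)) = u≢b , x≢b
      off-triangle (inj₂ (inj₂ refl)) = u≢c , x≢c

      path : ∀ {v w} → Adj G v w → TransClosure (Link G) (v , w) (u , x)
      path vw with cover vw
      ... | inj₁ (inj₁ refl) = from-u vw
      ... | inj₁ (inj₂ refl) = path-swap (from-u (symm G vw))
      ... | inj₂ (v∈ , w∈)   =
        let u≢v , x≢v = off-triangle v∈
            u≢w , x≢w = off-triangle w∈
        in [ link-sym G (spokes-link ux vw u≢v u≢w x≢v x≢w) ]

  module _ {g : Fin 5 → Fin n} (g-inj : ∀ {i j} → g i ≡ g j → i ≡ j)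
           (sides : ∀ k → IsArc G (map₂ g (side k)))
           (spanned : ∀ {v w} → Adj G v w → ∃₂ λ i j → g i ≡ v × g j ≡ w) where

    -- The disjointness graph of the five sides is again a 5-cycle, and every edge, side or chord,
    -- is disjoint from some side.
    pentagon-connected : Connected G
    pentagon-connected = map₂ g (side 0F) , λ _ → path
      where
      next : ∀ k l {_ : True (apart? (side k) (side l))} → Link G (map₂ g (side k)) (map₂ g (side l))
      next k l {apart} = sides k , sides l , apart-map {g = g} g-inj (toWitness apart)

      side-path : ∀ k → TransClosure (Link G) (map₂ g (side k)) (map₂ g (side 0F))
      side-path 0F = next 0F 2F ∷ [ next 2F 0F ]
      side-path 1F = next 1F 3F ∷ [ next 3F 0F ]
      side-path 2F = [ next 2F 0F ]
      side-path 3F = [ next 3F 0F ]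
      side-path 4F = next 4F 2F ∷ [ next 2F 0F ]

      path : ∀ {v w} → Adj G v w → TransClosure (Link G) (v , w) (map₂ g (side 0F))
      path vw with spanned vw
      ... | i , j , refl , refl =
        let k , apart = side-apart-from i j λ { refl → irrefl G refl vw }
        in (vw , sides k , apart-map {g = g} g-inj apart) ∷ side-path k

  -- Lying in C or D is a stable proposition, so the component of a vertex may be
  -- formed under a double negation, without deciding reachability.
  two-components-connected : NoIsolatedVertices G → TwoTriangleOrStarComponents G → Connected G
  two-components-connected no-isolated
    (C , D , C-component@(r , C-reach) , D-component@(s , D-reach) , C≢D , only , _) =
    (r , proj₁ (no-isolated r)) , λ _ → path
    where
    somewhere : ∀ v → v ∈ C ⊎ v ∈ D
    somewhere v = decidable-stable ((v ∈? C) ⊎-dec (v ∈? D)) λ nowhere →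
      ¬¬-sequence (λ w → ¬¬-excluded-middle {A = Star (Adj G) v w}) λ reach? →
        nowhere (Sum.map (λ E≡C → subst (v ∈_) E≡C (from (∈-subset reach? v) ε))
                         (λ E≡D → subst (v ∈_) E≡D (from (∈-subset reach? v) ε))
                         (only (subset reach?) (v , ∈-subset reach?)))
      where
      ¬¬-sequence : ∀ {k} {P : Fin k → Set} → (∀ i → ¬ ¬ P i) → ¬ ¬ (∀ i → P i)
      ¬¬-sequence {ℕ.zero}  _ ¬all = ¬all λ ()
      ¬¬-sequence {ℕ.suc k} p ¬all =
        p zero λ p₀ → ¬¬-sequence (p ∘ suc) λ ps → ¬all λ { zero → p₀ ; (suc i) → ps i }

    C-closed : ∀ {v w} → v ∈ C → Adj G v w → w ∈ C
    C-closed v∈ vw = from (C-reach _) (to (C-reach _) v∈ ◅◅ vw ◅ ε)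

    D-closed : ∀ {v w} → v ∈ D → Adj G v w → w ∈ D
    D-closed v∈ vw = from (D-reach _) (to (D-reach _) v∈ ◅◅ vw ◅ ε)

    distinct : ∀ {v w} → v ∈ C → w ∈ D → v ≢ w
    distinct v∈C v∈D refl = C≢D (same-component G C-component D-component v∈C v∈D)

    -- Edges in different components are disjoint, so a route to the root needs at most one detour
    -- through the other component.
    across : ∀ {v w v′ w′} → v ∈ C → Adj G v w → v′ ∈ D → Adj G v′ w′ → Link G (v , w) (v′ , w′)
    across v∈ vw v′∈ v′w′ = vw , v′w′ ,
      ( (distinct v∈ v′∈ , distinct v∈ (D-closed v′∈ v′w′))
      , (distinct (C-closed v∈ vw) v′∈ , distinct (C-closed v∈ vw) (D-closed v′∈ v′w′)))

    r∈C : r ∈ C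
    r∈C = root∈ G C-component
    s∈D : s ∈ D
    s∈D = root∈ G D-component

    path : ∀ {v w} → Adj G v w → TransClosure (Link G) (v , w) (r , proj₁ (no-isolated r))
    path {v} vw with somewhere v
    ... | inj₁ v∈C = across v∈C vw s∈D (proj₂ (no-isolated s))
                   ∷ [ link-sym G (across r∈C (proj₂ (no-isolated r)) s∈D (proj₂ (no-isolated s))) ]
    ... | inj₂ v∈D = [ link-sym G (across r∈C (proj₂ (no-isolated r)) v∈D vw) ]

-- Transport along isomorphisms

module _ {m n} {G : Graph m} {H : Graph n} (G≅H : G ≅ H) where

  open Inverse (proj₁ G≅H) using () renaming (to to f; from to f⁻¹; strictlyInverseˡ to f∘f⁻¹; strictlyInverseʳ to f⁻¹∘f)

  f-injective : ∀ {u v} → f u ≡ f v → u ≡ v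
  f-injective {u} {v} eq = ≡.trans (sym (f⁻¹∘f u)) (≡.trans (cong f⁻¹ eq) (f⁻¹∘f v))

  f⁻¹-injective : ∀ {u v} → f⁻¹ u ≡ f⁻¹ v → u ≡ v
  f⁻¹-injective {u} {v} eq = ≡.trans (sym (f∘f⁻¹ u)) (≡.trans (cong f eq) (f∘f⁻¹ v))

  iso-adj : ∀ {u v} → Adj G u v → Adj H (f u) (f v)
  iso-adj = Equivalence.to (proj₂ G≅H _ _)

  iso-adj⁻¹ : ∀ {u v} → Adj H u v → Adj G (f⁻¹ u) (f⁻¹ v)
  iso-adj⁻¹ {u} {v} uv = Equivalence.from (proj₂ G≅H _ _)
    (≡.subst₂ (Adj H) (sym (f∘f⁻¹ u)) (sym (f∘f⁻¹ v)) uv)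

  iso-link : ∀ {p q} → Link G p q → Link H (map₂ f p) (map₂ f q)
  iso-link (p∈ , q∈ , a) = iso-adj p∈ , iso-adj q∈ , apart-map {g = f} f-injective a

  iso-link⁻¹ : ∀ {p q} → Link H p q → Link G (map₂ f⁻¹ p) (map₂ f⁻¹ q)
  iso-link⁻¹ (p∈ , q∈ , a) = iso-adj⁻¹ p∈ , iso-adj⁻¹ q∈ , apart-map {g = f⁻¹} f⁻¹-injective a

  map₂-f⁻¹∘f : ∀ p → map₂ f⁻¹ (map₂ f p) ≡ p
  map₂-f⁻¹∘f (u , v) = ≡.cong₂ _,_ (f⁻¹∘f u) (f⁻¹∘f v)

  connected-iso : Connected H → Connected G
  connected-iso (r , path) = map₂ f⁻¹ r , λ p p∈ →
    subst (λ p → TransClosure (Link G) p (map₂ f⁻¹ r)) (map₂-f⁻¹∘f p)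
      (path-map {G = H} {H = G} {g = f⁻¹} iso-link⁻¹ (path (map₂ f p) (iso-adj p∈)))

  partnered-iso : Partnered H → Partnered G
  partnered-iso partner p p∈ =
    let q , pq = partner (map₂ f p) (iso-adj p∈)
    in map₂ f⁻¹ q , subst (λ p → Link G p (map₂ f⁻¹ q)) (map₂-f⁻¹∘f p) (iso-link⁻¹ pq)

-- On four vertices disjoint arcs are complementary, so the perfect matching
-- {01, 23} is a union of classes of linked arcs.
inFirstMatching : Fin 4 × Fin 4 → Bool
inFirstMatching (u , v) = does ((toℕ u ℕ.<ᵇ 2) Bool.≟ (toℕ v ℕ.<ᵇ 2))

inFirstMatching-swap : ∀ u v → inFirstMatching (v , u) ≡ inFirstMatching (u , v)
inFirstMatching-swap = from-yes (all? λ u → all? λ v → inFirstMatching (v , u) Bool.≟ inFirstMatching (u , v))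

inFirstMatching-apart : ∀ u v w z → u ≢ v → w ≢ z → Apart (u , v) (w , z) →
                        inFirstMatching (u , v) ≡ inFirstMatching (w , z)
inFirstMatching-apart = from-yes (all? λ u → all? λ v → all? λ w → all? λ z →
  ¬? (u ≟ v) →-dec (¬? (w ≟ z) →-dec (apart? (u , v) (w , z) →-dec
    (inFirstMatching (u , v) Bool.≟ inFirstMatching (w , z)))))

-- Pulling the colouring back along the isomorphism separates the arc `01`, which lies in the first
-- matching, from `12`, which does not. This handles `K₄` and `C₄` together.
four-vertices-not-cohenMacaulay : ∀ {c ℓ} (R : CommutativeRing c ℓ) →
  (let open CommutativeRing R in ¬ 1# ≈ 0#) → ∀ {n} {G : Graph n} → matchingComplex G HasDim (+ 1) →
  ∀ (H : Graph 4) → G ≅ H → Adj H 0F 1F → Adj H 1F 2F → ¬ CohenMacaulay R (matchingComplex G)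
four-vertices-not-cohenMacaulay R 1≉0 {G = G} dim1 H G≅H 01∈H 12∈H =
  disconnected⇒¬cohenMacaulay G dim1 R 1≉0 (inFirstMatching ∘ map₂ (Inverse.to (proj₁ G≅H)))
    (λ (u , v) → inFirstMatching-swap (Inverse.to (proj₁ G≅H) u) (Inverse.to (proj₁ G≅H) v))
    (λ pq → let p∈ , q∈ , apart = iso-link {G = G} {H} G≅H pq in
      inFirstMatching-apart _ _ _ _ (adj-≢ H p∈) (adj-≢ H q∈) apart)
    (iso-adj⁻¹ {G = G} {H} G≅H 01∈H) (iso-adj⁻¹ {G = G} {H} G≅H 12∈H)
    (cong inFirstMatching (map₂-f∘f⁻¹ (0F , 1F))) (cong inFirstMatching (map₂-f∘f⁻¹ (1F , 2F)))
  where
  map₂-f∘f⁻¹ : ∀ p → map₂ (Inverse.to (proj₁ G≅H)) (map₂ (Inverse.from (proj₁ G≅H)) p) ≡ p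
  map₂-f∘f⁻¹ (u , v) = ≡.cong₂ _,_ (Inverse.strictlyInverseˡ (proj₁ G≅H) u) (Inverse.strictlyInverseˡ (proj₁ G≅H) v)

-- Checks on fixed small graphs

partnered? : ∀ {n} (G : Graph n) → Dec (∀ u v → Adj G u v → ∃₂ λ w z → Adj G w z × Apart (u , v) (w , z))
partnered? G = all? λ u → all? λ v → adj? G u v →-dec any? λ w → any? λ z → adj? G w z ×-dec apart? (u , v) (w , z)

partnered-by-check : ∀ {n} (G : Graph n) {check : True (partnered? G)} → Partnered G
partnered-by-check G {check} (u , v) uv =
  let w , z , wz , apart = toWitness {a? = partnered? G} check u v uv in (w , z) , uv , wz , apart

K₄-partnered : Partnered (complete 4)
K₄-partnered = partnered-by-check (complete 4)

C₄-partnered : Partnered C₄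
C₄-partnered = partnered-by-check C₄

-- The sides `01` and `34` opposite to the centre are disjoint from each other, and every edge is
-- disjoint from one of them.
bowtie-connected : Connected bowtie
bowtie-connected = (0F , 1F) , λ (u , v) uv → [ (λ apart → [ uv , 01∈ , apart ])
  , (λ apart → (uv , 34∈ , apart) ∷ [ 34∈ , 01∈ , from-yes (apart? (3F , 4F) (0F , 1F)) ]) ]′ (escape u v uv)
  where
  01∈ : Adj bowtie 0F 1F
  01∈ = from-yes (adj? bowtie 0F 1F)
  34∈ : Adj bowtie 3F 4F
  34∈ = from-yes (adj? bowtie 3F 4F)
  escape : ∀ u v → Adj bowtie u v → Apart (u , v) (0F , 1F) ⊎ Apart (u , v) (3F , 4F)
  escape = from-yes (all? λ u → all? λ v → adj? bowtie u v →-dec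
    (apart? (u , v) (0F , 1F) ⊎-dec apart? (u , v) (3F , 4F)))

-- Members of the three families

module Extension (F : Family) {chosen} (chosen⊆ : chosen ⊆ˡ Family.optional F) {k} (N : Fin k → Subset 5)
                 (N⊆ : ∀ j → N j ⊆ Family.attach F) where
  open Family F

  H : Graph (5 ℕ.+ k)
  H = extend (required ++ chosen) N

  required⇒adj : ∀ {i j} → i ≢ j → (i , j) ∈ˡ required → Adj H (i ↑ˡ k) (j ↑ˡ k)
  required⇒adj {i} {j} i≢j ij∈ rewrite splitAt-↑ˡ 5 i k | splitAt-↑ˡ 5 j k = i≢j , inj₁ (∈-++⁺ˡ ij∈)

  -- The chosen edges are unknown. Conditions on arcs of the core are therefore verified with all
  -- optional edges present, where they become finite checks.
  allowed : ∀ {i j} → Joined (required ++ chosen) i j → Joined (required ++ optional) i j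
  allowed (i≢j , e) = i≢j , Sum.map widen widen e
    where
    widen : ∀ {e} → e ∈ˡ required ++ chosen → e ∈ˡ required ++ optional
    widen e∈ = [ ∈-++⁺ˡ , ∈-++⁺ʳ required ∘ chosen⊆ ]′ (∈-++⁻ required e∈)

  core-arc : ∀ {i j} → Adj H (i ↑ˡ k) (j ↑ˡ k) → Joined (required ++ optional) i j
  core-arc {i} {j} ij rewrite splitAt-↑ˡ 5 i k | splitAt-↑ˡ 5 j k = allowed ij

  -- New vertices are independent, so an arc lies inside the core or has an end among the attaching
  -- vertices. A cover that contains `attach` thus needs checking on the core alone.
  arc-cases : ∀ {x y} → Adj H x y →
    (∃₂ λ i j → i ↑ˡ k ≡ x × j ↑ˡ k ≡ y × Joined (required ++ optional) i j) ⊎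
    (∃[ i ] i ∈ attach × (x ≡ i ↑ˡ k ⊎ y ≡ i ↑ˡ k))
  arc-cases {x} {y} xy with splitAt 5 x in x≡ | splitAt 5 y in y≡
  ... | inj₁ i | inj₁ j = inj₁ (i , j , splitAt⁻¹-↑ˡ {5} x≡ , splitAt⁻¹-↑ˡ {5} y≡ , allowed xy)
  ... | inj₁ i | inj₂ j = inj₂ (i , N⊆ j xy , inj₁ (sym (splitAt⁻¹-↑ˡ {5} x≡)))
  ... | inj₂ j | inj₁ i = inj₂ (i , N⊆ j xy , inj₂ (sym (splitAt⁻¹-↑ˡ {5} y≡)))

  ↑ˡ-injective : ∀ {i j : Fin 5} → i ↑ˡ k ≡ j ↑ˡ k → i ≡ j
  ↑ˡ-injective {i} {j} = Fin.↑ˡ-injective k i j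

-- Both optional edges meet the attaching vertices `1F` and `3F`, which therefore cover all edges,
-- and neither of them joins `1F` to `3F`.
𝒢₁-connected : ∀ {n} {G : Graph n} → G ∈ᶠ 𝒢₁ → Connected G
𝒢₁-connected {G = G} (chosen , chosen⊆ , k , N , N-ok , G≅) = connected-iso {G = G} {H} G≅
  (path-connected H {1F} {3F} {0F} {2F} {4F}
    (required⇒adj {0F} {1F} (λ ()) (here refl)) (required⇒adj {1F} {2F} (λ ()) (there (here refl)))
    (required⇒adj {2F} {3F} (λ ()) (there (there (here refl))))
    (required⇒adj {3F} {4F} (λ ()) (there (there (there (here refl)))))
    (λ ()) (λ ()) (λ ()) (λ ()) (λ 13∈ → from-no (joined? full 1F 3F) (core-arc {1F} {3F} 13∈)) cover)
  where
  open Extension 𝒢₁ chosen⊆ N (λ j → proj₁ (N-ok j))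
  full = Family.required 𝒢₁ ++ Family.optional 𝒢₁
  core-cover : ∀ i j → Joined full i j → (i ≡ 1F ⊎ i ≡ 3F) ⊎ (j ≡ 1F ⊎ j ≡ 3F)
  core-cover = from-yes (all? λ i → all? λ j → joined? full i j →-dec
    (((i ≟ 1F) ⊎-dec (i ≟ 3F)) ⊎-dec ((j ≟ 1F) ⊎-dec (j ≟ 3F))))
  attach-cases : ∀ i → i ∈ Family.attach 𝒢₁ → i ≡ 1F ⊎ i ≡ 3F
  attach-cases = from-yes (all? λ i → (i ∈? Family.attach 𝒢₁) →-dec ((i ≟ 1F) ⊎-dec (i ≟ 3F)))
  lift : ∀ {i} → i ≡ 1F ⊎ i ≡ 3F → i ↑ˡ k ≡ 1F ⊎ i ↑ˡ k ≡ 3F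
  lift = Sum.map (cong (_↑ˡ k)) (cong (_↑ˡ k))
  cover : ∀ {v w} → Adj H v w → (v ≡ 1F ⊎ v ≡ 3F) ⊎ (w ≡ 1F ⊎ w ≡ 3F)
  cover {v} {w} vw with arc-cases {v} {w} vw
  ... | inj₁ (i , j , refl , refl , ij) = Sum.map lift lift (core-cover i j ij)
  ... | inj₂ (i , i∈ , inj₁ refl)       = inj₁ (lift (attach-cases i i∈))
  ... | inj₂ (i , i∈ , inj₂ refl)       = inj₂ (lift (attach-cases i i∈))

𝒢₂-connected : ∀ {n} {G : Graph n} → G ∈ᶠ 𝒢₂ → Connected G
𝒢₂-connected {G = G} (chosen , chosen⊆ , k , N , N-ok , G≅) = connected-iso {G = G} {H} G≅
  (hub-connected H {3F} {0F} {1F} {2F} {4F}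
    (required⇒adj {0F} {1F} (λ ()) (here refl)) (required⇒adj {1F} {2F} (λ ()) (there (here refl)))
    (required⇒adj {0F} {2F} (λ ()) (there (there (here refl))))
    (required⇒adj {3F} {4F} (λ ()) (there (there (there (there (here refl))))))
    (λ ()) (λ ()) (λ ()) (λ ()) (λ ()) (λ ()) cover)
  where
  open Extension 𝒢₂ chosen⊆ N (λ j → proj₁ (N-ok j))
  full = Family.required 𝒢₂ ++ Family.optional 𝒢₂
  InTriangle : Fin 5 → Set
  InTriangle i = i ≡ 0F ⊎ i ≡ 1F ⊎ i ≡ 2F
  inTriangle? : ∀ i → Dec (InTriangle i)
  inTriangle? i = (i ≟ 0F) ⊎-dec ((i ≟ 1F) ⊎-dec (i ≟ 2F))
  core-cover : ∀ i j → Joined full i j → (i ≡ 3F ⊎ j ≡ 3F) ⊎ (InTriangle i × InTriangle j)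
  core-cover = from-yes (all? λ i → all? λ j → joined? full i j →-dec
    (((i ≟ 3F) ⊎-dec (j ≟ 3F)) ⊎-dec (inTriangle? i ×-dec inTriangle? j)))
  attach-cases : ∀ i → i ∈ Family.attach 𝒢₂ → i ≡ 3F
  attach-cases = from-yes (all? λ i → (i ∈? Family.attach 𝒢₂) →-dec (i ≟ 3F))
  lift : ∀ {i} → InTriangle i → i ↑ˡ k ≡ 0F ⊎ i ↑ˡ k ≡ 1F ⊎ i ↑ˡ k ≡ 2F
  lift = Sum.map (cong (_↑ˡ k)) (Sum.map (cong (_↑ˡ k)) (cong (_↑ˡ k)))
  cover : ∀ {v w} → Adj H v w →
    (v ≡ 3F ⊎ w ≡ 3F) ⊎ ((v ≡ 0F ⊎ v ≡ 1F ⊎ v ≡ 2F) × (w ≡ 0F ⊎ w ≡ 1F ⊎ w ≡ 2F))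
  cover {v} {w} vw with arc-cases {v} {w} vw
  ... | inj₂ (i , i∈ , inj₁ refl)       = inj₁ (inj₁ (cong (_↑ˡ k) (attach-cases i i∈)))
  ... | inj₂ (i , i∈ , inj₂ refl)       = inj₁ (inj₂ (cong (_↑ˡ k) (attach-cases i i∈)))
  ... | inj₁ (i , j , refl , refl , ij) =
    Sum.map (Sum.map (cong (_↑ˡ k)) (cong (_↑ˡ k))) (λ (i∈ , j∈) → lift i∈ , lift j∈) (core-cover i j ij)

𝒢₃-connected : ∀ {n} {G : Graph n} → G ∈ᶠ 𝒢₃ → Connected G
𝒢₃-connected {G = G} (chosen , chosen⊆ , k , N , N-ok , G≅) = connected-iso {G = G} {H} G≅
  (pentagon-connected H {_↑ˡ k} ↑ˡ-injective sides spanned)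
  where
  open Extension 𝒢₃ chosen⊆ N (λ j → proj₁ (N-ok j))
  sides : ∀ i → IsArc H (map₂ (_↑ˡ k) (side i))
  sides 0F = required⇒adj {0F} {1F} (λ ()) (here refl)
  sides 1F = required⇒adj {1F} {2F} (λ ()) (there (here refl))
  sides 2F = required⇒adj {2F} {3F} (λ ()) (there (there (here refl)))
  sides 3F = required⇒adj {3F} {4F} (λ ()) (there (there (there (here refl))))
  sides 4F = required⇒adj {4F} {0F} (λ ()) (there (there (there (there (here refl)))))
  spanned : ∀ {v w} → Adj H v w → ∃₂ λ i j → i ↑ˡ k ≡ v × j ↑ˡ k ≡ w
  spanned {v} {w} vw with arc-cases {v} {w} vw
  ... | inj₁ (i , j , v≡ , w≡ , _) = i , j , v≡ , w≡
  ... | inj₂ (i , i∈ , _)          = contradiction i∈ ∉⊥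

described⇒connected : ∀ {n} {G : Graph n} → NoIsolatedVertices G →
  TwoTriangleOrStarComponents G ⊎ InFamiliesOrBowtie G → Connected G
described⇒connected {G = G} no-isolated (inj₁ two)                         = two-components-connected G no-isolated two
described⇒connected {G = G} no-isolated (inj₂ (inj₁ G∈))                   = 𝒢₁-connected {G = G} G∈
described⇒connected {G = G} no-isolated (inj₂ (inj₂ (inj₁ G∈)))            = 𝒢₂-connected {G = G} G∈
described⇒connected {G = G} no-isolated (inj₂ (inj₂ (inj₂ (inj₁ G∈))))     = 𝒢₃-connected {G = G} G∈
described⇒connected {G = G} no-isolated (inj₂ (inj₂ (inj₂ (inj₂ G≅))))     =
  connected-iso {G = G} {bowtie} G≅ bowtie-connected

theorem3p1 : ∀ {c ℓ} (R : CommutativeRing c ℓ) →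
    (let open CommutativeRing R in ¬ (1# ≈ 0#)) →
    ∀ {n} (G : Graph n) →
    NoIsolatedVertices G →
    matchingComplex G HasDim (+ 1) →
    (CohenMacaulay R (matchingComplex G) ⇔
    (TwoTriangleOrStarComponents G ⊎ InFamiliesOrBowtie G)) ×
    (Buchsbaum R (matchingComplex G) ⇔
    ((TwoTriangleOrStarComponents G ⊎ InFamiliesOrBowtie G) ⊎ G ≅ complete 4 ⊎ G ≅ C₄))
theorem3p1 R 1≉0 G no-isolated dim1 =
    mk⇔ (λ cm → [ (λ described → described)
                , [ (λ G≅K₄ → contradiction cm (not-cm (complete 4) G≅K₄ (λ ()) (λ ())))
                  , (λ G≅C₄ → contradiction cm (not-cm C₄ G≅C₄ (from-yes (adj? C₄ 0F 1F)) (from-yes (adj? C₄ 1F 2F)))) ]′ ]′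
                  (classify (proj₁ cm)))
        (λ described → connected⇒cohenMacaulay G dim1 R (described⇒connected {G = G} no-isolated described))
  , mk⇔ classify
        (partnered⇒buchsbaum G dim1 R ∘
          [ connected⇒partnered G ∘ described⇒connected {G = G} no-isolated
          , [ (λ G≅K₄ → partnered-iso {G = G} {complete 4} G≅K₄ K₄-partnered)
            , (λ G≅C₄ → partnered-iso {G = G} {C₄} G≅C₄ C₄-partnered) ]′ ]′)
  where
  not-cm : ∀ (H : Graph 4) → G ≅ H → Adj H 0F 1F → Adj H 1F 2F → ¬ CohenMacaulay R (matchingComplex G)
  not-cm H = four-vertices-not-cohenMacaulay R 1≉0 {G = G} dim1 H
  classify : Buchsbaum R (matchingComplex G) →
             (TwoTriangleOrStarComponents G ⊎ InFamiliesOrBowtie G) ⊎ G ≅ complete 4 ⊎ G ≅ C₄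
  classify (pure , _) = Classification.classification G no-isolated
    (no-three-disjoint G dim1) (pure⇒partnered G dim1 pure) (two-disjoint G dim1)
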